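{- (a) $K1/N1$ has a basis adapted to $T_7$ and $T_{13}$ with $m_{0,0}$ the class of $F$. (b) $K5/N1$ has a basis adapted to $T_7$ and $T_{13}$ with $m_{0,0}$ the class of $F^2G$.
   Context: $\mathbb{Z}/2[[x]]$ is the formal power series ring over the field with two elements. Let $r=\sum_{n>0}(x^{n^2}+x^{2n^2}+x^{3n^2}+x^{6n^2})$, $\mathbb{Z}/2[r]\subset\mathbb{Z}/2[[x]]$ the subring it generates, $F=r(r+1)^3$, $G=r^3(r+1)$. Let $K1$, $K5$, $N1$ be the free $\mathbb{Z}/2[G^2]$-submodules of $\mathbb{Z}/2[r]$ with bases $\{G,F\}$, $\{G,F^2G\}$, $\{G\}$ respectively. For primes $p>3$, $T_p(\sum a_nx^n)=\sum a_{pn}x^n+\sum a_nx^{pn}$; $T_7$ and $T_{13}$ map $K1$, $K5$ and $N1$ into themselves, hence act on $K1/N1$ and $K5/N1$. A basis of a $\mathbb{Z}/2$-vector space $V$ adapted to commuting operators $X,Y$ is a $\mathbb{Z}/2$-basis $\{m_{i,j}\}_{i,j\ge 0}$ with $Xm_{i,j}=m_{i-1,j}$ for $i>0$, $Xm_{0,j}=0$, $Ym_{i,j}=m_{i,j-1}$ for $j>0$, $Ym_{i,0}=0$. -}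

module Defs where

open import Data.Bool using (Bool; true; false; _xor_; _∧_; if_then_else_)
open import Data.Nat using (ℕ; zero; suc; _+_; _*_; _∸_; _≡ᵇ_; NonZero)
open import Data.Nat.DivMod using (_/_; _%_)
open import Data.List using (List; []; _∷_; map; foldr; upTo)
open import Data.Product using (_×_; _,_; ∃; ∃-syntax)
open import Relation.Binary.PropositionalEquality using (_≡_)
open import Data.List.Relation.Unary.Unique.Propositional using (Unique)

-- Formal power series over ℤ/2: coefficient functions ℕ → Bool
-- (true = 1, false = 0; addition = xor, multiplication = ∧).
PS : Set
PS = ℕ → Bool

_≈_ : PS → PS → Set
f ≈ g = ∀ n → f n ≡ g n

infix 4 _≈_
infixl 6 _⊕_
infixl 7 _⊛_

zeroPS : PS
zeroPS _ = false

constPS : Bool → PS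
constPS b zero = b
constPS b (suc _) = false

_⊕_ : PS → PS → PS
(f ⊕ g) n = f n xor g n

xorSum : List Bool → Bool
xorSum = foldr _xor_ false

_⊛_ : PS → PS → PS
(f ⊛ g) n = xorSum (map (λ k → f k ∧ g (n ∸ k)) (upTo (suc n)))

xPS : PS
xPS (suc zero) = true
xPS _ = false

evalPoly : List Bool → PS → PS
evalPoly [] s = zeroPS
evalPoly (c ∷ cs) s = constPS c ⊕ s ⊛ evalPoly cs s

-- r = Σ_{m>0} (x^{m²} + x^{2m²} + x^{3m²} + x^{6m²});
-- coefficient of x^n is the parity of #{(c,m) : c ∈ {1,2,3,6}, m ≥ 1, c·m² = n}
-- (any such m satisfies m ≤ n, so m ranges over 1..n).
r : PS
r n = xorSum (map (λ m → xorSum (map (λ c → (c * (m * m)) ≡ᵇ n) (1 ∷ 2 ∷ 3 ∷ 6 ∷ [])))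
                  (map suc (upTo n)))

oneP : PS
oneP = constPS true

F : PS
F = r ⊛ ((r ⊕ oneP) ⊛ (r ⊕ oneP) ⊛ (r ⊕ oneP))

G : PS
G = (r ⊛ r ⊛ r) ⊛ (r ⊕ oneP)

G² : PS
G² = G ⊛ G

-- Hecke operator T_p(Σ aₙxⁿ) = Σ a_{pn} xⁿ + Σ aₙ x^{pn}
T : (p : ℕ) → .{{NonZero p}} → PS → PS
T p f n = f (p * n) xor (if (n % p) ≡ᵇ 0 then f (n / p) else false)

-- membership in the Z/2[G²]-submodules of Z/2[r]
-- K1 = G·Z/2[G²] ⊕ F·Z/2[G²]
inK1 : PS → Set
inK1 s = ∃[ a ] ∃[ b ] (s ≈ (G ⊛ evalPoly a G² ⊕ F ⊛ evalPoly b G²))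

inK5 : PS → Set
inK5 s = ∃[ a ] ∃[ b ] (s ≈ (G ⊛ evalPoly a G² ⊕ (F ⊛ F ⊛ G) ⊛ evalPoly b G²))

inN1 : PS → Set
inN1 s = ∃[ a ] (s ≈ G ⊛ evalPoly a G²)

sumFam : (ℕ → ℕ → PS) → List (ℕ × ℕ) → PS
sumFam m [] = zeroPS
sumFam m ((i , j) ∷ l) = m i j ⊕ sumFam m l

-- {[m i j]} is a basis of V/N (V, N given by membership predicates, N ⊆ V)
-- adapted to the operators X, Y (which preserve V and N).
-- Classes are represented by elements of V; [s] = [t] iff s ⊕ t ∈ N.
record AdaptedBasis (inV inN : PS → Set) (X Y : PS → PS) (m : ℕ → ℕ → PS) : Set where
  field
    mem    : ∀ i j → inV (m i j)
    X-suc  : ∀ i j → inN (X (m (suc i) j) ⊕ m i j)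
    X-zero : ∀ j → inN (X (m zero j))
    Y-suc  : ∀ i j → inN (Y (m i (suc j)) ⊕ m i j)
    Y-zero : ∀ i → inN (Y (m i zero))
    indep  : ∀ (l : List (ℕ × ℕ)) → Unique l → inN (sumFam m l) → l ≡ []
    span   : ∀ s → inV s → ∃[ l ] inN (s ⊕ sumFam m l)

{-# OPTIONS --safe #-}
module Submission where

-- With th c = Σ_{k ∈ ℤ} x^(c (4k+1)²), identities between theta series, proved by reparametrising ℤ²,
-- show F = th 1 and G = th 3 and give modular equations between r(x) and r(x^p) for p = 7 and 13.
-- Since T p (f · V p g) involves g only as a factor, such an equation is a linear recurrence for T p (rⁿ) over
-- 𝔽₂[r], and, with y = G², one for T p (B yⁿ) over 𝔽₂[y], for B = F and B = F² G modulo N1.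
-- By the recurrence, the four sections of the matrix of T p by the parities of its indices are again matrices of
-- this kind, and finitely many of them occur. An induction along these sections shows that, for n with
-- Nicolas–Serre code (a , b), T 7 lowers a by one and T 13 lowers b by one, up to terms of smaller 2 a + 3 b.
-- The commuting operators T 7 and T 13 are thus perturbations of the partial shifts; compatible pairs of targets
-- have common preimages, which successively give the adapted basis.

-- Closure under sections is an effect of characteristic 2: when a recurrence is applied twice, the
-- cross terms cancel, and the same recurrence holds with all indices and degrees doubled. A section
-- of a solution thus solves the original recurrence and is fixed by its first window, so an
-- equality of infinite matrices becomes a finite comparison. Halving n sends its code (a , b) to (b
-- , half of a). The only weight that this transports up to a factor is a + √2 b. Two rational
-- approximations are used in alternation: 2 a + 3 b turns into 3 a + 4 b, and 3 a + 4 b into twice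
-- 2 a + 3 b. The induction therefore has to carry a drop for both. The bounds alone do not make X v
-- = f and Y v = g solvable. The lowering operators A and B have a common preimage of f and g only
-- if B f = A g, whereas the available condition Y f = X g yields this only up to lower terms. The
-- commutation of T 7 and T 13 keeps the condition valid after each correction, and the excess of
-- the drops over 2 and 3 makes the corrections terminate.

open import Defs
open import Algebra.Bundles using (CommutativeRing)
import Algebra.Properties.AbelianGroup
import Algebra.Properties.CommutativeSemigroup
import Algebra.Properties.Semiring.Exp
open import Algebra.Structures using (IsCommutativeRing)
open import Data.Bool using (Bool; true; false; _xor_; _∧_; _∨_; not; if_then_else_)
open import Data.Bool.Properties using (xor-assoc; xor-comm; xor-identityʳ; xor-same; ∧-assoc; ∧-comm; ∧-identityʳ; ∧-zeroʳ; ∧-idem; ∧-distribˡ-xor; ∧-distribʳ-xor)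
open import Data.Bool.Solver using (module xor-∧-Solver)
open import Data.Empty using (⊥; ⊥-elim)
open import Data.Fin using (Fin; zero; suc)
open import Data.Integer using (ℤ; +_; -[1+_]; ∣_∣; 1ℤ) renaming (_+_ to _+ᶻ_; _*_ to _*ᶻ_; -_ to -ᶻ_; _-_ to _-ᶻ_)
open import Data.Integer.Divisibility.Signed using (∣ᵤ⇒∣) renaming (divides to dividesᶻ)
import Data.Integer.Properties as ℤₚ
open import Data.Integer.Tactic.RingSolver using (solve-∀)
open import Data.List using (List; []; _∷_; map; upTo; _++_; drop; length; filter; concat; cartesianProduct)
open import Data.List.Membership.Propositional using (_∈_)
open import Data.List.Membership.Propositional.Properties using (∈-map⁺; ∈-map⁻; ∈-++⁺ˡ; ∈-++⁺ʳ; ∈-++⁻; ∈-filter⁺; ∈-filter⁻; ∈-upTo⁺; ∈-upTo⁻; ∈-cartesianProduct⁺; ∈-cartesianProduct⁻; ∈-concat⁺′; ∈-concat⁻′)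
open import Data.List.Membership.Propositional.Properties.WithK using (unique∧set⇒bag)
import Data.List.Properties as Lₚ
open import Data.List.Relation.Binary.BagAndSetEquality using (∼bag⇒↭)
open import Data.List.Relation.Binary.Permutation.Propositional.Properties using (↭-length)
open import Data.List.Relation.Unary.All using (All; []; _∷_)
import Data.List.Relation.Unary.All as All
import Data.List.Relation.Unary.All.Properties as Allₚ
open import Data.List.Relation.Unary.AllPairs using (AllPairs; []; _∷_)
import Data.List.Relation.Unary.AllPairs as AllPairs
import Data.List.Relation.Unary.AllPairs.Properties as AllPairsₚ
open import Data.List.Relation.Unary.Any using (here; there)
open import Data.List.Relation.Unary.Unique.Propositional using (Unique)
import Data.List.Relation.Unary.Unique.Propositional.Properties as Uniqueₚ
open import Data.Maybe using (Maybe; just; nothing)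
import Data.Maybe as Maybe
open import Data.Nat using (ℕ; zero; suc; _+_; _*_; _∸_; _≤_; _<_; z≤n; s≤s; _≡ᵇ_; _≤ᵇ_; _<ᵇ_; NonZero)
open import Data.Nat.Coprimality using (Coprime; coprime-divisor; coprime?)
open import Data.Nat.DivMod using (_/_; _%_)
import Data.Nat.DivMod as DM
open import Data.Nat.Divisibility using (_∣_; divides; _∣?_; m%n≡0⇒n∣m)
open import Data.Nat.Primality using (Prime; prime?; euclidsLemma)
import Data.Nat.Properties as ℕₚ
import Data.Nat.Tactic.RingSolver as ℕ-Solver
open import Data.Product using (_×_; _,_; ∃-syntax; proj₁; proj₂)
open import Data.Sum using (_⊎_; inj₁; inj₂; [_,_]′)
open import Data.Unit using (tt)
open import Data.Vec using (Vec; []; _∷_; lookup)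
open import Function using (_∘_; id; case_of_)
open import Function.Bundles using (mk⇔)
import Relation.Binary.Reasoning.Setoid
open import Relation.Binary.PropositionalEquality using (_≡_; _≢_; refl; sym; trans; cong; cong₂; subst; subst₂; module ≡-Reasoning)
open import Relation.Nullary using (¬_; yes; no; does)
open import Relation.Nullary.Decidable using (from-yes)
open import Relation.Unary using (Decidable)

module ℤ-Group = Algebra.Properties.AbelianGroup ℤₚ.+-0-abelianGroup

-- The ring of power series

-- A record, so that the two sides can be recovered by unification.
record _≃_ (f g : PS) : Set where
  constructor mk
  field at : f ≈ g
open _≃_ public

infix 4 _≃_

xor-interchange : ∀ a b c d → (a xor b) xor (c xor d) ≡ (a xor c) xor (b xor d)
xor-interchange = solve 4 (λ a b c d → (a :+ b) :+ (c :+ d) := (a :+ c) :+ (b :+ d)) refl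
  where open xor-∧-Solver

tl : PS → PS
tl f n = f (suc n)

sh : PS → PS
sh f zero = false
sh f (suc n) = f n

scale : Bool → PS → PS
scale c f n = c ∧ f n

⊛-head : ∀ f g → (f ⊛ g) 0 ≡ f 0 ∧ g 0
⊛-head f g = xor-identityʳ _

⊛-suc : ∀ f g n → (f ⊛ g) (suc n) ≡ (f 0 ∧ g (suc n)) xor (tl f ⊛ g) n
⊛-suc f g n = cong (λ l → (f 0 ∧ g (suc n)) xor xorSum l)
  (trans (Lₚ.map-applyUpTo suc (λ k → f k ∧ g (suc n ∸ k)) (suc n))
         (sym (Lₚ.map-applyUpTo id (λ k → tl f k ∧ g (n ∸ k)) (suc n))))

⊛-cong′ : ∀ {f f′ g g′} → f ≈ f′ → g ≈ g′ → f ⊛ g ≈ f′ ⊛ g′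
⊛-cong′ {f} {f′} {g} {g′} p q zero rewrite ⊛-head f g | ⊛-head f′ g′ = cong₂ _∧_ (p 0) (q 0)
⊛-cong′ {f} {f′} {g} {g′} p q (suc n) rewrite ⊛-suc f g n | ⊛-suc f′ g′ n =
  cong₂ _xor_ (cong₂ _∧_ (p 0) (q (suc n))) (⊛-cong′ (λ k → p (suc k)) q n)

⊛-suc′ : ∀ f g n → (f ⊛ g) (suc n) ≡ (f ⊛ tl g) n xor (f (suc n) ∧ g 0)
⊛-suc′ f g zero rewrite ⊛-suc f g 0 | ⊛-head (tl f) g | ⊛-head f (tl g) = refl
⊛-suc′ f g (suc n) rewrite ⊛-suc f g (suc n) | ⊛-suc′ (tl f) g n | ⊛-suc f (tl g) n =
  sym (xor-assoc (f 0 ∧ g (suc (suc n))) ((tl f ⊛ tl g) n) (f (suc (suc n)) ∧ g 0))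

⊛-comm′ : ∀ f g → f ⊛ g ≈ g ⊛ f
⊛-comm′ f g zero rewrite ⊛-head f g | ⊛-head g f = ∧-comm (f 0) (g 0)
⊛-comm′ f g (suc n) rewrite ⊛-suc f g n | ⊛-suc′ g f n =
  trans (cong₂ _xor_ (∧-comm (f 0) (g (suc n))) (⊛-comm′ (tl f) g n)) (xor-comm (g (suc n) ∧ f 0) ((g ⊛ tl f) n))

⊛-distribʳ′ : ∀ h f g → (f ⊕ g) ⊛ h ≈ f ⊛ h ⊕ g ⊛ h
⊛-distribʳ′ h f g zero rewrite ⊛-head (f ⊕ g) h | ⊛-head f h | ⊛-head g h = ∧-distribʳ-xor (h 0) (f 0) (g 0)
⊛-distribʳ′ h f g (suc n) rewrite ⊛-suc (f ⊕ g) h n | ⊛-suc f h n | ⊛-suc g h n | ⊛-distribʳ′ h (tl f) (tl g) n =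
  solve 5 (λ a b c d e → (a :+ b) :* c :+ (d :+ e) := (a :* c :+ d) :+ (b :* c :+ e)) refl
    (f 0) (g 0) (h (suc n)) ((tl f ⊛ h) n) ((tl g ⊛ h) n)
  where open xor-∧-Solver

scale-⊛ : ∀ c f g → scale c f ⊛ g ≈ scale c (f ⊛ g)
scale-⊛ c f g zero rewrite ⊛-head (scale c f) g | ⊛-head f g = ∧-assoc c (f 0) (g 0)
scale-⊛ c f g (suc n) rewrite ⊛-suc (scale c f) g n | ⊛-suc f g n | scale-⊛ c (tl f) g n =
  solve 4 (λ c a b d → (c :* a) :* b :+ c :* d := c :* (a :* b :+ d)) refl c (f 0) (g (suc n)) ((tl f ⊛ g) n)
  where open xor-∧-Solver

zero-⊛ : ∀ f → zeroPS ⊛ f ≈ zeroPS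
zero-⊛ f zero = refl
zero-⊛ f (suc n) rewrite ⊛-suc zeroPS f n = zero-⊛ f n

⊛-assoc′ : ∀ f g h → (f ⊛ g) ⊛ h ≈ f ⊛ (g ⊛ h)
⊛-assoc′ f g h zero rewrite ⊛-head (f ⊛ g) h | ⊛-head f (g ⊛ h) | ⊛-head f g | ⊛-head g h = ∧-assoc (f 0) (g 0) (h 0)
⊛-assoc′ f g h (suc n) = begin
  ((f ⊛ g) ⊛ h) (suc n)
    ≡⟨ ⊛-suc (f ⊛ g) h n ⟩
  ((f ⊛ g) 0 ∧ h (suc n)) xor (tl (f ⊛ g) ⊛ h) n
    ≡⟨ cong₂ (λ a b → (a ∧ h (suc n)) xor b) (⊛-head f g)
         (trans (⊛-cong′ {tl (f ⊛ g)} {scale (f 0) (tl g) ⊕ tl f ⊛ g} {h} (⊛-suc f g) (λ _ → refl) n)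
         (trans (⊛-distribʳ′ h (scale (f 0) (tl g)) (tl f ⊛ g) n)
                (cong₂ _xor_ (scale-⊛ (f 0) (tl g) h n) (⊛-assoc′ (tl f) g h n)))) ⟩
  ((f 0 ∧ g 0) ∧ h (suc n)) xor ((f 0 ∧ (tl g ⊛ h) n) xor (tl f ⊛ (g ⊛ h)) n)
    ≡⟨ solve 5 (λ a b c d e → (a :* b) :* c :+ (a :* d :+ e) := a :* (b :* c :+ d) :+ e) refl
         (f 0) (g 0) (h (suc n)) ((tl g ⊛ h) n) ((tl f ⊛ (g ⊛ h)) n) ⟩
  (f 0 ∧ ((g 0 ∧ h (suc n)) xor (tl g ⊛ h) n)) xor (tl f ⊛ (g ⊛ h)) n
    ≡⟨ cong (λ a → (f 0 ∧ a) xor (tl f ⊛ (g ⊛ h)) n) (⊛-suc g h n) ⟨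
  (f 0 ∧ (g ⊛ h) (suc n)) xor (tl f ⊛ (g ⊛ h)) n
    ≡⟨ ⊛-suc f (g ⊛ h) n ⟨
  (f ⊛ (g ⊛ h)) (suc n) ∎
  where open ≡-Reasoning
        open xor-∧-Solver using (solve; _:+_; _:*_; _:=_)

one-⊛ : ∀ f → oneP ⊛ f ≈ f
one-⊛ f zero = ⊛-head oneP f
one-⊛ f (suc n) rewrite ⊛-suc oneP f n = trans (cong (f (suc n) xor_) (zero-⊛ f n)) (xor-identityʳ _)

infixl 6 _⊞_
infixl 7 _⊠_

-- Opaque copies of the operations: unification then never unfolds the convolution.
opaque
  _⊞_ _⊠_ : PS → PS → PS
  _⊞_ = _⊕_
  _⊠_ = _⊛_

  ⊞-at : ∀ f g n → (f ⊞ g) n ≡ f n xor g n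
  ⊞-at f g n = refl

  ⊠-at : ∀ f g n → (f ⊠ g) n ≡ (f ⊛ g) n
  ⊠-at f g n = refl

opaque
  unfolding _⊞_

  ⊞-⊠-isCommutativeRing : IsCommutativeRing _≃_ _⊞_ _⊠_ id zeroPS oneP
  ⊞-⊠-isCommutativeRing = record
      { isRing = record
        { +-isAbelianGroup = record
          { isGroup = record
            { isMonoid = record
              { isSemigroup = record
                { isMagma = record
                  { isEquivalence = record
                    { refl = mk λ _ → refl
                    ; sym = λ p → mk λ n → sym (at p n)
                    ; trans = λ p q → mk λ n → trans (at p n) (at q n) }
                  ; ∙-cong = λ p q → mk λ n → cong₂ _xor_ (at p n) (at q n) }
                ; assoc = λ f g h → mk λ n → xor-assoc (f n) (g n) (h n) }
              ; identity = (λ f → mk λ n → refl) , (λ f → mk λ n → xor-identityʳ (f n)) }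
            ; inverse = (λ f → mk λ n → xor-same (f n)) , (λ f → mk λ n → xor-same (f n))
            ; ⁻¹-cong = id }
          ; comm = λ f g → mk λ n → xor-comm (f n) (g n) }
        ; *-cong = λ p q → mk (⊛-cong′ (at p) (at q))
        ; *-assoc = λ f g h → mk (⊛-assoc′ f g h)
        ; *-identity = (λ f → mk (one-⊛ f)) , (λ f → mk λ n → trans (⊛-comm′ f oneP n) (one-⊛ f n))
        ; distrib = (λ f g h → mk λ n → trans (⊛-comm′ f (g ⊕ h) n) (trans (⊛-distribʳ′ f g h n)
                        (cong₂ _xor_ (⊛-comm′ g f n) (⊛-comm′ h f n))))
                  , (λ f g h → mk (⊛-distribʳ′ f g h)) }
      ; *-comm = λ f g → mk (⊛-comm′ f g) }

PSRing : CommutativeRing _ _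
PSRing = record { isCommutativeRing = ⊞-⊠-isCommutativeRing }

module R = CommutativeRing PSRing

constPS-+ : ∀ a b → constPS (a xor b) ≃ constPS a ⊞ constPS b
constPS-+ a b = mk λ { zero → sym (⊞-at (constPS a) (constPS b) 0) ; (suc n) → sym (⊞-at (constPS a) (constPS b) (suc n)) }

constPS-zero : constPS false ≃ zeroPS
constPS-zero = mk λ { zero → refl ; (suc _) → refl }

constPS-⊠ : ∀ c f → constPS c ⊠ f ≃ scale c f
constPS-⊠ true f = R.*-identityˡ f
constPS-⊠ false f = R.trans (R.*-congʳ constPS-zero) (R.zeroˡ f)

constPS-* : ∀ a b → constPS (a ∧ b) ≃ constPS a ⊠ constPS b
constPS-* a b = mk λ { zero → sym (at (constPS-⊠ a (constPS b)) 0)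
                     ; (suc n) → sym (trans (at (constPS-⊠ a (constPS b)) (suc n)) (∧-zeroʳ a)) }

open Algebra.Properties.Semiring.Exp R.semiring using (_^_; ^-homo-*) public
module ≃-Reasoning = Relation.Binary.Reasoning.Setoid R.setoid

-- Normalisation of polynomial expressions in characteristic 2

module CSP = Algebra.Properties.CommutativeSemigroup R.+-commutativeSemigroup

-- Dense Horner form: a polynomial in n + 1 variables is the list of its coefficients, themselves
-- polynomials in n variables. No normal form is required, since only vanishing is ever tested.
Nested : ℕ → Set
Nested zero = Bool
Nested (suc n) = List (Nested n)

con : ∀ n → Bool → Nested n
con zero c = c
con (suc n) c = con n c ∷ []

add : ∀ n → Nested n → Nested n → Nested n
add zero a b = a xor b
add (suc n) [] q = q
add (suc n) (a ∷ p) [] = a ∷ p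
add (suc n) (a ∷ p) (b ∷ q) = add n a b ∷ add (suc n) p q

mul : ∀ n → Nested n → Nested n → Nested n
scaleBy : ∀ n → Nested n → List (Nested n) → List (Nested n)
mul zero a b = a ∧ b
mul (suc n) [] q = []
mul (suc n) (a ∷ p) q = add (suc n) (scaleBy n a q) (con n false ∷ mul (suc n) p q)
scaleBy n a [] = []
scaleBy n a (b ∷ q) = mul n a b ∷ scaleBy n a q

pow : ∀ n → Nested n → ℕ → Nested n
pow n p zero = con n true
pow n p (suc k) = mul n p (pow n p k)

gen : ∀ n → Fin n → Nested n
gen (suc n) zero = con n false ∷ con n true ∷ []
gen (suc n) (suc i) = gen n i ∷ []

isZero : ∀ n → Nested n → Bool
isZero zero a = true xor a
isZero (suc n) [] = true
isZero (suc n) (a ∷ p) = isZero n a ∧ isZero (suc n) p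

eval : ∀ n → Vec PS n → Nested n → PS
eval zero ρ c = constPS c
eval (suc n) ρ [] = zeroPS
eval (suc n) (x ∷ ρ) (a ∷ p) = eval n ρ a ⊞ x ⊠ eval (suc n) (x ∷ ρ) p

+-interchange : ∀ a b c d → (a ⊞ b) ⊞ (c ⊞ d) ≃ (a ⊞ c) ⊞ (b ⊞ d)
+-interchange = CSP.interchange

+-self : ∀ a → a ⊞ a ≃ zeroPS
+-self a = mk λ n → trans (⊞-at a a n) (xor-same (a n))

eval-con : ∀ n ρ c → eval n ρ (con n c) ≃ constPS c
eval-con zero ρ c = R.refl
eval-con (suc n) (x ∷ ρ) c = R.trans (R.+-cong (eval-con n ρ c) (R.zeroʳ x)) (R.+-identityʳ _)

eval-add : ∀ n ρ p q → eval n ρ (add n p q) ≃ eval n ρ p ⊞ eval n ρ q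
eval-add zero ρ a b = constPS-+ a b
eval-add (suc n) (x ∷ ρ) [] q = R.sym (R.+-identityˡ _)
eval-add (suc n) (x ∷ ρ) (a ∷ p) [] = R.sym (R.+-identityʳ _)
eval-add (suc n) (x ∷ ρ) (a ∷ p) (b ∷ q) = R.trans
  (R.+-cong (eval-add n ρ a b) (R.trans (R.*-congˡ (eval-add (suc n) (x ∷ ρ) p q)) (R.distribˡ x _ _)))
  (+-interchange _ _ _ _)

eval-mul : ∀ n ρ p q → eval n ρ (mul n p q) ≃ eval n ρ p ⊠ eval n ρ q
eval-scaleBy : ∀ n x ρ a q → eval (suc n) (x ∷ ρ) (scaleBy n a q) ≃ eval n ρ a ⊠ eval (suc n) (x ∷ ρ) q
eval-mul zero ρ a b = constPS-* a b
eval-mul (suc n) (x ∷ ρ) [] q = R.sym (R.zeroˡ _)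
eval-mul (suc n) (x ∷ ρ) (a ∷ p) q = begin
  eval (suc n) (x ∷ ρ) (add (suc n) (scaleBy n a q) (con n false ∷ mul (suc n) p q))
    ≈⟨ eval-add (suc n) (x ∷ ρ) (scaleBy n a q) _ ⟩
  eval (suc n) (x ∷ ρ) (scaleBy n a q) ⊞ (eval n ρ (con n false) ⊞ x ⊠ eval (suc n) (x ∷ ρ) (mul (suc n) p q))
    ≈⟨ R.+-cong (eval-scaleBy n x ρ a q) (R.trans (R.+-cong (R.trans (eval-con n ρ false) constPS-zero)
         (R.trans (R.*-congˡ (eval-mul (suc n) (x ∷ ρ) p q)) (R.sym (R.*-assoc x _ _)))) (R.+-identityˡ _)) ⟩
  eval n ρ a ⊠ eval (suc n) (x ∷ ρ) q ⊞ (x ⊠ eval (suc n) (x ∷ ρ) p) ⊠ eval (suc n) (x ∷ ρ) q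
    ≈⟨ R.sym (R.distribʳ _ _ _) ⟩
  (eval n ρ a ⊞ x ⊠ eval (suc n) (x ∷ ρ) p) ⊠ eval (suc n) (x ∷ ρ) q ∎
  where open ≃-Reasoning
eval-scaleBy n x ρ a [] = R.sym (R.zeroʳ _)
eval-scaleBy n x ρ a (b ∷ q) = begin
  eval n ρ (mul n a b) ⊞ x ⊠ eval (suc n) (x ∷ ρ) (scaleBy n a q)
    ≈⟨ R.+-cong (eval-mul n ρ a b) (R.trans (R.*-congˡ (eval-scaleBy n x ρ a q))
         (R.trans (R.sym (R.*-assoc _ _ _)) (R.trans (R.*-congʳ (R.*-comm x _)) (R.*-assoc _ _ _)))) ⟩
  eval n ρ a ⊠ eval n ρ b ⊞ eval n ρ a ⊠ (x ⊠ eval (suc n) (x ∷ ρ) q)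
    ≈⟨ R.sym (R.distribˡ _ _ _) ⟩
  eval n ρ a ⊠ (eval n ρ b ⊞ x ⊠ eval (suc n) (x ∷ ρ) q) ∎
  where open ≃-Reasoning

eval-pow : ∀ n ρ p k → eval n ρ (pow n p k) ≃ eval n ρ p ^ k
eval-pow n ρ p zero = eval-con n ρ true
eval-pow n ρ p (suc k) = R.trans (eval-mul n ρ p (pow n p k)) (R.*-congˡ (eval-pow n ρ p k))

eval-gen : ∀ n ρ i → eval n ρ (gen n i) ≃ lookup ρ i
eval-gen (suc n) (x ∷ ρ) zero = begin
  eval n ρ (con n false) ⊞ x ⊠ (eval n ρ (con n true) ⊞ x ⊠ zeroPS)
    ≈⟨ R.+-cong (R.trans (eval-con n ρ false) constPS-zero)
         (R.*-congˡ (R.trans (R.+-cong (eval-con n ρ true) (R.zeroʳ x)) (R.+-identityʳ _))) ⟩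
  zeroPS ⊞ x ⊠ oneP
    ≈⟨ R.trans (R.+-identityˡ _) (R.*-identityʳ x) ⟩
  x ∎
  where open ≃-Reasoning
eval-gen (suc n) (x ∷ ρ) (suc i) = R.trans (R.+-cong (eval-gen n ρ i) (R.zeroʳ x)) (R.+-identityʳ _)

isZero-sound : ∀ n ρ p → isZero n p ≡ true → eval n ρ p ≃ zeroPS
isZero-sound zero ρ false _ = constPS-zero
isZero-sound (suc n) ρ [] _ = R.refl
isZero-sound (suc n) (x ∷ ρ) (a ∷ p) z with isZero n a in za
... | true = R.trans (R.+-cong (isZero-sound n ρ a za) (R.trans (R.*-congˡ (isZero-sound (suc n) (x ∷ ρ) p z)) (R.zeroʳ x))) (R.+-identityʳ _)

infixl 6 _:+_
infixl 7 _:*_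
infixr 8 _:^_

data Expr (n : ℕ) : Set where
  :var : Fin n → Expr n
  :con : Bool → Expr n
  _:+_ _:*_ : Expr n → Expr n → Expr n
  _:^_ : Expr n → ℕ → Expr n

pattern :x = :var zero
pattern :y = :var (suc zero)
pattern :z = :var (suc (suc zero))
pattern :w = :var (suc (suc (suc zero)))
pattern :a = :var (suc (suc (suc (suc zero))))
pattern :b = :var (suc (suc (suc (suc (suc zero)))))
pattern :1 = :con true

⟦_⟧ᵉ : ∀ {n} → Expr n → Vec PS n → PS
⟦ :var i ⟧ᵉ ρ = lookup ρ i
⟦ :con c ⟧ᵉ ρ = constPS c
⟦ a :+ b ⟧ᵉ ρ = ⟦ a ⟧ᵉ ρ ⊞ ⟦ b ⟧ᵉ ρ
⟦ a :* b ⟧ᵉ ρ = ⟦ a ⟧ᵉ ρ ⊠ ⟦ b ⟧ᵉ ρ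
⟦ a :^ k ⟧ᵉ ρ = ⟦ a ⟧ᵉ ρ ^ k

normalise : ∀ {n} → Expr n → Nested n
normalise (:var i) = gen _ i
normalise (:con c) = con _ c
normalise (a :+ b) = add _ (normalise a) (normalise b)
normalise (a :* b) = mul _ (normalise a) (normalise b)
normalise (a :^ k) = pow _ (normalise a) k

^-cong : ∀ {f g} k → f ≃ g → f ^ k ≃ g ^ k
^-cong zero p = R.refl
^-cong (suc k) p = R.*-cong p (^-cong k p)

normalise-sound : ∀ {n} ρ (e : Expr n) → eval n ρ (normalise e) ≃ ⟦ e ⟧ᵉ ρ
normalise-sound ρ (:var i) = eval-gen _ ρ i
normalise-sound ρ (:con c) = eval-con _ ρ c
normalise-sound ρ (a :+ b) = R.trans (eval-add _ ρ (normalise a) _) (R.+-cong (normalise-sound ρ a) (normalise-sound ρ b))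
normalise-sound ρ (a :* b) = R.trans (eval-mul _ ρ (normalise a) _) (R.*-cong (normalise-sound ρ a) (normalise-sound ρ b))
normalise-sound ρ (a :^ k) = R.trans (eval-pow _ ρ (normalise a) k) (^-cong k (normalise-sound ρ a))

⊞-zero⇒≃ : ∀ {f g} → f ⊞ g ≃ zeroPS → f ≃ g
⊞-zero⇒≃ {f} {g} p = mk λ n → xor-zero (f n) (g n) (trans (sym (⊞-at f g n)) (at p n))
  where
  xor-zero : ∀ a b → a xor b ≡ false → a ≡ b
  xor-zero false b q = sym q
  xor-zero true true q = refl

-- In characteristic 2 an equality is the vanishing of a sum, so one zero test by evaluation decides
-- it. The hypothesis is always discharged by `refl`.
ring : ∀ {n} (ρ : Vec PS n) (e e′ : Expr n) → isZero n (normalise (e :+ e′)) ≡ true → ⟦ e ⟧ᵉ ρ ≃ ⟦ e′ ⟧ᵉ ρ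
ring ρ e e′ z = ⊞-zero⇒≃ (R.trans (R.sym (normalise-sound ρ (e :+ e′))) (isZero-sound _ ρ _ z))

-- Shifts and the operators U, V and T

⊛-at-sh : ∀ f g → (sh f ⊛ g) ≈ sh (f ⊛ g)
⊛-at-sh f g zero = ⊛-head (sh f) g
⊛-at-sh f g (suc n) = ⊛-suc (sh f) g n

sh-⊠ : ∀ f g → sh f ⊠ g ≃ sh (f ⊠ g)
sh-⊠ f g = mk λ { zero → trans (⊠-at (sh f) g 0) (⊛-at-sh f g 0)
                ; (suc n) → trans (⊠-at (sh f) g (suc n)) (trans (⊛-at-sh f g (suc n)) (sym (⊠-at f g n))) }

sh-⊞ : ∀ f g → sh (f ⊞ g) ≃ sh f ⊞ sh g
sh-⊞ f g = mk λ { zero → sym (⊞-at (sh f) (sh g) 0) ; (suc n) → trans (⊞-at f g n) (sym (⊞-at (sh f) (sh g) (suc n))) }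

sh-cong : ∀ {f g} → f ≃ g → sh f ≃ sh g
sh-cong p = mk λ { zero → refl ; (suc n) → at p n }

sh-zero : sh zeroPS ≃ zeroPS
sh-zero = mk λ { zero → refl ; (suc n) → refl }

shN : ℕ → PS → PS
shN zero f = f
shN (suc k) f = sh (shN k f)

shN-cong : ∀ k {f g} → f ≃ g → shN k f ≃ shN k g
shN-cong zero p = p
shN-cong (suc k) p = sh-cong (shN-cong k p)

shN-⊞ : ∀ k f g → shN k (f ⊞ g) ≃ shN k f ⊞ shN k g
shN-⊞ zero f g = R.refl
shN-⊞ (suc k) f g = R.trans (sh-cong (shN-⊞ k f g)) (sh-⊞ (shN k f) (shN k g))

shN-⊠ : ∀ k f g → shN k f ⊠ g ≃ shN k (f ⊠ g)
shN-⊠ zero f g = R.refl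
shN-⊠ (suc k) f g = R.trans (sh-⊠ (shN k f) g) (sh-cong (shN-⊠ k f g))

shN-local : ∀ k {f g} n → (∀ m → m < n → f m ≡ g m) → shN (suc k) f n ≡ shN (suc k) g n
shN-local k zero p = refl
shN-local zero (suc n) p = p n ℕₚ.≤-refl
shN-local (suc k) (suc n) p = shN-local k n λ m q → p m (ℕₚ.m<n⇒m<1+n q)

shN-+ : ∀ k f n → shN k f (k + n) ≡ f n
shN-+ zero f n = refl
shN-+ (suc k) f n = shN-+ k f n

shN-< : ∀ k f n → n < k → shN k f n ≡ false
shN-< (suc k) f zero p = refl
shN-< (suc k) f (suc n) (s≤s p) = shN-< k f n p

split-head : ∀ f → f ≃ constPS (f 0) ⊞ sh (tl f)
split-head f = mk λ { zero → sym (trans (⊞-at (constPS (f 0)) (sh (tl f)) 0) (xor-identityʳ _))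
                    ; (suc n) → sym (⊞-at (constPS (f 0)) (sh (tl f)) (suc n)) }

-- The shift by `suc k` makes each coefficient depend only on earlier ones, so a recursion of this
-- kind along `tl` has a unique solution. The product rules for `V` and `U` and the Frobenius
-- identity all follow from it, without reindexing any convolution sum.
≃-coind : ∀ (A B Z : PS → PS) k → (∀ f → A f ≃ Z f ⊞ shN (suc k) (A (tl f))) →
          (∀ f → B f ≃ Z f ⊞ shN (suc k) (B (tl f))) → ∀ f → A f ≃ B f
≃-coind A B Z k a b f = mk λ n → go (suc n) n ℕₚ.≤-refl f
  where
  go : ∀ N n → n < N → ∀ f → A f n ≡ B f n
  go (suc N) n (s≤s q) f = begin
    A f n ≡⟨ trans (at (a f) n) (⊞-at (Z f) _ n) ⟩
    Z f n xor shN (suc k) (A (tl f)) n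
      ≡⟨ cong (Z f n xor_) (shN-local k n λ m m<n → go N m (ℕₚ.<-≤-trans m<n q) (tl f)) ⟩
    Z f n xor shN (suc k) (B (tl f)) n ≡⟨ trans (at (b f) n) (⊞-at (Z f) _ n) ⟨
    B f n ∎
    where open ≡-Reasoning

unit-cancel : ∀ g → g 0 ≡ true → ∀ n f → (∀ k → k ≤ n → (f ⊛ g) k ≡ false) → f n ≡ false
unit-cancel g g0 n f z = go n f z
  where
  f0 : ∀ f → (f ⊛ g) 0 ≡ false → f 0 ≡ false
  f0 f p = trans (sym (∧-identityʳ (f 0))) (trans (cong (f 0 ∧_) (sym g0)) (trans (sym (⊛-head f g)) p))
  go : ∀ n f → (∀ k → k ≤ n → (f ⊛ g) k ≡ false) → f n ≡ false
  go zero f z = f0 f (z 0 z≤n)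
  go (suc n) f z = go n (tl f) λ k k≤n →
    trans (sym (trans (⊛-suc f g k) (cong (λ b → (b ∧ g (suc k)) xor (tl f ⊛ g) k) (f0 f (z 0 z≤n))))) (z (suc k) (s≤s k≤n))

-- Power series over a field form a domain: `tl` strips the leading zeros of `g` until its constant
-- term is 1, and then the coefficients of `f` vanish one after the other. Nonvanishing of `g` is
-- witnessed by a single coefficient, which later uses compute.
⊠-cancelʳ-zero : ∀ n {f} g → g n ≡ true → f ⊠ g ≃ zeroPS → f ≃ zeroPS
⊠-cancelʳ-zero zero {f} g g0 p = mk λ n → unit-cancel g g0 n f λ k _ → trans (sym (⊠-at f g k)) (at p k)
⊠-cancelʳ-zero (suc n) {f} g gn p with g 0 in g0
... | true = ⊠-cancelʳ-zero zero g g0 p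
... | false = ⊠-cancelʳ-zero n (tl g) gn (mk λ m → trans (sym (shifted m)) (at p (suc m)))
  where
  shifted : ∀ m → (f ⊠ g) (suc m) ≡ (f ⊠ tl g) m
  shifted m = trans (⊠-at f g (suc m)) (trans (⊛-suc′ f g m)
    (trans (cong (λ b → (f ⊛ tl g) m xor (f (suc m) ∧ b)) g0)
    (trans (cong ((f ⊛ tl g) m xor_) (∧-zeroʳ (f (suc m)))) (trans (xor-identityʳ _) (sym (⊠-at f (tl g) m))))))

⊠-cancelʳ : ∀ n {f f′} g → g n ≡ true → f ⊠ g ≃ f′ ⊠ g → f ≃ f′
⊠-cancelʳ n {f} {f′} g gn p = ⊞-zero⇒≃ (⊠-cancelʳ-zero n g gn
  (R.trans (R.distribʳ g f f′) (R.trans (R.+-congʳ p) (+-self (f′ ⊠ g)))))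

V U : (p : ℕ) → .{{NonZero p}} → PS → PS
V p f n = if (n % p) ≡ᵇ 0 then f (n / p) else false
U p f n = f (p * n)

T≃U⊞V : ∀ p → .{{_ : NonZero p}} → ∀ f → T p f ≃ U p f ⊞ V p f
T≃U⊞V p f = mk λ n → sym (⊞-at (U p f) (V p f) n)

V-cong : ∀ p → .{{_ : NonZero p}} → ∀ {f g} → f ≃ g → V p f ≃ V p g
V-cong p e = mk λ n → cong (λ b → if (n % p) ≡ᵇ 0 then b else false) (at e (n / p))

U-cong : ∀ p → .{{_ : NonZero p}} → ∀ {f g} → f ≃ g → U p f ≃ U p g
U-cong p e = mk λ n → at e (p * n)

V-⊞ : ∀ p → .{{_ : NonZero p}} → ∀ f g → V p (f ⊞ g) ≃ V p f ⊞ V p g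
V-⊞ p f g = mk λ n → trans (if-xor′ ((n % p) ≡ᵇ 0) (⊞-at f g (n / p))) (sym (⊞-at (V p f) (V p g) n))
  where
  if-xor′ : ∀ b {x y z} → z ≡ x xor y → (if b then z else false) ≡ (if b then x else false) xor (if b then y else false)
  if-xor′ false e = refl
  if-xor′ true e = e

U-⊞ : ∀ p → .{{_ : NonZero p}} → ∀ f g → U p (f ⊞ g) ≃ U p f ⊞ U p g
U-⊞ p f g = mk λ n → trans (⊞-at f g (p * n)) (sym (⊞-at (U p f) (U p g) n))

V-sh : ∀ k f → V (suc k) (sh f) ≃ shN (suc k) (V (suc k) f)
V-sh k f = mk go
  where
  p = suc k
  go : ∀ n → V p (sh f) n ≡ shN p (V p f) n
  go n with ℕₚ.<-≤-connex n p
  go zero | inj₁ _ = refl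
  go (suc n) | inj₁ n<p rewrite DM.m<n⇒m%n≡m n<p = sym (shN-< p (V p f) (suc n) n<p)
  go n | inj₂ p≤n = begin
    (if (n % p) ≡ᵇ 0 then sh f (n / p) else false)
      ≡⟨ cong₂ (λ a b → if a ≡ᵇ 0 then sh f b else false) (sym (DM.m≤n⇒[n∸m]%m≡n%m p≤n)) (DM.m/n≡1+[m∸n]/n p≤n) ⟩
    V p f (n ∸ p) ≡⟨ shN-+ p (V p f) (n ∸ p) ⟨
    shN p (V p f) (p + (n ∸ p)) ≡⟨ cong (shN p (V p f)) (ℕₚ.m+[n∸m]≡n p≤n) ⟩
    shN p (V p f) n ∎
    where open ≡-Reasoning

V-const : ∀ p → .{{_ : NonZero p}} → ∀ c → V p (constPS c) ≃ constPS c
V-const p@(suc k) c = mk go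
  where
  go : ∀ n → V p (constPS c) n ≡ constPS c n
  go zero = refl
  go (suc n) with suc n % p in e | suc n / p in e′
  ... | suc _ | _ = refl
  ... | zero | suc _ = refl
  ... | zero | zero with () ← trans (DM.m≡m%n+[m/n]*n (suc n) p) (cong₂ (λ a b → a + b * p) e e′)

V-split : ∀ k f → V (suc k) f ≃ constPS (f 0) ⊞ shN (suc k) (V (suc k) (tl f))
V-split k f = R.trans (V-cong (suc k) (split-head f)) (R.trans (V-⊞ (suc k) (constPS (f 0)) (sh (tl f)))
  (R.+-cong (V-const (suc k) (f 0)) (V-sh k (tl f))))

split-⊠ : ∀ f g → f ⊠ g ≃ constPS (f 0) ⊠ g ⊞ sh (tl f ⊠ g)
split-⊠ f g = R.trans (R.*-congʳ (split-head f)) (R.trans (R.distribʳ g (constPS (f 0)) (sh (tl f))) (R.+-congˡ (sh-⊠ (tl f) g)))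

V-scale : ∀ p → .{{_ : NonZero p}} → ∀ c f → V p (constPS c ⊠ f) ≃ constPS c ⊠ V p f
V-scale p true f = R.trans (V-cong p (R.*-identityˡ f)) (R.sym (R.*-identityˡ _))
V-scale p false f = R.trans (V-cong p (R.trans (R.*-congʳ constPS-zero) (R.trans (R.zeroˡ f) (R.sym constPS-zero))))
  (R.trans (V-const p false) (R.trans constPS-zero (R.sym (R.trans (R.*-congʳ constPS-zero) (R.zeroˡ _)))))

V-⊠ : ∀ p → .{{_ : NonZero p}} → ∀ f g → V p (f ⊠ g) ≃ V p f ⊠ V p g
V-⊠ p@(suc k) f g = ≃-coind (λ f → V p (f ⊠ g)) (λ f → V p f ⊠ V p g) (λ f → constPS (f 0) ⊠ V p g) k lhs rhs f
  where
  lhs : ∀ f → V p (f ⊠ g) ≃ constPS (f 0) ⊠ V p g ⊞ shN p (V p (tl f ⊠ g))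
  lhs f = R.trans (V-cong p (split-⊠ f g)) (R.trans (V-⊞ p (constPS (f 0) ⊠ g) (sh (tl f ⊠ g)))
    (R.+-cong (V-scale p (f 0) g) (V-sh k (tl f ⊠ g))))
  rhs : ∀ f → V p f ⊠ V p g ≃ constPS (f 0) ⊠ V p g ⊞ shN p (V p (tl f) ⊠ V p g)
  rhs f = R.trans (R.*-congʳ (V-split k f)) (R.trans (R.distribʳ (V p g) (constPS (f 0)) _)
    (R.+-congˡ (shN-⊠ p (V p (tl f)) (V p g))))

V-^ : ∀ p → .{{_ : NonZero p}} → ∀ f n → V p (f ^ n) ≃ V p f ^ n
V-^ p f zero = V-const p true
V-^ p f (suc n) = R.trans (V-⊠ p f (f ^ n)) (R.*-congˡ (V-^ p f n))

-- The cross terms of a square cancel in characteristic 2, which leaves the substitution of x² for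
-- x. Squaring thereby commutes with `T p` for odd p, and it doubles the index of a theta series.
frobenius : ∀ f → f ⊠ f ≃ V 2 f
frobenius = ≃-coind (λ f → f ⊠ f) (V 2) (λ f → constPS (f 0)) 1 lhs (V-split 1)
  where
  lhs : ∀ f → f ⊠ f ≃ constPS (f 0) ⊞ shN 2 (tl f ⊠ tl f)
  lhs f = begin
    f ⊠ f ≈⟨ R.*-cong (split-head f) (split-head f) ⟩
    (c ⊞ s) ⊠ (c ⊞ s) ≈⟨ ring (c ∷ s ∷ []) ((:x :+ :y) :* (:x :+ :y)) (:x :* :x :+ :y :* :y) refl ⟩
    c ⊠ c ⊞ s ⊠ s ≈⟨ R.+-cong (R.trans (R.sym (constPS-* (f 0) (f 0))) (mk λ n → cong (λ b → constPS b n) (∧-idem (f 0))))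
                        (R.trans (sh-⊠ (tl f) s) (sh-cong (R.trans (R.*-comm (tl f) s) (sh-⊠ (tl f) (tl f))))) ⟩
    c ⊞ shN 2 (tl f ⊠ tl f) ∎
    where
    open ≃-Reasoning
    c = constPS (f 0)
    s = sh (tl f)

U-sh : ∀ k h → U (suc k) (shN (suc k) h) ≃ sh (U (suc k) h)
U-sh k h = mk λ { zero → trans (cong (shN (suc k) h) (ℕₚ.*-zeroʳ (suc k))) refl
                ; (suc n) → trans (cong (shN (suc k) h) (ℕₚ.*-suc (suc k) n)) (shN-+ (suc k) h (suc k * n)) }

U-scale : ∀ p → .{{_ : NonZero p}} → ∀ c f → U p (constPS c ⊠ f) ≃ constPS c ⊠ U p f
U-scale p c f = mk λ n → trans (at (constPS-⊠ c f) (p * n)) (sym (at (constPS-⊠ c (U p f)) n))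

-- The projection formula: `V p g` lives on multiples of p, so the coefficients of the product at
-- multiples of p involve only those coefficients of `f`.
U-⊠-V : ∀ p → .{{_ : NonZero p}} → ∀ f g → U p (f ⊠ V p g) ≃ U p f ⊠ g
U-⊠-V p@(suc k) f g = ≃-coind (λ g → U p (f ⊠ V p g)) (λ g → U p f ⊠ g) (λ g → constPS (g 0) ⊠ U p f) 0 lhs rhs g
  where
  lhs : ∀ g → U p (f ⊠ V p g) ≃ constPS (g 0) ⊠ U p f ⊞ sh (U p (f ⊠ V p (tl g)))
  lhs g = begin
    U p (f ⊠ V p g)
      ≈⟨ U-cong p (R.trans (R.*-congˡ (V-split k g)) (R.trans (R.*-comm f _)
           (R.trans (R.distribʳ f (constPS (g 0)) _) (R.+-congˡ (R.trans (shN-⊠ p (V p (tl g)) f) (shN-cong p (R.*-comm _ f))))))) ⟩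
    U p (constPS (g 0) ⊠ f ⊞ shN p (f ⊠ V p (tl g)))
      ≈⟨ R.trans (U-⊞ p (constPS (g 0) ⊠ f) _) (R.+-cong (U-scale p (g 0) f) (U-sh k (f ⊠ V p (tl g)))) ⟩
    constPS (g 0) ⊠ U p f ⊞ sh (U p (f ⊠ V p (tl g))) ∎
    where open ≃-Reasoning
  rhs : ∀ g → U p f ⊠ g ≃ constPS (g 0) ⊠ U p f ⊞ sh (U p f ⊠ tl g)
  rhs g = R.trans (R.*-comm (U p f) g) (R.trans (split-⊠ g (U p f)) (R.+-congˡ (sh-cong (R.*-comm (tl g) (U p f)))))

T-cong : ∀ p → .{{_ : NonZero p}} → ∀ {f g} → f ≃ g → T p f ≃ T p g
T-cong p {f} {g} e = R.trans (T≃U⊞V p f) (R.trans (R.+-cong (U-cong p e) (V-cong p e)) (R.sym (T≃U⊞V p g)))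

T-⊞ : ∀ p → .{{_ : NonZero p}} → ∀ f g → T p (f ⊞ g) ≃ T p f ⊞ T p g
T-⊞ p f g = R.trans (T≃U⊞V p (f ⊞ g)) (R.trans (R.+-cong (U-⊞ p f g) (V-⊞ p f g))
  (R.trans (+-interchange (U p f) (U p g) (V p f) (V p g)) (R.sym (R.+-cong (T≃U⊞V p f) (T≃U⊞V p g)))))

T-zero : ∀ p → .{{_ : NonZero p}} → ∀ {f} → f ≃ zeroPS → T p f ≃ zeroPS
T-zero p {f} e = R.trans (T-cong p e) (mk λ n → if-false ((n % p) ≡ᵇ 0))
  where
  if-false : ∀ b → (if b then false else false) ≡ false
  if-false false = refl
  if-false true = refl

V-multiple : ∀ q → .{{_ : NonZero q}} → ∀ f k → V q f (k * q) ≡ f k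
V-multiple q f k = cong₂ (λ a b → if a ≡ᵇ 0 then f b else false) (DM.m*n%n≡0 k q) (DM.m*n/n≡m k q)

V-nonmultiple : ∀ q → .{{_ : NonZero q}} → ∀ f n → ¬ (q ∣ n) → V q f n ≡ false
V-nonmultiple q f n q∤n with n % q in e
... | zero = ⊥-elim (q∤n (m%n≡0⇒n∣m n q e))
... | suc _ = refl

V-unique : ∀ q → .{{_ : NonZero q}} → ∀ f h → (∀ k → h (k * q) ≡ f k) → (∀ n → ¬ (q ∣ n) → h n ≡ false) → V q f ≃ h
V-unique q f h on off = mk go
  where
  go : ∀ n → V q f n ≡ h n
  go n with q ∣? n
  ... | yes (divides k refl) = trans (V-multiple q f k) (sym (on k))
  ... | no q∤n = trans (V-nonmultiple q f n q∤n) (sym (off n q∤n))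

V-U-comm : ∀ p q → .{{_ : NonZero p}} → .{{_ : NonZero q}} → Coprime q p → ∀ f → V q (U p f) ≃ U p (V q f)
V-U-comm p q c f = V-unique q (U p f) (U p (V q f))
  (λ k → trans (cong (V q f) (sym (ℕₚ.*-assoc p k q))) (V-multiple q f (p * k)))
  (λ n q∤n → V-nonmultiple q f (p * n) (q∤n ∘ coprime-divisor c))

V-V-comm : ∀ p q → .{{_ : NonZero p}} → .{{_ : NonZero q}} → Coprime q p → ∀ f → V p (V q f) ≃ V q (V p f)
V-V-comm p q c f = V-unique p (V q f) (V q (V p f)) on off
  where
  on : ∀ k → V q (V p f) (k * p) ≡ V q f k
  on k with q ∣? k
  ... | yes (divides j refl) = begin
    V q (V p f) (j * q * p)
      ≡⟨ cong (V q (V p f)) (trans (ℕₚ.*-assoc j q p) (trans (cong (j *_) (ℕₚ.*-comm q p)) (sym (ℕₚ.*-assoc j p q)))) ⟩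
    V q (V p f) (j * p * q) ≡⟨ trans (V-multiple q (V p f) (j * p)) (V-multiple p f j) ⟩
    f j ≡⟨ V-multiple q f j ⟨
    V q f (j * q) ∎
    where open ≡-Reasoning
  ... | no q∤k = trans (V-nonmultiple q (V p f) (k * p)
      (λ d → q∤k (coprime-divisor c (subst (q ∣_) (ℕₚ.*-comm k p) d)))) (sym (V-nonmultiple q f k q∤k))
  off : ∀ n → ¬ (p ∣ n) → V q (V p f) n ≡ false
  off n p∤n with q ∣? n
  ... | yes (divides j refl) = trans (V-multiple q (V p f) j)
      (V-nonmultiple p f j λ { (divides i refl) → p∤n (divides (i * q)
        (trans (ℕₚ.*-assoc i p q) (trans (cong (i *_) (ℕₚ.*-comm p q)) (sym (ℕₚ.*-assoc i q p))))) })
  ... | no q∤n = V-nonmultiple q (V p f) n q∤n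

U-U-comm : ∀ p q → .{{_ : NonZero p}} → .{{_ : NonZero q}} → ∀ f → U p (U q f) ≃ U q (U p f)
U-U-comm p q f = mk λ n → cong f (trans (sym (ℕₚ.*-assoc q p n)) (trans (cong (_* n) (ℕₚ.*-comm q p)) (ℕₚ.*-assoc p q n)))

T-V-comm : ∀ p q → .{{_ : NonZero p}} → .{{_ : NonZero q}} → Coprime q p → ∀ f → T p (V q f) ≃ V q (T p f)
T-V-comm p q c f = R.trans (T≃U⊞V p (V q f)) (R.trans (R.+-cong (R.sym (V-U-comm p q c f)) (V-V-comm p q c f))
  (R.trans (R.sym (V-⊞ q (U p f) (V p f))) (V-cong q (R.sym (T≃U⊞V p f)))))

T-T-comm : ∀ p q → .{{_ : NonZero p}} → .{{_ : NonZero q}} → Coprime p q → Coprime q p → ∀ f → T p (T q f) ≃ T q (T p f)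
T-T-comm p q c c′ f = begin
  T p (T q f) ≈⟨ T-cong p (T≃U⊞V q f) ⟩
  T p (U q f ⊞ V q f) ≈⟨ T-⊞ p (U q f) (V q f) ⟩
  T p (U q f) ⊞ T p (V q f) ≈⟨ R.+-cong (T≃U⊞V p (U q f)) (T-V-comm p q c′ f) ⟩
  (U p (U q f) ⊞ V p (U q f)) ⊞ V q (T p f) ≈⟨ R.+-congʳ (R.+-cong (U-U-comm p q f) (V-U-comm q p c f)) ⟩
  (U q (U p f) ⊞ U q (V p f)) ⊞ V q (T p f) ≈⟨ R.+-congʳ (R.trans (R.sym (U-⊞ q (U p f) (V p f))) (U-cong q (R.sym (T≃U⊞V p f)))) ⟩
  U q (T p f) ⊞ V q (T p f) ≈⟨ R.sym (T≃U⊞V q (T p f)) ⟩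
  T q (T p f) ∎
  where open ≃-Reasoning

-- This gives `T p` on even powers of r from the exponents half as large, which turns the linear
-- recurrence into quadratic equations for the unknown values.
T-square : ∀ p → .{{_ : NonZero p}} → Coprime 2 p → ∀ f → T p (f ⊠ f) ≃ T p f ⊠ T p f
T-square p c f = R.trans (T-cong p (frobenius f)) (R.trans (T-V-comm p 2 c f) (R.sym (frobenius (T p f))))

square-zero : ∀ {f} → f ⊠ f ≃ zeroPS → f ≃ zeroPS
square-zero {f} e = mk λ n → trans (sym (V-multiple 2 f n)) (at (R.trans (R.sym (frobenius f)) e) (n * 2))

sumPS : {A : Set} → (A → PS) → List A → PS
sumPS h [] = zeroPS
sumPS h (a ∷ l) = h a ⊞ sumPS h l

U-sumPS : ∀ p → .{{_ : NonZero p}} → ∀ {A : Set} (h : A → PS) l → U p (sumPS h l) ≃ sumPS (U p ∘ h) l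
U-sumPS p h [] = R.refl
U-sumPS p h (a ∷ l) = R.trans (U-⊞ p (h a) (sumPS h l)) (R.+-congˡ (U-sumPS p h l))

sumPS-cong : ∀ {A : Set} {h h′ : A → PS} → (∀ a → h a ≃ h′ a) → ∀ l → sumPS h l ≃ sumPS h′ l
sumPS-cong e [] = R.refl
sumPS-cong e (a ∷ l) = R.+-cong (e a) (sumPS-cong e l)

sumPS-⊞ : ∀ {A : Set} (h h′ : A → PS) l → sumPS (λ a → h a ⊞ h′ a) l ≃ sumPS h l ⊞ sumPS h′ l
sumPS-⊞ h h′ [] = R.sym (R.+-identityˡ zeroPS)
sumPS-⊞ h h′ (a ∷ l) = R.trans (R.+-congˡ (sumPS-⊞ h h′ l)) (+-interchange (h a) (h′ a) (sumPS h l) (sumPS h′ l))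

⊠-sumPS : ∀ {A : Set} g (h : A → PS) l → g ⊠ sumPS h l ≃ sumPS (λ a → g ⊠ h a) l
⊠-sumPS g h [] = R.zeroʳ g
⊠-sumPS g h (a ∷ l) = R.trans (R.distribˡ g (h a) (sumPS h l)) (R.+-congˡ (⊠-sumPS g h l))

-- A symmetric relation between s and V p s turns, through U (f · V g) = U f · g,
-- into a linear recurrence for n ↦ T p (f · sⁿ) over the polynomials in s.
T-relation : ∀ p → .{{_ : NonZero p}} → ∀ {A : Set} (a b : A → PS) l →
  sumPS (λ i → a i ⊠ V p (b i)) l ≃ zeroPS → sumPS (λ i → b i ⊠ V p (a i)) l ≃ zeroPS →
  ∀ f → sumPS (λ i → b i ⊠ T p (f ⊠ a i)) l ≃ zeroPS
T-relation p a b l e e′ f = begin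
  sumPS (λ i → b i ⊠ T p (f ⊠ a i)) l
    ≈⟨ sumPS-cong (λ i → R.trans (R.*-congˡ (T≃U⊞V p (f ⊠ a i))) (R.distribˡ (b i) (U p (f ⊠ a i)) (V p (f ⊠ a i)))) l ⟩
  sumPS (λ i → b i ⊠ U p (f ⊠ a i) ⊞ b i ⊠ V p (f ⊠ a i)) l
    ≈⟨ sumPS-⊞ _ _ l ⟩
  sumPS (λ i → b i ⊠ U p (f ⊠ a i)) l ⊞ sumPS (λ i → b i ⊠ V p (f ⊠ a i)) l
    ≈⟨ R.+-cong u v ⟩
  zeroPS ⊞ zeroPS
    ≈⟨ R.+-identityˡ zeroPS ⟩
  zeroPS ∎
  where
  open ≃-Reasoning
  u : sumPS (λ i → b i ⊠ U p (f ⊠ a i)) l ≃ zeroPS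
  u = begin
    sumPS (λ i → b i ⊠ U p (f ⊠ a i)) l
      ≈⟨ sumPS-cong (λ i → R.trans (R.*-comm (b i) _) (R.trans (R.sym (U-⊠-V p (f ⊠ a i) (b i)))
           (U-cong p (R.*-assoc f (a i) (V p (b i)))))) l ⟩
    sumPS (λ i → U p (f ⊠ (a i ⊠ V p (b i)))) l
      ≈⟨ U-sumPS p _ l ⟨
    U p (sumPS (λ i → f ⊠ (a i ⊠ V p (b i))) l)
      ≈⟨ U-cong p (R.trans (R.sym (⊠-sumPS f _ l)) (R.trans (R.*-congˡ e) (R.zeroʳ f))) ⟩
    U p zeroPS
      ≈⟨ R.refl ⟩
    zeroPS ∎
  v : sumPS (λ i → b i ⊠ V p (f ⊠ a i)) l ≃ zeroPS
  v = begin
    sumPS (λ i → b i ⊠ V p (f ⊠ a i)) l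
      ≈⟨ sumPS-cong (λ i → R.trans (R.*-congˡ (V-⊠ p f (a i))) (x∙yz≈y∙xz (b i) (V p f) (V p (a i)))) l ⟩
    sumPS (λ i → V p f ⊠ (b i ⊠ V p (a i))) l
      ≈⟨ ⊠-sumPS (V p f) _ l ⟨
    V p f ⊠ sumPS (λ i → b i ⊠ V p (a i)) l
      ≈⟨ R.trans (R.*-congˡ e′) (R.zeroʳ (V p f)) ⟩
    zeroPS ∎
    where open import Algebra.Properties.CommutativeSemigroup R.*-commutativeSemigroup using (x∙yz≈y∙xz)

-- Generating functions of weights

odd : ℕ → Bool
odd zero = false
odd (suc n) = true xor odd n

odd-+ : ∀ m n → odd (m + n) ≡ odd m xor odd n
odd-+ zero n = refl
odd-+ (suc m) n = trans (cong (true xor_) (odd-+ m n)) (sym (xor-assoc true (odd m) (odd n)))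

odd-* : ∀ m n → odd (m * n) ≡ odd m ∧ odd n
odd-* zero n = refl
odd-* (suc m) n = trans (odd-+ n (m * n)) (trans (cong (odd n xor_) (odd-* m n)) (lemma (odd m) (odd n)))
  where
  lemma : ∀ a b → b xor (a ∧ b) ≡ (true xor a) ∧ b
  lemma false b = xor-identityʳ b
  lemma true false = refl
  lemma true true = refl

-- f is the generating function Σ_i x^(w i) of the weight w.
record Gen {I : Set} (w : I → ℕ) (f : PS) : Set where
  field
    fib : ℕ → List I
    uniq : ∀ n → Unique (fib n)
    sound : ∀ {n i} → i ∈ fib n → w i ≡ n
    complete : ∀ i → i ∈ fib (w i)
    series : ∀ n → f n ≡ odd (length (fib n))
  complete′ : ∀ {n} i → w i ≡ n → i ∈ fib n
  complete′ i refl = complete i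
open Gen public

module _ {I : Set} where

  -- Two duplicate-free enumerations of the same fibre are permutations of each other and have the
  -- same parity. Every identity of theta series below is thereby reduced to a bijection that
  -- preserves weights.
  Gen-unique : {w w′ : I → ℕ} {f f′ : PS} → Gen w f → Gen w′ f′ → (∀ i → w i ≡ w′ i) → f ≃ f′
  Gen-unique g g′ e = mk λ n → trans (series g n) (trans (cong odd (↭-length (∼bag⇒↭
    (unique∧set⇒bag (uniq g n) (uniq g′ n)
      (mk⇔ (λ p → complete′ g′ _ (trans (sym (e _)) (sound g p)))
           (λ p → complete′ g _ (trans (e _) (sound g′ p)))))))) (sym (series g′ n)))

  Gen-resp : {w : I → ℕ} {f f′ : PS} → f ≃ f′ → Gen w f → Gen w f′
  Gen-resp e g = record { fib = fib g ; uniq = uniq g ; sound = sound g ; complete = complete g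
    ; series = λ n → trans (sym (at e n)) (series g n) }

  Gen-enum : (w : I → ℕ) (enum : ℕ → List I) → (∀ n → Unique (enum n)) → (∀ i → i ∈ enum (w i)) →
             Gen w (λ n → odd (length (filter (λ i → w i ℕₚ.≟ n) (enum n))))
  Gen-enum w enum u c = record
    { fib = λ n → filter (λ i → w i ℕₚ.≟ n) (enum n)
    ; uniq = λ n → Uniqueₚ.filter⁺ (λ i → w i ℕₚ.≟ n) (u n)
    ; sound = λ {n} p → proj₂ (∈-filter⁻ (λ i → w i ℕₚ.≟ n) {xs = enum n} p)
    ; complete = λ i → ∈-filter⁺ (λ j → w j ℕₚ.≟ w i) (c i) refl
    ; series = λ n → refl }

  Gen-V : ∀ {w : I → ℕ} {f} c → .{{_ : NonZero c}} → Gen w f → Gen (λ i → w i * c) (V c f)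
  Gen-V {w} {f} c g = record { fib = fib′ ; uniq = uniq′ ; sound = λ {n} → sound′ n ; complete = complete″ ; series = series′ }
    where
    fib′ : ℕ → List I
    fib′ n with c ∣? n
    ... | yes d = fib g (_∣_.quotient d)
    ... | no _ = []
    uniq′ : ∀ n → Unique (fib′ n)
    uniq′ n with c ∣? n
    ... | yes d = uniq g _
    ... | no _ = []
    sound′ : ∀ n {i} → i ∈ fib′ n → w i * c ≡ n
    sound′ n p with c ∣? n
    ... | yes (divides q e) = trans (cong (_* c) (sound g p)) (sym e)
    complete″ : ∀ i → i ∈ fib′ (w i * c)
    complete″ i with c ∣? (w i * c)
    ... | yes (divides q e) = complete′ g i (ℕₚ.*-cancelʳ-≡ (w i) q c e)
    ... | no c∤ = ⊥-elim (c∤ (divides (w i) refl))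
    series′ : ∀ n → V c f n ≡ odd (length (fib′ n))
    series′ n with c ∣? n
    ... | yes (divides q refl) = trans (V-multiple c f q) (series g q)
    ... | no c∤ = V-nonmultiple c f n c∤

module _ {I J : Set} where

  pull : (I → Maybe J) → List I → List J
  pull d [] = []
  pull d (i ∷ l) with d i
  ... | just j = j ∷ pull d l
  ... | nothing = pull d l

  module Pull (φ : J → I) (d : I → Maybe J) (d-φ : ∀ j → d (φ j) ≡ just j) (φ-d : ∀ i {j} → d i ≡ just j → φ j ≡ i) where

    ∈-pull⁺ : ∀ {j} l → φ j ∈ l → j ∈ pull d l
    ∈-pull⁺ {j} (i ∷ l) (here refl) rewrite d-φ j = here refl
    ∈-pull⁺ (i ∷ l) (there p) with d i
    ... | just _ = there (∈-pull⁺ l p)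
    ... | nothing = ∈-pull⁺ l p

    ∈-pull⁻ : ∀ {j} l → j ∈ pull d l → φ j ∈ l
    ∈-pull⁻ (i ∷ l) p with d i in e
    ∈-pull⁻ (i ∷ l) (here refl) | just _ = here (φ-d i e)
    ∈-pull⁻ (i ∷ l) (there p) | just _ = there (∈-pull⁻ l p)
    ∈-pull⁻ (i ∷ l) p | nothing = there (∈-pull⁻ l p)

    pull-unique : ∀ {l} → Unique l → Unique (pull d l)
    pull-unique {[]} [] = []
    pull-unique {i ∷ l} (i∉ ∷ u) with d i in e
    ... | just j = All.tabulate (λ {k} k∈ j≡k → All.lookup i∉ (∈-pull⁻ l k∈) (trans (sym (φ-d i e)) (cong φ j≡k))) ∷ pull-unique u
    ... | nothing = pull-unique u

    Gen-pull : ∀ {w f} → Gen w f → ∃[ f′ ] Gen (w ∘ φ) f′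
    Gen-pull g = _ , record
      { fib = λ n → pull d (fib g n)
      ; uniq = λ n → pull-unique (uniq g n)
      ; sound = λ p → sound g (∈-pull⁻ _ p)
      ; complete = λ j → ∈-pull⁺ _ (complete g (φ j))
      ; series = λ n → refl }

  Gen-⊎ : ∀ {w : I → ℕ} {w′ : J → ℕ} {f f′} → Gen w f → Gen w′ f′ → Gen [ w , w′ ]′ (f ⊞ f′)
  Gen-⊎ {w} {w′} {f} {f′} g g′ = record
    { fib = λ n → map inj₁ (fib g n) ++ map inj₂ (fib g′ n)
    ; uniq = λ n → Uniqueₚ.++⁺ (Uniqueₚ.map⁺ (λ { refl → refl }) (uniq g n)) (Uniqueₚ.map⁺ (λ { refl → refl }) (uniq g′ n))
        λ (p , q) → case (∈-map⁻ inj₁ p , ∈-map⁻ inj₂ q) of λ { ((_ , _ , refl) , (_ , _ , ())) }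
    ; sound = sound′
    ; complete = λ { (inj₁ i) → ∈-++⁺ˡ (∈-map⁺ inj₁ (complete g i)) ; (inj₂ j) → ∈-++⁺ʳ _ (∈-map⁺ inj₂ (complete g′ j)) }
    ; series = λ n → trans (⊞-at f f′ n) (trans (cong₂ _xor_ (series g n) (series g′ n))
        (sym (trans (cong odd (trans (Lₚ.length-++ (map inj₁ (fib g n)))
          (cong₂ _+_ (Lₚ.length-map inj₁ (fib g n)) (Lₚ.length-map inj₂ (fib g′ n))))) (odd-+ (length (fib g n)) _)))) }
    where
    sound′ : ∀ {n i} → i ∈ map inj₁ (fib g n) ++ map inj₂ (fib g′ n) → [ w , w′ ]′ i ≡ n
    sound′ {n} p with ∈-++⁻ (map inj₁ (fib g n)) p
    ... | inj₁ q with ∈-map⁻ inj₁ q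
    ... | _ , q′ , refl = sound g q′
    sound′ {n} p | inj₂ q with ∈-map⁻ inj₂ q
    ... | _ , q′ , refl = sound g′ q′

  Gen-× : ∀ {w : I → ℕ} {w′ : J → ℕ} {f f′} → Gen w f → Gen w′ f′ → Gen (λ (i , j) → w i + w′ j) (f ⊠ f′)
  Gen-× {w} {w′} {f} {f′} g g′ = record
    { fib = λ n → concat (map (block n) (upTo (suc n)))
    ; uniq = λ n → Uniqueₚ.concat⁺ (Allₚ.map⁺ (All.tabulate λ {k} _ → Uniqueₚ.cartesianProduct⁺ (uniq g k) (uniq g′ (n ∸ k))))
        (AllPairsₚ.map⁺ (AllPairs.map (λ {k} {k′} k≢k′ {v} (p , q) → k≢k′ (trans (sym (sound g (proj₁ (∈-cartesianProduct⁻ (fib g k) _ p))))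
          (sound g (proj₁ (∈-cartesianProduct⁻ (fib g k′) _ q))))) (Uniqueₚ.upTo⁺ (suc n))))
    ; sound = sound′
    ; complete = complete″
    ; series = λ n → trans (⊠-at f f′ n) (series′ n (upTo (suc n))) }
    where
    block : ℕ → ℕ → List (I × J)
    block n k = cartesianProduct (fib g k) (fib g′ (n ∸ k))
    sound′ : ∀ {n v} → v ∈ concat (map (block n) (upTo (suc n))) → w (proj₁ v) + w′ (proj₂ v) ≡ n
    sound′ {n} p with ∈-concat⁻′ (map (block n) (upTo (suc n))) p
    ... | xs , v∈xs , xs∈ with ∈-map⁻ (block n) xs∈
    ... | k , k∈ , refl with ∈-cartesianProduct⁻ (fib g k) (fib g′ (n ∸ k)) v∈xs
    ... | i∈ , j∈ = trans (cong₂ _+_ (sound g i∈) (sound g′ j∈)) (ℕₚ.m+[n∸m]≡n (ℕₚ.m<1+n⇒m≤n (∈-upTo⁻ k∈)))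
    complete″ : ∀ v → v ∈ concat (map (block (w (proj₁ v) + w′ (proj₂ v))) (upTo (suc (w (proj₁ v) + w′ (proj₂ v)))))
    complete″ (i , j) = ∈-concat⁺′ (∈-cartesianProduct⁺ (complete g i) (complete′ g′ j (sym (ℕₚ.m+n∸m≡n (w i) (w′ j)))))
      (∈-map⁺ (block (w i + w′ j)) (∈-upTo⁺ (s≤s (ℕₚ.m≤m+n (w i) (w′ j)))))
    length-× : ∀ (xs : List I) (ys : List J) → length (cartesianProduct xs ys) ≡ length xs * length ys
    length-× [] ys = refl
    length-× (x ∷ xs) ys = trans (Lₚ.length-++ (map (x ,_) ys)) (cong₂ _+_ (Lₚ.length-map (x ,_) ys) (length-× xs ys))
    series′ : ∀ n l → xorSum (map (λ k → f k ∧ f′ (n ∸ k)) l) ≡ odd (length (concat (map (block n) l)))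
    series′ n [] = refl
    series′ n (k ∷ l) = trans (cong₂ _xor_ (trans (cong₂ _∧_ (series g k) (series g′ (n ∸ k)))
        (trans (sym (odd-* (length (fib g k)) _)) (cong odd (sym (length-× (fib g k) (fib g′ (n ∸ k))))))) (series′ n l))
      (sym (trans (cong odd (Lₚ.length-++ (block n k))) (odd-+ (length (block n k)) _)))

Gen-push : ∀ {I J : Set} {w : J → ℕ} {w′ : I → ℕ} {f} (φ : J → I) → (∀ {j j′} → φ j ≡ φ j′ → j ≡ j′) → (∀ i → ∃[ j ] φ j ≡ i) →
           (∀ j → w′ (φ j) ≡ w j) → Gen w f → Gen w′ f
Gen-push {w = w} {w′ = w′} φ inj surj e g = record
  { fib = λ n → map φ (fib g n)
  ; uniq = λ n → Uniqueₚ.map⁺ inj (uniq g n)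
  ; sound = λ p → case ∈-map⁻ φ p of λ { (j , q , refl) → trans (e j) (sound g q) }
  ; complete = complete″
  ; series = λ n → trans (series g n) (cong odd (sym (Lₚ.length-map φ (fib g n)))) }
  where
  complete″ : ∀ i → i ∈ map φ (fib g (w′ i))
  complete″ i with surj i
  ... | j , refl = ∈-map⁺ φ (complete′ g j (sym (e j)))

Gen-reparam : ∀ {I J : Set} {w : I → ℕ} {f} (φ : J → I) (ψ : I → J) → (∀ i → φ (ψ i) ≡ i) → (∀ j → ψ (φ j) ≡ j) → Gen w f → Gen (w ∘ φ) f
Gen-reparam {w = w} φ ψ φψ ψφ = Gen-push ψ (λ {i} {i′} e → trans (sym (φψ i)) (trans (cong φ e) (φψ i′))) (λ j → φ j , ψφ j)
  (λ i → cong w (φψ i))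

-- A partition of I into two parametrised pieces. Constructively, `cover` decides the piece and
-- recovers the parameter, which is what allows the finite fibres over I to be divided.
record Split (I J K : Set) : Set where
  field
    φ : J → I
    ψ : K → I
    φ-inj : ∀ {j j′} → φ j ≡ φ j′ → j ≡ j′
    ψ-inj : ∀ {k k′} → ψ k ≡ ψ k′ → k ≡ k′
    disjoint : ∀ {j k} → φ j ≢ ψ k
    cover : ∀ i → (∃[ j ] φ j ≡ i) ⊎ (∃[ k ] ψ k ≡ i)

  decφ : I → Maybe J
  decφ i = [ (λ (j , _) → just j) , (λ _ → nothing) ]′ (cover i)

  decψ : I → Maybe K
  decψ i = [ (λ _ → nothing) , (λ (k , _) → just k) ]′ (cover i)

  Gen-split : ∀ {w f} → Gen w f → ∃[ f₀ ] ∃[ f₁ ] (Gen (w ∘ φ) f₀ × Gen (w ∘ ψ) f₁ × f ≃ f₀ ⊞ f₁)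
  Gen-split {w} {f} g = proj₁ gφ , proj₁ gψ , proj₂ gφ , proj₂ gψ ,
    Gen-unique g (Gen-push [ φ , ψ ]′ inj surj (λ { (inj₁ j) → refl ; (inj₂ k) → refl }) (Gen-⊎ (proj₂ gφ) (proj₂ gψ))) (λ _ → refl)
    where
    decφ-φ : ∀ j → decφ (φ j) ≡ just j
    decφ-φ j with cover (φ j)
    ... | inj₁ (j′ , e) = cong just (φ-inj e)
    ... | inj₂ (k , e) = ⊥-elim (disjoint (sym e))
    φ-decφ : ∀ i {j} → decφ i ≡ just j → φ j ≡ i
    φ-decφ i e with cover i
    φ-decφ i refl | inj₁ (j , e) = e
    decψ-ψ : ∀ k → decψ (ψ k) ≡ just k
    decψ-ψ k with cover (ψ k)
    ... | inj₁ (j , e) = ⊥-elim (disjoint e)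
    ... | inj₂ (k′ , e) = cong just (ψ-inj e)
    ψ-decψ : ∀ i {k} → decψ i ≡ just k → ψ k ≡ i
    ψ-decψ i e with cover i
    ψ-decψ i refl | inj₂ (k , e) = e
    gφ = Pull.Gen-pull φ decφ decφ-φ φ-decφ g
    gψ = Pull.Gen-pull ψ decψ decψ-ψ ψ-decψ g
    inj : ∀ {s t} → [ φ , ψ ]′ s ≡ [ φ , ψ ]′ t → s ≡ t
    inj {inj₁ _} {inj₁ _} e = cong inj₁ (φ-inj e)
    inj {inj₁ _} {inj₂ _} e = ⊥-elim (disjoint e)
    inj {inj₂ _} {inj₁ _} e = ⊥-elim (disjoint (sym e))
    inj {inj₂ _} {inj₂ _} e = cong inj₂ (ψ-inj e)
    surj : ∀ i → ∃[ s ] [ φ , ψ ]′ s ≡ i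
    surj i with cover i
    ... | inj₁ (j , e) = inj₁ j , e
    ... | inj₂ (k , e) = inj₂ k , e
open Split public using (Gen-split)

-- Theta series

-- The numbers 4 k + 1 represent each odd integer exactly once up to sign, so a sum over k of a
-- function of the square is a sum over the positive odd integers.
ι : ℤ → ℤ
ι k = + 4 *ᶻ k +ᶻ 1ℤ

sq : ℤ → ℕ
sq z = ∣ z *ᶻ z ∣

+sq : ∀ z → + sq z ≡ z *ᶻ z
+sq (+ n) = trans (cong +_ (cong ∣_∣ e)) (sym e)
  where e = ℤₚ.+◃n≡+n (n * n)
+sq -[1+ n ] = refl

ints : ℕ → List ℤ
ints n = map +_ (upTo (suc n)) ++ map -[1+_] (upTo n)

ints-unique : ∀ n → Unique (ints n)
ints-unique n = Uniqueₚ.++⁺ (Uniqueₚ.map⁺ (λ { refl → refl }) (Uniqueₚ.upTo⁺ (suc n))) (Uniqueₚ.map⁺ (λ { refl → refl }) (Uniqueₚ.upTo⁺ n))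
  λ (p , q) → case (∈-map⁻ +_ p , ∈-map⁻ -[1+_] q) of λ { ((_ , _ , refl) , (_ , _ , ())) }

∈-ints : ∀ {n} z → ∣ z ∣ ≤ n → z ∈ ints n
∈-ints (+ m) p = ∈-++⁺ˡ (∈-map⁺ +_ (∈-upTo⁺ (s≤s p)))
∈-ints {n} -[1+ m ] p = ∈-++⁺ʳ (map +_ (upTo (suc n))) (∈-map⁺ -[1+_] (∈-upTo⁺ p))

∣ι∣ : ℤ → ℕ
∣ι∣ (+ n) = 1 + 4 * n
∣ι∣ -[1+ n ] = 3 + 4 * n

∣ι∣-correct : ∀ k → ∣ ι k ∣ ≡ ∣ι∣ k
∣ι∣-correct (+ n) = trans (cong (λ z → ∣ z +ᶻ 1ℤ ∣) (sym (ℤₚ.pos-* 4 n))) (ℕₚ.+-comm (4 * n) 1)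
∣ι∣-correct -[1+ n ] = trans (cong ∣_∣ (trans (ℤₚ.[1+m]⊖[1+n]≡m⊖n 0 (n + 3 * suc n)) (ℤₚ.⊖-≤ {0} {n + 3 * suc n} z≤n)))
  (trans (ℤₚ.∣-i∣≡∣i∣ (+ (n + 3 * suc n))) (trans (cong (λ m → n + m) (ℕₚ.*-suc 3 n)) (trans (sym (ℕₚ.+-assoc n 3 (3 * n))) (trans (cong (_+ 3 * n) (ℕₚ.+-comm n 3)) (ℕₚ.+-assoc 3 n (3 * n))))))

sq-ι : ∀ k → sq (ι k) ≡ ∣ι∣ k * ∣ι∣ k
sq-ι k = trans (ℤₚ.abs-* (ι k) (ι k)) (cong₂ _*_ (∣ι∣-correct k) (∣ι∣-correct k))

∣z∣≤sqι : ∀ z → ∣ z ∣ ≤ sq (ι z)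
∣z∣≤sqι z = subst (∣ z ∣ ≤_) (sym (sq-ι z)) (ℕₚ.≤-trans (le z) (ℕₚ.m≤m*n (∣ι∣ z) (∣ι∣ z) {{nz z}}))
  where
  nz : ∀ z → NonZero (∣ι∣ z)
  nz (+ n) = _
  nz -[1+ n ] = _
  le : ∀ z → ∣ z ∣ ≤ ∣ι∣ z
  le (+ n) = ℕₚ.≤-trans (ℕₚ.m≤n*m n 4) (ℕₚ.n≤1+n (4 * n))
  le -[1+ n ] = s≤s (ℕₚ.≤-trans (ℕₚ.m≤n*m n 4) (ℕₚ.m≤n+m (4 * n) 2))

opaque
  th : ℕ → PS
  th c n = odd (length (filter (λ k → c * sq (ι k) ℕₚ.≟ n) (ints n)))

  Gen-th : ∀ c → .{{_ : NonZero c}} → Gen (λ k → c * sq (ι k)) (th c)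
  Gen-th c = Gen-enum (λ k → c * sq (ι k)) ints ints-unique
    (λ k → ∈-ints k (ℕₚ.≤-trans (∣z∣≤sqι k) (ℕₚ.m≤n*m (sq (ι k)) c)))

wt : ℕ → ℕ → ℤ → ℤ → ℕ
wt a b i j = a * sq i + b * sq j

+wt : ∀ a b i j → + wt a b i j ≡ + a *ᶻ (i *ᶻ i) +ᶻ + b *ᶻ (j *ᶻ j)
+wt a b i j = cong₂ _+ᶻ_ (trans (ℤₚ.pos-* a (sq i)) (cong (+ a *ᶻ_) (+sq i)))
                         (trans (ℤₚ.pos-* b (sq j)) (cong (+ b *ᶻ_) (+sq j)))

wt-0ˡ : ∀ a b i j → i ≡ + 0 → wt a b i j ≡ b * sq j
wt-0ˡ a b _ j refl = cong (_+ b * sq j) (ℕₚ.*-zeroʳ a)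

wt-0ʳ : ∀ a b i j → j ≡ + 0 → wt a b i j ≡ a * sq i
wt-0ʳ a b i _ refl = trans (cong (λ m → a * sq i + m) (ℕₚ.*-zeroʳ b)) (ℕₚ.+-identityʳ _)

2z : ℤ → ℤ
2z a = + 2 *ᶻ a

1+2z : ℤ → ℤ
1+2z a = + 2 *ᶻ a +ᶻ 1ℤ

even≢odd : ∀ a b → 2z a ≢ 1+2z b
even≢odd a b e with ℕₚ.m*n≡1⇒m≡1 2 ∣ a -ᶻ b ∣ (trans (sym (ℤₚ.abs-* (+ 2) (a -ᶻ b))) (cong ∣_∣ e′))
  where
  e′ : + 2 *ᶻ (a -ᶻ b) ≡ 1ℤ
  e′ = trans (lemma a b) (trans (cong (_-ᶻ 2z b) e) (lemma′ b))
    where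
    lemma : ∀ a b → + 2 *ᶻ (a -ᶻ b) ≡ + 2 *ᶻ a -ᶻ + 2 *ᶻ b
    lemma = solve-∀
    lemma′ : ∀ b → (+ 2 *ᶻ b +ᶻ 1ℤ) -ᶻ + 2 *ᶻ b ≡ 1ℤ
    lemma′ = solve-∀
... | ()

parity-ℕ : ∀ n → (∃[ a ] n ≡ 2 * a) ⊎ (∃[ a ] n ≡ suc (2 * a))
parity-ℕ zero = inj₁ (0 , refl)
parity-ℕ (suc n) with parity-ℕ n
... | inj₁ (a , e) = inj₂ (a , cong suc e)
... | inj₂ (a , e) = inj₁ (suc a , trans (cong suc e) (sym (ℕₚ.*-suc 2 a)))

parity-ℤ : ∀ z → (∃[ a ] 2z a ≡ z) ⊎ (∃[ a ] 1+2z a ≡ z)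
parity-ℤ (+ n) with parity-ℕ n
... | inj₁ (a , refl) = inj₁ (+ a , sym (ℤₚ.pos-* 2 a))
... | inj₂ (a , refl) = inj₂ (+ a , trans (cong (_+ᶻ 1ℤ) (sym (ℤₚ.pos-* 2 a))) (cong +_ (ℕₚ.+-comm (2 * a) 1)))
parity-ℤ -[1+ n ] with parity-ℕ n
... | inj₁ (a , refl) = inj₂ (-[1+ a ] , trans (lemma (+ suc a)) (cong -ᶻ_ (trans (cong (_-ᶻ 1ℤ) (trans (sym (ℤₚ.pos-* 2 (suc a))) (cong +_ (ℕₚ.*-suc 2 a)))) refl)))
  where
  lemma : ∀ b → + 2 *ᶻ (-ᶻ b) +ᶻ 1ℤ ≡ -ᶻ (+ 2 *ᶻ b -ᶻ 1ℤ)
  lemma = solve-∀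
... | inj₂ (a , refl) = inj₁ (-[1+ a ] , trans (lemma (+ suc a)) (cong -ᶻ_ (trans (sym (ℤₚ.pos-* 2 (suc a))) (cong +_ (ℕₚ.*-suc 2 a)))))
  where
  lemma : ∀ b → + 2 *ᶻ (-ᶻ b) ≡ -ᶻ (+ 2 *ᶻ b)
  lemma = solve-∀

2z-injective : ∀ {a b} → 2z a ≡ 2z b → a ≡ b
2z-injective {a} {b} e = ℤₚ.*-cancelˡ-≡ (+ 2) a b e

1+2z-injective : ∀ {a b} → 1+2z a ≡ 1+2z b → a ≡ b
1+2z-injective {a} {b} e = 2z-injective (ℤ-Group.∙-cancelʳ 1ℤ (2z a) (2z b) e)

parity-split : Split (ℤ × ℤ) (ℤ × ℤ) (ℤ × ℤ)
parity-split = record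
  { φ = λ (k , a) → k , 2z a
  ; ψ = λ (k , a) → k , 1+2z a
  ; φ-inj = λ e → cong₂ _,_ (cong proj₁ e) (2z-injective (cong proj₂ e))
  ; ψ-inj = λ e → cong₂ _,_ (cong proj₁ e) (1+2z-injective (cong proj₂ e))
  ; disjoint = λ {j} {k} e → even≢odd (proj₂ j) (proj₂ k) (cong proj₂ e)
  ; cover = λ (k , z) → [ (λ { (a , refl) → inj₁ ((k , a) , refl) }) , (λ { (a , refl) → inj₂ ((k , a) , refl) }) ]′ (parity-ℤ z) }

sign-split : Split (ℤ × ℤ) ℤ ((ℤ × ℕ) ⊎ (ℤ × ℕ))
sign-split = record
  { φ = λ k → k , + 0
  ; ψ = [ (λ (k , n) → k , + suc n) , (λ (k , n) → k , -[1+ n ]) ]′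
  ; φ-inj = cong proj₁
  ; ψ-inj = λ { {inj₁ _} {inj₁ _} refl → refl ; {inj₂ _} {inj₂ _} refl → refl ; {inj₁ _} {inj₂ _} () ; {inj₂ _} {inj₁ _} () }
  ; disjoint = λ { {j} {inj₁ _} () ; {j} {inj₂ _} () }
  ; cover = λ { (k , + 0) → inj₁ (k , refl) ; (k , + suc n) → inj₂ (inj₁ (k , n) , refl) ; (k , -[1+ n ]) → inj₂ (inj₂ (k , n) , refl) } }

sum-split : ∀ {A B : Set} → Split (A ⊎ B) A B
sum-split = record
  { φ = inj₁ ; ψ = inj₂ ; φ-inj = λ { refl → refl } ; ψ-inj = λ { refl → refl } ; disjoint = λ ()
  ; cover = λ { (inj₁ a) → inj₁ (a , refl) ; (inj₂ b) → inj₂ (b , refl) } }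

-- The involution (k , g) ↦ (k + d g , - g) pairs off all terms with g ≠ 0.
Gen-flip : ∀ {w : ℤ × ℤ → ℕ} {f} (d : ℤ) → (∀ k g → w (k , -ᶻ g) ≡ w (k +ᶻ d *ᶻ g , g)) → Gen w f → Gen (λ k → w (k , + 0)) f
Gen-flip {w} {f} d e g with Gen-split sign-split g
... | f₀ , f₁ , g₀ , g₁ , f≃ with Gen-split sum-split g₁
... | f₂ , f₃ , g₂ , g₃ , f₁≃ = Gen-resp (R.sym (begin
  f ≈⟨ f≃ ⟩
  f₀ ⊞ f₁ ≈⟨ R.+-congˡ (R.trans f₁≃ (R.+-congˡ f₃≃f₂)) ⟩
  f₀ ⊞ (f₂ ⊞ f₂) ≈⟨ R.trans (R.+-congˡ (+-self f₂)) (R.+-identityʳ f₀) ⟩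
  f₀ ∎)) g₀
  where
  open ≃-Reasoning
  f₃≃f₂ : f₃ ≃ f₂
  f₃≃f₂ = Gen-unique g₃ (Gen-reparam (λ (k , n) → k +ᶻ d *ᶻ + suc n , n) (λ (k , n) → k -ᶻ d *ᶻ + suc n , n)
      (λ (k , n) → cong (_, n) (l₁ k (d *ᶻ + suc n))) (λ (k , n) → cong (_, n) (l₂ k (d *ᶻ + suc n))) g₂)
    (λ (k , n) → e k (+ suc n))
    where
    l₁ : ∀ k z → (k -ᶻ z) +ᶻ z ≡ k
    l₁ = solve-∀
    l₂ : ∀ k z → (k +ᶻ z) -ᶻ z ≡ k
    l₂ = solve-∀

Gen-double : ∀ {I : Set} {w : I → ℕ} {f} → Gen w f → Gen (λ i → w i * 2) (f ⊠ f)
Gen-double {f = f} g = Gen-resp (R.sym (frobenius f)) (Gen-V 2 g)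

th-V : ∀ c d → .{{_ : NonZero c}} → .{{_ : NonZero d}} → .{{_ : NonZero (d * c)}} → V c (th d) ≃ th (d * c)
th-V c d = Gen-unique (Gen-V c (Gen-th d)) (Gen-th (d * c))
  (λ k → trans (ℕₚ.*-assoc d (sq (ι k)) c) (trans (cong (d *_) (ℕₚ.*-comm (sq (ι k)) c)) (sym (ℕₚ.*-assoc d c (sq (ι k))))))

th-square : ∀ d → .{{_ : NonZero d}} → .{{_ : NonZero (d * 2)}} → th d ⊠ th d ≃ th (d * 2)
th-square d = R.trans (frobenius (th d)) (th-V 2 d)

-- Binary quadratic forms under affine substitutions

record Lin : Set where
  constructor lin
  field ck cg c1 : ℤ

⟪_⟫ : Lin → ℤ → ℤ → ℤ
⟪ lin p q r ⟫ k g = (p *ᶻ k +ᶻ q *ᶻ g) +ᶻ r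

Affine : Set
Affine = Lin × Lin

idᴬ : Affine
idᴬ = lin 1ℤ (+ 0) (+ 0) , lin (+ 0) 1ℤ (+ 0)

applyᴬ : Affine → ℤ × ℤ → ℤ × ℤ
applyᴬ (l , m) (k , g) = ⟪ l ⟫ k g , ⟪ m ⟫ k g

infixl 9 _∘ᴸ_ _∘ᴬ_ _∘ᶠ_

_∘ᴸ_ : Lin → Affine → Lin
lin p q r ∘ᴸ (lin a b c , lin d e f) = lin (p *ᶻ a +ᶻ q *ᶻ d) (p *ᶻ b +ᶻ q *ᶻ e) ((p *ᶻ c +ᶻ q *ᶻ f) +ᶻ r)

_∘ᴬ_ : Affine → Affine → Affine
(l , m) ∘ᴬ A = l ∘ᴸ A , m ∘ᴸ A

⟪∘ᴸ⟫ : ∀ l A k g → ⟪ l ∘ᴸ A ⟫ k g ≡ ⟪ l ⟫ (proj₁ (applyᴬ A (k , g))) (proj₂ (applyᴬ A (k , g)))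
⟪∘ᴸ⟫ (lin p q r) (lin a b c , lin d e f) k g = identity p q r a b c d e f k g
  where
  identity : ∀ p q r a b c d e f k g →
    ((p *ᶻ a +ᶻ q *ᶻ d) *ᶻ k +ᶻ (p *ᶻ b +ᶻ q *ᶻ e) *ᶻ g) +ᶻ ((p *ᶻ c +ᶻ q *ᶻ f) +ᶻ r)
    ≡ (p *ᶻ ((a *ᶻ k +ᶻ b *ᶻ g) +ᶻ c) +ᶻ q *ᶻ ((d *ᶻ k +ᶻ e *ᶻ g) +ᶻ f)) +ᶻ r
  identity = solve-∀

applyᴬ-∘ : ∀ A B v → applyᴬ (A ∘ᴬ B) v ≡ applyᴬ A (applyᴬ B v)
applyᴬ-∘ (l , m) B (k , g) = cong₂ _,_ (⟪∘ᴸ⟫ l B k g) (⟪∘ᴸ⟫ m B k g)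

applyᴬ-id : ∀ v → applyᴬ idᴬ v ≡ v
applyᴬ-id (k , g) = cong₂ _,_ (l₁ k g) (l₂ k g)
  where
  l₁ : ∀ k g → (1ℤ *ᶻ k +ᶻ + 0 *ᶻ g) +ᶻ + 0 ≡ k
  l₁ = solve-∀
  l₂ : ∀ k g → (+ 0 *ᶻ k +ᶻ 1ℤ *ᶻ g) +ᶻ + 0 ≡ g
  l₂ = solve-∀

-- The six coefficients of a quadratic polynomial in k and g. They are concrete integers for each
-- concrete form, so that two reparametrised forms are compared by `refl` instead of by a polynomial
-- identity in the variables.
record Coeffs : Set where
  constructor coeffs
  field kk kg gg k1 g1 c0 : ℤ

squareᴸ : Lin → Coeffs
squareᴸ (lin p q r) = coeffs (p *ᶻ p) (+ 2 *ᶻ (p *ᶻ q)) (q *ᶻ q) (+ 2 *ᶻ (p *ᶻ r)) (+ 2 *ᶻ (q *ᶻ r)) (r *ᶻ r)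

evalᶜ : Coeffs → ℤ → ℤ → ℤ
evalᶜ (coeffs a b c d e f) k g = (a *ᶻ (k *ᶻ k) +ᶻ b *ᶻ (k *ᶻ g) +ᶻ c *ᶻ (g *ᶻ g)) +ᶻ (d *ᶻ k +ᶻ e *ᶻ g +ᶻ f)

squareᴸ-correct : ∀ l k g → ⟪ l ⟫ k g *ᶻ ⟪ l ⟫ k g ≡ evalᶜ (squareᴸ l) k g
squareᴸ-correct (lin p q r) k g = identity p q r k g
  where
  identity : ∀ p q r k g → ((p *ᶻ k +ᶻ q *ᶻ g) +ᶻ r) *ᶻ ((p *ᶻ k +ᶻ q *ᶻ g) +ᶻ r) ≡
    ((p *ᶻ p) *ᶻ (k *ᶻ k) +ᶻ (+ 2 *ᶻ (p *ᶻ q)) *ᶻ (k *ᶻ g) +ᶻ (q *ᶻ q) *ᶻ (g *ᶻ g)) +ᶻ ((+ 2 *ᶻ (p *ᶻ r)) *ᶻ k +ᶻ (+ 2 *ᶻ (q *ᶻ r)) *ᶻ g +ᶻ (r *ᶻ r))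
  identity = solve-∀

combine : ℕ → ℕ → Coeffs → Coeffs → Coeffs
combine m n (coeffs a b c d e f) (coeffs a′ b′ c′ d′ e′ f′) = coeffs
  (+ m *ᶻ a +ᶻ + n *ᶻ a′) (+ m *ᶻ b +ᶻ + n *ᶻ b′) (+ m *ᶻ c +ᶻ + n *ᶻ c′)
  (+ m *ᶻ d +ᶻ + n *ᶻ d′) (+ m *ᶻ e +ᶻ + n *ᶻ e′) (+ m *ᶻ f +ᶻ + n *ᶻ f′)

combine-correct : ∀ m n C D k g → + m *ᶻ evalᶜ C k g +ᶻ + n *ᶻ evalᶜ D k g ≡ evalᶜ (combine m n C D) k g
combine-correct m n (coeffs a b c d e f) (coeffs a′ b′ c′ d′ e′ f′) k g = trans
    (cong₂ _+ᶻ_ (expand (+ m) a b c d e f (k *ᶻ k) (k *ᶻ g) (g *ᶻ g) k g) (expand (+ n) a′ b′ c′ d′ e′ f′ (k *ᶻ k) (k *ᶻ g) (g *ᶻ g) k g))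
    (collect (+ m *ᶻ a) (+ m *ᶻ b) (+ m *ᶻ c) (+ m *ᶻ d) (+ m *ᶻ e) (+ m *ᶻ f) (+ n *ᶻ a′) (+ n *ᶻ b′) (+ n *ᶻ c′) (+ n *ᶻ d′) (+ n *ᶻ e′) (+ n *ᶻ f′)
      (k *ᶻ k) (k *ᶻ g) (g *ᶻ g) k g)
  where
  expand : ∀ m a b c d e f x y z k g → m *ᶻ ((a *ᶻ x +ᶻ b *ᶻ y +ᶻ c *ᶻ z) +ᶻ (d *ᶻ k +ᶻ e *ᶻ g +ᶻ f))
    ≡ ((m *ᶻ a) *ᶻ x +ᶻ (m *ᶻ b) *ᶻ y +ᶻ (m *ᶻ c) *ᶻ z) +ᶻ ((m *ᶻ d) *ᶻ k +ᶻ (m *ᶻ e) *ᶻ g +ᶻ (m *ᶻ f))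
  expand = solve-∀
  collect : ∀ a b c d e f a′ b′ c′ d′ e′ f′ x y z k g →
    ((a *ᶻ x +ᶻ b *ᶻ y +ᶻ c *ᶻ z) +ᶻ (d *ᶻ k +ᶻ e *ᶻ g +ᶻ f)) +ᶻ ((a′ *ᶻ x +ᶻ b′ *ᶻ y +ᶻ c′ *ᶻ z) +ᶻ (d′ *ᶻ k +ᶻ e′ *ᶻ g +ᶻ f′))
    ≡ ((a +ᶻ a′) *ᶻ x +ᶻ (b +ᶻ b′) *ᶻ y +ᶻ (c +ᶻ c′) *ᶻ z) +ᶻ ((d +ᶻ d′) *ᶻ k +ᶻ (e +ᶻ e′) *ᶻ g +ᶻ (f +ᶻ f′))
  collect = solve-∀

-- The weight a l² + b m² for affine functions l and m of (k , g) ∈ ℤ².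
record Form : Set where
  constructor form
  field
    a b : ℕ
    l m : Lin

weight : Form → ℤ × ℤ → ℕ
weight (form a b l m) (k , g) = wt a b (⟪ l ⟫ k g) (⟪ m ⟫ k g)

_∘ᶠ_ : Form → Affine → Form
form a b l m ∘ᶠ A = form a b (l ∘ᴸ A) (m ∘ᴸ A)

weight-∘ : ∀ Q A v → weight (Q ∘ᶠ A) v ≡ weight Q (applyᴬ A v)
weight-∘ (form a b l m) A (k , g) = cong₂ (wt a b) (⟪∘ᴸ⟫ l A k g) (⟪∘ᴸ⟫ m A k g)

coeffsᶠ : Form → Coeffs
coeffsᶠ (form a b l m) = combine a b (squareᴸ l) (squareᴸ m)

+weight : ∀ Q k g → + weight Q (k , g) ≡ evalᶜ (coeffsᶠ Q) k g
+weight (form a b l m) k g = trans (+wt a b (⟪ l ⟫ k g) (⟪ m ⟫ k g)) (trans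
  (cong₂ (λ x y → + a *ᶻ x +ᶻ + b *ᶻ y) (squareᴸ-correct l k g) (squareᴸ-correct m k g))
  (combine-correct a b (squareᴸ l) (squareᴸ m) k g))

weight-≡ : ∀ Q Q′ → coeffsᶠ Q ≡ coeffsᶠ Q′ → ∀ v → weight Q v ≡ weight Q′ v
weight-≡ Q Q′ e (k , g) = ℤₚ.+-injective (trans (+weight Q k g) (trans (cong (λ C → evalᶜ C k g) e) (sym (+weight Q′ k g))))

record GenF (Q : Form) (f : PS) : Set where
  constructor genF
  field ungenF : Gen (weight Q) f
open GenF public

GenF-unique : ∀ {Q Q′ f f′} → coeffsᶠ Q ≡ coeffsᶠ Q′ → GenF Q f → GenF Q′ f′ → f ≃ f′
GenF-unique {Q} {Q′} e (genF g) (genF g′) = Gen-unique g g′ (weight-≡ Q Q′ e)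

GenF-recast : ∀ {Q f} Q′ → coeffsᶠ Q ≡ coeffsᶠ Q′ → GenF Q f → GenF Q′ f
GenF-recast {Q} Q′ e (genF g) = genF (Gen-push id id (λ v → v , refl) (λ v → sym (weight-≡ Q Q′ e v)) g)

GenF-reparam : ∀ {Q f} A B → A ∘ᴬ B ≡ idᴬ → B ∘ᴬ A ≡ idᴬ → GenF Q f → GenF (Q ∘ᶠ A) f
GenF-reparam {Q} A B AB BA (genF g) = genF (Gen-push id id (λ v → v , refl) (weight-∘ Q A)
  (Gen-reparam (applyᴬ A) (applyᴬ B) (cancel A B AB) (cancel B A BA) g))
  where
  cancel : ∀ A B → A ∘ᴬ B ≡ idᴬ → ∀ v → applyᴬ A (applyᴬ B v) ≡ v
  cancel A B e v = trans (sym (applyᴬ-∘ A B v)) (trans (cong (λ C → applyᴬ C v) e) (applyᴬ-id v))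

evens odds : Affine
evens = lin 1ℤ (+ 0) (+ 0) , lin (+ 0) (+ 2) (+ 0)
odds = lin 1ℤ (+ 0) (+ 0) , lin (+ 0) (+ 2) 1ℤ

opaque
  GenF-parity : ∀ {Q f} → GenF Q f → ∃[ f₀ ] ∃[ f₁ ] (GenF (Q ∘ᶠ evens) f₀ × GenF (Q ∘ᶠ odds) f₁ × f ≃ f₀ ⊞ f₁)
  GenF-parity {Q} (genF g) with Gen-split parity-split g
  ... | f₀ , f₁ , g₀ , g₁ , e = f₀ , f₁ ,
      genF (Gen-push id id (λ v → v , refl) (λ (k , z) → trans (weight-∘ Q evens (k , z)) (cong (weight Q) (cong₂ _,_ (l₁ k z) (l₂ k z)))) g₀) ,
      genF (Gen-push id id (λ v → v , refl) (λ (k , z) → trans (weight-∘ Q odds (k , z)) (cong (weight Q) (cong₂ _,_ (l₁ k z) (l₃ k z)))) g₁) , e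
    where
    l₁ : ∀ k g → (1ℤ *ᶻ k +ᶻ + 0 *ᶻ g) +ᶻ + 0 ≡ k
    l₁ = solve-∀
    l₂ : ∀ k g → (+ 0 *ᶻ k +ᶻ + 2 *ᶻ g) +ᶻ + 0 ≡ + 2 *ᶻ g
    l₂ = solve-∀
    l₃ : ∀ k g → (+ 0 *ᶻ k +ᶻ + 2 *ᶻ g) +ᶻ 1ℤ ≡ + 2 *ᶻ g +ᶻ 1ℤ
    l₃ = solve-∀

GenF-double : ∀ {a b l m f} → GenF (form a b l m) f → GenF (form (a * 2) (b * 2) l m) (f ⊠ f)
GenF-double {a} {b} {l} {m} (genF g) = genF (Gen-push id id (λ v → v , refl)
  (λ (k , g) → trans (cong₂ _+_ (lemma a (sq (⟪ l ⟫ k g))) (lemma b (sq (⟪ m ⟫ k g)))) (sym (ℕₚ.*-distribʳ-+ 2 (a * sq (⟪ l ⟫ k g)) _)))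
  (Gen-double g))
  where
  lemma : ∀ a s → (a * 2) * s ≡ (a * s) * 2
  lemma a s = trans (ℕₚ.*-assoc a 2 s) (trans (cong (a *_) (ℕₚ.*-comm 2 s)) (sym (ℕₚ.*-assoc a s 2)))

GenF-flip : ∀ {a b l m f} d → let A = lin 1ℤ (+ 0) (+ 0) , lin (+ 0) (-ᶻ 1ℤ) (+ 0) ; B = lin 1ℤ d (+ 0) , lin (+ 0) 1ℤ (+ 0) in
  squareᴸ (l ∘ᴸ A) ≡ squareᴸ (l ∘ᴸ B) → squareᴸ (m ∘ᴸ A) ≡ squareᴸ (m ∘ᴸ B) →
  GenF (form a b l m) f → Gen (λ k → weight (form a b l m) (k , + 0)) f
GenF-flip {a} {b} {l} {m} d e e′ (genF g) = Gen-flip d sym-weight g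
  where
  A = lin 1ℤ (+ 0) (+ 0) , lin (+ 0) (-ᶻ 1ℤ) (+ 0)
  B = lin 1ℤ d (+ 0) , lin (+ 0) 1ℤ (+ 0)
  l₁ : ∀ k g → (1ℤ *ᶻ k +ᶻ + 0 *ᶻ g) +ᶻ + 0 ≡ k
  l₁ = solve-∀
  l₂ : ∀ k g → (+ 0 *ᶻ k +ᶻ -ᶻ 1ℤ *ᶻ g) +ᶻ + 0 ≡ -ᶻ g
  l₂ = solve-∀
  l₃ : ∀ d k g → (1ℤ *ᶻ k +ᶻ d *ᶻ g) +ᶻ + 0 ≡ k +ᶻ d *ᶻ g
  l₃ = solve-∀
  l₄ : ∀ k g → (+ 0 *ᶻ k +ᶻ 1ℤ *ᶻ g) +ᶻ + 0 ≡ g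
  l₄ = solve-∀
  Q = form a b l m
  sym-weight : ∀ k g → weight Q (k , -ᶻ g) ≡ weight Q (k +ᶻ d *ᶻ g , g)
  sym-weight k g = begin
    weight Q (k , -ᶻ g) ≡⟨ cong (weight Q) (cong₂ _,_ (l₁ k g) (l₂ k g)) ⟨
    weight Q (applyᴬ A (k , g)) ≡⟨ weight-∘ Q A (k , g) ⟨
    weight (Q ∘ᶠ A) (k , g) ≡⟨ weight-≡ (Q ∘ᶠ A) (Q ∘ᶠ B) (cong₂ (combine a b) e e′) (k , g) ⟩
    weight (Q ∘ᶠ B) (k , g) ≡⟨ weight-∘ Q B (k , g) ⟩
    weight Q (applyᴬ B (k , g)) ≡⟨ cong (weight Q) (cong₂ _,_ (l₃ d k g) (l₄ k g)) ⟩
    weight Q (k +ᶻ d *ᶻ g , g) ∎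
    where open ≡-Reasoning

GenF-th : ∀ a b → .{{_ : NonZero a}} → .{{_ : NonZero b}} →
  GenF (form a b (lin (+ 4) (+ 0) 1ℤ) (lin (+ 0) (+ 4) 1ℤ)) (th a ⊠ th b)
GenF-th a b = genF (Gen-push id id (λ v → v , refl) (λ (j , k) → cong₂ (wt a b) (l₁ j k) (l₂ j k)) (Gen-× (Gen-th a) (Gen-th b)))
  where
  l₁ : ∀ j k → (+ 4 *ᶻ j +ᶻ + 0 *ᶻ k) +ᶻ 1ℤ ≡ + 4 *ᶻ j +ᶻ 1ℤ
  l₁ = solve-∀
  l₂ : ∀ j k → (+ 0 *ᶻ j +ᶻ + 4 *ᶻ k) +ᶻ 1ℤ ≡ + 4 *ᶻ k +ᶻ 1ℤ
  l₂ = solve-∀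

-- The pairs (h , g) with h - g ≡ 1 mod 4 represent each pair of integers of opposite parity once up to sign.
half-plane : ∀ a b → .{{_ : NonZero a}} → .{{_ : NonZero b}} → ∀ {f} →
  GenF (form a b (lin (+ 4) 1ℤ 1ℤ) (lin (+ 0) 1ℤ (+ 0))) f → f ≃ th a ⊞ th b
half-plane a b gen with GenF-parity gen
... | f₀ , f₁ , g₀ , g₁ , f≃ = R.trans f≃ (R.+-cong
  (Gen-unique (GenF-flip (-ᶻ 1ℤ) refl refl g₀) (Gen-th a)
    (λ k → trans (wt-0ʳ a b ((+ 4 *ᶻ k +ᶻ + 0) +ᶻ 1ℤ) (+ 0) refl) (cong (λ z → a * sq (z +ᶻ 1ℤ)) (ℤₚ.+-identityʳ (+ 4 *ᶻ k)))))
  -- For odd g the roles are exchanged: the shear turns the first coordinate into 2 g and the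
  -- second, up to sign, into 4 k + 1 - 2 g. The terms with g = 0, which survive the flip, then form
  -- `th b`.
  (Gen-unique (GenF-flip 1ℤ refl refl
      (GenF-reparam (lin 1ℤ (+ 0) (+ 0) , lin (-ᶻ + 2) 1ℤ (-ᶻ 1ℤ)) (lin 1ℤ (+ 0) (+ 0) , lin (+ 2) 1ℤ 1ℤ) refl refl g₁)) (Gen-th b)
    (λ k → trans (wt-0ˡ a b (+ 0) ((-ᶻ + 4 *ᶻ k +ᶻ + 0) -ᶻ 1ℤ) refl) (cong (λ z → b * ∣ z ∣) (neg k)))))
  where
  neg : ∀ k → ((-ᶻ + 4 *ᶻ k +ᶻ + 0) -ᶻ 1ℤ) *ᶻ ((-ᶻ + 4 *ᶻ k +ᶻ + 0) -ᶻ 1ℤ) ≡ (+ 4 *ᶻ k +ᶻ 1ℤ) *ᶻ (+ 4 *ᶻ k +ᶻ 1ℤ)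
  neg = solve-∀

-- Theta identities from reparametrised quadratic forms

private
  [_,_,_] : ℤ → ℤ → ℤ → Lin
  [ p , q , s ] = lin p q s

  pattern 0z = + 0
  pattern 1z = + 1
  pattern -1z = -[1+ 0 ]
  pattern -2z = -[1+ 1 ]

record Halves (Q : Form) (f : PS) : Set where
  field
    {even odd′} : PS
    gen-even : GenF (Q ∘ᶠ evens) even
    gen-odd : GenF (Q ∘ᶠ odds) odd′
    sum : f ≃ even ⊞ odd′

opaque
  halves : ∀ {Q f} → GenF Q f → Halves Q f
  halves g = let f₀ , f₁ , g₀ , g₁ , e = GenF-parity g in record { gen-even = g₀ ; gen-odd = g₁ ; sum = e }

-- The new coordinate g is the sum of the two old ones, respectively the second minus the first, so
-- that `halves` splits by the parity of that quantity.
by-sum by-diff : Affine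
by-sum = [ -1z , 1z , 0z ] , [ 1z , 0z , 0z ]
by-diff = [ 1z , -1z , 0z ] , [ 1z , 0z , 0z ]

opaque
  halves-sum : ∀ {Q f} → GenF Q f → Halves (Q ∘ᶠ by-sum) f
  halves-sum g = halves (GenF-reparam by-sum ([ 0z , 1z , 0z ] , [ 1z , 1z , 0z ]) refl refl g)

  halves-diff : ∀ {Q f} → GenF Q f → Halves (Q ∘ᶠ by-diff) f
  halves-diff g = halves (GenF-reparam by-diff ([ 0z , 1z , 0z ] , [ -1z , 1z , 0z ]) refl refl g)

-- m² + 3 n² = 4 (a² + 3 b²) for a = (m + 3 n)/4 and b = (m - n)/4.
th-3 : th 1 ⊠ th 3 ≃ th 4 ⊞ th 12
th-3 = half-plane 4 12 (GenF-recast (form 4 12 [ + 4 , 1z , 1z ] [ 0z , 1z , 0z ]) refl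
  (GenF-reparam ([ 1z , 1z , 0z ] , [ 1z , 0z , 0z ]) ([ 0z , 1z , 0z ] , [ 1z , -1z , 0z ]) refl refl (GenF-th 1 3)))

-- Division of (m + n √-7)/2 by the prime (1 + √-7)/2 above 2; the quotient either has again odd
-- coordinates, or lies in ℤ[√-7].
th-7 : th 1 ⊠ th 7 ≃ (th 1 ⊠ th 7) ⊠ (th 1 ⊠ th 7) ⊞ (th 8 ⊞ th 56)
th-7 = begin
  th 1 ⊠ th 7 ≈⟨ D.sum ⟩
  D.even ⊞ D.odd′ ≈⟨ R.+-cong even (R.trans O.sum (R.+-cong o₀ o₁)) ⟩
  (th 8 ⊞ th 56) ⊞ (S.even ⊞ S.odd′) ≈⟨ R.+-comm (th 8 ⊞ th 56) (S.even ⊞ S.odd′) ⟩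
  (S.even ⊞ S.odd′) ⊞ (th 8 ⊞ th 56) ≈⟨ R.+-congʳ S.sum ⟨
  (th 1 ⊠ th 7) ⊠ (th 1 ⊠ th 7) ⊞ (th 8 ⊞ th 56) ∎
  where
  open ≃-Reasoning
  -- For m = 4 j + 1 and n = 4 k + 1, the value m² + 7 n² is 8 modulo 16 when k - j is even and 0
  -- when it is odd. The odd half has to make up the square, whose exponents 2 (m² + 7 n²) are all
  -- multiples of 16.
  module D = Halves (halves-diff (GenF-th 1 7))
  module S = Halves (halves-sum (GenF-double (GenF-th 1 7)))
  module O = Halves (halves D.gen-odd)
  even : D.even ≃ th 8 ⊞ th 56
  even = half-plane 8 56 (GenF-recast (form 8 56 [ + 4 , 1z , 1z ] [ 0z , 1z , 0z ]) refl
    (GenF-reparam ([ 1z , 0z , 0z ] , [ 0z , -1z , 0z ]) ([ 1z , 0z , 0z ] , [ 0z , -1z , 0z ]) refl refl D.gen-even))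
  o₀ : O.even ≃ S.even
  o₀ = GenF-unique refl O.gen-even (GenF-reparam ([ 0z , 1z , 0z ] , [ 1z , 0z , 0z ]) ([ 0z , 1z , 0z ] , [ 1z , 0z , 0z ]) refl refl S.gen-even)
  o₁ : O.odd′ ≃ S.odd′
  o₁ = GenF-unique refl O.gen-odd (GenF-reparam ([ 0z , -1z , -1z ] , [ -1z , 0z , -1z ]) ([ 0z , -1z , -1z ] , [ -1z , 0z , -1z ]) refl refl S.gen-odd)

-- Multiplication by (3 + √-39)/2, of norm 12, exchanges the forms m² + 39 n² and 3 m² + 13 n².
th-39 : let S₁ = th 1 ⊠ th 39 ; S₂ = th 3 ⊠ th 13 in
  S₁ ⊞ S₂ ≃ ((S₁ ⊠ S₁) ⊠ (S₁ ⊠ S₁) ⊞ (S₂ ⊠ S₂) ⊠ (S₂ ⊠ S₂)) ⊞ ((th 16 ⊞ th 624) ⊞ (th 48 ⊞ th 208))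
th-39 = begin
  S₁ ⊞ S₂ ≈⟨ R.+-cong A.sum E.sum ⟩
  (A.even ⊞ A.odd′) ⊞ (E.even ⊞ E.odd′) ≈⟨ R.+-cong (R.+-cong a≃b c≃) (R.+-congʳ e≃) ⟩
  (E.odd′ ⊞ (tc ⊞ q)) ⊞ ((te ⊞ p) ⊞ E.odd′)
    ≈⟨ ring (E.odd′ ∷ tc ∷ q ∷ te ∷ p ∷ []) ((:x :+ (:y :+ :z)) :+ ((:w :+ :a) :+ :x)) ((:a :+ :z) :+ (:w :+ :y)) refl ⟩
  (p ⊞ q) ⊞ (te ⊞ tc) ∎
  where
  open ≃-Reasoning
  S₁ = th 1 ⊠ th 39
  S₂ = th 3 ⊠ th 13
  p = (S₁ ⊠ S₁) ⊠ (S₁ ⊠ S₁)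
  q = (S₂ ⊠ S₂) ⊠ (S₂ ⊠ S₂)
  te = th 16 ⊞ th 624
  tc = th 48 ⊞ th 208
  module A = Halves (halves (GenF-reparam ([ 1z , 1z , 0z ] , [ 1z , 0z , 0z ]) ([ 0z , 1z , 0z ] , [ 1z , -1z , 0z ]) refl refl (GenF-th 1 39)))
  module E = Halves (halves-diff (GenF-th 3 13))
  module P = Halves (halves-sum (GenF-double (GenF-double (GenF-th 1 39))))
  module Q = Halves (halves-sum (GenF-double (GenF-double (GenF-th 3 13))))
  module A′ = Halves (halves A.gen-even)
  module B′ = Halves (halves E.gen-odd)
  module E′ = Halves (halves E.gen-even)
  module C′ = Halves (halves (GenF-reparam ([ 1z , 0z , 0z ] , [ -2z , 1z , -1z ]) ([ 1z , 0z , 0z ] , [ + 2 , 1z , 1z ]) refl refl A.gen-odd))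
  module E″ = Halves (halves E′.gen-odd)
  module C″ = Halves (halves C′.gen-odd)
  -- In these two halves all exponents are 8 modulo 16, and the halves cancel in the sum. In the
  -- other two, all exponents are multiples of 16: the half from m² + 39 n² yields the fourth power
  -- of `S₂`, and the half from 3 m² + 13 n² that of `S₁`.
  a≃b : A.even ≃ E.odd′
  a≃b = R.trans A′.sum (R.trans (R.+-cong
    (GenF-unique refl A′.gen-even (GenF-reparam ([ 1z , 1z , 0z ] , [ 1z , 0z , 0z ]) ([ 0z , 1z , 0z ] , [ 1z , -1z , 0z ]) refl refl B′.gen-even))
    (GenF-unique refl A′.gen-odd (GenF-reparam ([ -1z , -1z , -1z ] , [ -1z , 0z , -1z ]) ([ 0z , -1z , -1z ] , [ -1z , 1z , 0z ]) refl refl B′.gen-odd)))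
    (R.sym B′.sum))
  c≃ : A.odd′ ≃ tc ⊞ q
  c≃ = R.trans C′.sum (R.+-cong
    (half-plane 48 208 (GenF-recast (form 48 208 [ + 4 , 1z , 1z ] [ 0z , 1z , 0z ]) refl
      (GenF-reparam ([ 1z , 0z , 0z ] , [ 0z , -1z , 0z ]) ([ 1z , 0z , 0z ] , [ 0z , -1z , 0z ]) refl refl C′.gen-even)))
    (R.trans C″.sum (R.trans (R.+-cong
      (GenF-unique refl C″.gen-even (GenF-reparam ([ 0z , 1z , 0z ] , [ 1z , 0z , 0z ]) ([ 0z , 1z , 0z ] , [ 1z , 0z , 0z ]) refl refl Q.gen-even))
      (GenF-unique refl C″.gen-odd (GenF-reparam ([ 0z , -1z , -1z ] , [ -1z , 0z , -1z ]) ([ 0z , -1z , -1z ] , [ -1z , 0z , -1z ]) refl refl Q.gen-odd)))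
      (R.sym Q.sum))))
  e≃ : E.even ≃ te ⊞ p
  e≃ = R.trans E′.sum (R.+-cong
    (half-plane 16 624 (GenF-recast (form 16 624 [ + 4 , 1z , 1z ] [ 0z , 1z , 0z ]) refl
      (GenF-reparam ([ 1z , 1z , 0z ] , [ 0z , 1z , 0z ]) ([ 1z , -1z , 0z ] , [ 0z , 1z , 0z ]) refl refl E′.gen-even)))
    (R.trans E″.sum (R.trans (R.+-cong
      (GenF-unique refl E″.gen-even (GenF-reparam ([ 0z , 1z , 0z ] , [ -1z , + 2 , 0z ]) ([ + 2 , -1z , 0z ] , [ 1z , 0z , 0z ]) refl refl P.gen-even))
      (GenF-unique refl E″.gen-odd (GenF-reparam ([ 0z , -1z , -1z ] , [ 1z , -2z , -2z ]) ([ -2z , 1z , 0z ] , [ -1z , 0z , -1z ]) refl refl P.gen-odd)))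
      (R.sym P.sum))))

-- r, F and G in terms of theta series

odd-filter : ∀ {A : Set} {P : A → Set} (P? : Decidable P) l → odd (length (filter P? l)) ≡ xorSum (map (does ∘ P?) l)
odd-filter P? [] = refl
odd-filter P? (a ∷ l) with does (P? a)
... | true = cong (true xor_) (odd-filter P? l)
... | false = odd-filter P? l

squares : ℕ → PS
squares c n = xorSum (map (λ m → (c * (m * m)) ≡ᵇ n) (map suc (upTo n)))

Gen-squares : ∀ c → .{{_ : NonZero c}} → Gen (λ j → c * (suc j * suc j)) (squares c)
Gen-squares c = Gen-resp (mk λ n → trans (odd-filter (λ j → c * (suc j * suc j) ℕₚ.≟ n) (upTo n)) (cong xorSum (Lₚ.map-∘ (upTo n))))
  (Gen-enum (λ j → c * (suc j * suc j)) upTo Uniqueₚ.upTo⁺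
    (λ j → ∈-upTo⁺ (ℕₚ.≤-trans (ℕₚ.m≤m*n (suc j) (suc j)) (ℕₚ.m≤n*m (suc j * suc j) c))))

fold-ℤ : ℤ → ℕ
fold-ℤ (+ k) = 2 * k
fold-ℤ -[1+ k ] = suc (2 * k)

even≢odd-ℕ : ∀ a b → 2 * a ≢ suc (2 * b)
even≢odd-ℕ a b e = even≢odd (+ a) (+ b) (trans (sym (ℤₚ.pos-* 2 a)) (trans (cong +_ e)
  (trans (cong +_ (ℕₚ.+-comm 1 (2 * b))) (cong (_+ᶻ 1ℤ) (ℤₚ.pos-* 2 b)))))

fold-ℤ-injective : ∀ {y z} → fold-ℤ y ≡ fold-ℤ z → y ≡ z
fold-ℤ-injective {+ a} {+ b} e = cong +_ (ℕₚ.*-cancelˡ-≡ a b 2 e)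
fold-ℤ-injective {+ a} { -[1+ b ]} e = ⊥-elim (even≢odd-ℕ a b e)
fold-ℤ-injective { -[1+ a ]} {+ b} e = ⊥-elim (even≢odd-ℕ b a (sym e))
fold-ℤ-injective { -[1+ a ]} { -[1+ b ]} e = cong -[1+_] (ℕₚ.*-cancelˡ-≡ a b 2 (ℕₚ.suc-injective e))

fold-ℤ-surjective : ∀ n → ∃[ z ] fold-ℤ z ≡ n
fold-ℤ-surjective n with parity-ℕ n
... | inj₁ (a , e) = + a , sym e
... | inj₂ (a , e) = -[1+ a ] , sym e

∣ι∣-fold : ∀ z → ∣ι∣ z ≡ suc (2 * fold-ℤ z)
∣ι∣-fold (+ k) = cong suc (ℕₚ.*-assoc 2 2 k)
∣ι∣-fold -[1+ k ] = lemma k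
  where
  lemma : ∀ k → 3 + 4 * k ≡ suc (2 * suc (2 * k))
  lemma = ℕ-Solver.solve-∀

-- A positive integer is either odd, hence a unique 4 k + 1 up to sign, or twice a positive integer.
-- The index j stands for the integer j + 1, so even indices belong to odd integers.
squares-split : ∀ c → .{{_ : NonZero c}} → .{{_ : NonZero (4 * c)}} → squares c ≃ th c ⊞ squares (4 * c)
squares-split c = Gen-unique (Gen-squares c) (Gen-push φ inj surj weights (Gen-⊎ (Gen-th c) (Gen-squares (4 * c)))) (λ _ → refl)
  where
  φ : ℤ ⊎ ℕ → ℕ
  φ (inj₁ z) = 2 * fold-ℤ z
  φ (inj₂ j) = suc (2 * j)
  inj : ∀ {s t} → φ s ≡ φ t → s ≡ t
  inj {inj₁ y} {inj₁ z} e = cong inj₁ (fold-ℤ-injective (ℕₚ.*-cancelˡ-≡ (fold-ℤ y) (fold-ℤ z) 2 e))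
  inj {inj₁ y} {inj₂ j} e = ⊥-elim (even≢odd-ℕ (fold-ℤ y) j e)
  inj {inj₂ j} {inj₁ y} e = ⊥-elim (even≢odd-ℕ (fold-ℤ y) j (sym e))
  inj {inj₂ i} {inj₂ j} e = cong inj₂ (ℕₚ.*-cancelˡ-≡ i j 2 (ℕₚ.suc-injective e))
  surj : ∀ n → ∃[ s ] φ s ≡ n
  surj n with parity-ℕ n
  ... | inj₁ (a , e) = inj₁ (proj₁ (fold-ℤ-surjective a)) , trans (cong (2 *_) (proj₂ (fold-ℤ-surjective a))) (sym e)
  ... | inj₂ (a , e) = inj₂ a , sym e
  quadruple : ∀ c j → c * (suc (suc (2 * j)) * suc (suc (2 * j))) ≡ (4 * c) * (suc j * suc j)
  quadruple = ℕ-Solver.solve-∀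
  weights : ∀ s → c * (suc (φ s) * suc (φ s)) ≡ [ (λ k → c * sq (ι k)) , (λ j → (4 * c) * (suc j * suc j)) ]′ s
  weights (inj₁ z) = cong (c *_) (trans (cong₂ _*_ (sym (∣ι∣-fold z)) (sym (∣ι∣-fold z))) (sym (sq-ι z)))
  weights (inj₂ j) = quadruple c j

squares-square : ∀ c → .{{_ : NonZero c}} → .{{_ : NonZero (c * 2)}} → squares c ⊠ squares c ≃ squares (c * 2)
squares-square c = Gen-unique (Gen-double (Gen-squares c)) (Gen-squares (c * 2)) (λ j → lemma c (suc j * suc j))
  where
  lemma : ∀ c s → (c * s) * 2 ≡ (c * 2) * s
  lemma = ℕ-Solver.solve-∀

xorSum-xor : ∀ {A : Set} (f g : A → Bool) l → xorSum (map (λ a → f a xor g a) l) ≡ xorSum (map f l) xor xorSum (map g l)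
xorSum-xor f g [] = refl
xorSum-xor f g (a ∷ l) = trans (cong ((f a xor g a) xor_) (xorSum-xor f g l))
  (xor-interchange (f a) (g a) (xorSum (map f l)) (xorSum (map g l)))

r-squares : r ≃ squares 1 ⊞ (squares 2 ⊞ (squares 3 ⊞ squares 6))
r-squares = mk λ n → let l = map suc (upTo n) ; e = λ c m → (c * (m * m)) ≡ᵇ n in begin
  xorSum (map (λ m → e 1 m xor (e 2 m xor (e 3 m xor (e 6 m xor false)))) l)
    ≡⟨ xorSum-xor (e 1) _ l ⟩
  squares 1 n xor xorSum (map (λ m → e 2 m xor (e 3 m xor (e 6 m xor false))) l)
    ≡⟨ cong (squares 1 n xor_) (xorSum-xor (e 2) _ l) ⟩
  squares 1 n xor (squares 2 n xor xorSum (map (λ m → e 3 m xor (e 6 m xor false)) l))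
    ≡⟨ cong (λ b → squares 1 n xor (squares 2 n xor b)) (xorSum-xor (e 3) _ l) ⟩
  squares 1 n xor (squares 2 n xor (squares 3 n xor xorSum (map (λ m → e 6 m xor false) l)))
    ≡⟨ cong (λ b → squares 1 n xor (squares 2 n xor (squares 3 n xor xorSum b))) (Lₚ.map-cong (λ m → xor-identityʳ (e 6 m)) l) ⟩
  squares 1 n xor (squares 2 n xor (squares 3 n xor squares 6 n))
    ≡⟨ cong (squares 1 n xor_) (trans (⊞-at (squares 2) (squares 3 ⊞ squares 6) n) (cong (squares 2 n xor_) (⊞-at (squares 3) (squares 6) n))) ⟨
  squares 1 n xor (squares 2 ⊞ (squares 3 ⊞ squares 6)) n
    ≡⟨ ⊞-at (squares 1) (squares 2 ⊞ (squares 3 ⊞ squares 6)) n ⟨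
  (squares 1 ⊞ (squares 2 ⊞ (squares 3 ⊞ squares 6))) n ∎
  where open ≡-Reasoning

-- Squaring doubles the index of each of the four sums of squares: those with index 2 and 6 cancel,
-- and those with index 4 and 12 remove the even squares from those with index 1 and 3.
r-r² : r ⊞ r ⊠ r ≃ th 1 ⊞ th 3
r-r² = begin
  r ⊞ r ⊠ r ≈⟨ R.+-cong r-squares (R.*-cong r-squares r-squares) ⟩
  s ⊞ s ⊠ s
    ≈⟨ ring (squares 1 ∷ squares 2 ∷ squares 3 ∷ squares 6 ∷ []) (:s :+ :s :* :s) (:s :+ (:x :* :x :+ (:y :* :y :+ (:z :* :z :+ :w :* :w)))) refl ⟩
  s ⊞ (squares 1 ⊠ squares 1 ⊞ (squares 2 ⊠ squares 2 ⊞ (squares 3 ⊠ squares 3 ⊞ squares 6 ⊠ squares 6)))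
    ≈⟨ R.+-cong (R.+-cong (squares-split 1) (R.+-congˡ (R.+-congʳ (squares-split 3))))
         (R.+-cong (squares-square 1) (R.+-cong (squares-square 2) (R.+-cong (squares-square 3) (squares-square 6)))) ⟩
  ((th 1 ⊞ squares 4) ⊞ (squares 2 ⊞ ((th 3 ⊞ squares 12) ⊞ squares 6))) ⊞ (squares 2 ⊞ (squares 4 ⊞ (squares 6 ⊞ squares 12)))
    ≈⟨ ring (th 1 ∷ th 3 ∷ squares 2 ∷ squares 4 ∷ squares 6 ∷ squares 12 ∷ [])
         (((:x :+ :w) :+ (:z :+ ((:y :+ :b) :+ :a))) :+ (:z :+ (:w :+ (:a :+ :b)))) (:x :+ :y) refl ⟩
  th 1 ⊞ th 3 ∎
  where
  open ≃-Reasoning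
  s = squares 1 ⊞ (squares 2 ⊞ (squares 3 ⊞ squares 6))
  :s : Expr 4
  :s = :x :+ (:y :+ (:z :+ :w))

opaque
  unfolding _⊞_

  F-def : F ≃ r ⊠ ((r ⊞ oneP) ⊠ (r ⊞ oneP) ⊠ (r ⊞ oneP))
  F-def = mk λ _ → refl

  G-def : G ≃ (r ⊠ r ⊠ r) ⊠ (r ⊞ oneP)
  G-def = mk λ _ → refl

opaque
  unfolding th

  th3-1 : th 3 1 ≡ false
  th3-1 = refl

:F :G : ∀ {n} → Expr n → Expr n
:F a = a :* ((a :+ :1) :* (a :+ :1) :* (a :+ :1))
:G a = (a :* a :* a) :* (a :+ :1)

F⊞G : F ⊞ G ≃ r ⊞ r ⊠ r
F⊞G = R.trans (R.+-cong F-def G-def) (ring (r ∷ []) (:F :x :+ :G :x) (:x :+ :x :* :x) refl)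

F⊠G : F ⊠ G ≃ (r ⊞ r ⊠ r) ^ 4
F⊠G = R.trans (R.*-cong F-def G-def) (ring (r ∷ []) (:F :x :* :G :x) ((:x :+ :x :* :x) :^ 4) refl)

th-^4 : (th 1 ⊞ th 3) ^ 4 ≃ th 4 ⊞ th 12
th-^4 = begin
  (th 1 ⊞ th 3) ^ 4
    ≈⟨ ring (th 1 ∷ th 3 ∷ []) ((:x :+ :y) :^ 4) ((:x :* :x) :* (:x :* :x) :+ (:y :* :y) :* (:y :* :y)) refl ⟩
  (th 1 ⊠ th 1) ⊠ (th 1 ⊠ th 1) ⊞ (th 3 ⊠ th 3) ⊠ (th 3 ⊠ th 3)
    ≈⟨ R.+-cong (R.*-cong (th-square 1) (th-square 1)) (R.*-cong (th-square 3) (th-square 3)) ⟩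
  th 2 ⊠ th 2 ⊞ th 6 ⊠ th 6
    ≈⟨ R.+-cong (th-square 2) (th-square 6) ⟩
  th 4 ⊞ th 12 ∎
  where open ≃-Reasoning

th-sum : th 1 ⊞ th 3 ≃ F ⊞ G
th-sum = R.trans (R.sym r-r²) (R.sym F⊞G)

th-product : th 1 ⊠ th 3 ≃ F ⊠ G
th-product = R.trans th-3 (R.trans (R.sym th-^4) (R.trans (^-cong 4 (R.sym r-r²)) (R.sym F⊠G)))

-- F and G are the roots of the same quadratic polynomial as th 1 and th 3.
F≃th : F ≃ th 1
-- The quadratic relation leaves F equal to `th 1` or to `th 3`. The second is excluded because F +
-- `th 3` has coefficient 1 at x.
F≃th = ⊞-zero⇒≃ (⊠-cancelʳ-zero 1 (F ⊞ th 3) (trans (⊞-at F (th 3) 1) (cong (F 1 xor_) th3-1)) (begin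
  (F ⊞ th 1) ⊠ (F ⊞ th 3)
    ≈⟨ ring (F ∷ th 1 ∷ th 3 ∷ []) ((:x :+ :y) :* (:x :+ :z)) ((:x :* :x :+ :x :* (:y :+ :z)) :+ :y :* :z) refl ⟩
  (F ⊠ F ⊞ F ⊠ (th 1 ⊞ th 3)) ⊞ th 1 ⊠ th 3
    ≈⟨ R.+-cong (R.+-congˡ (R.*-congˡ th-sum)) th-product ⟩
  (F ⊠ F ⊞ F ⊠ (F ⊞ G)) ⊞ F ⊠ G
    ≈⟨ ring (F ∷ G ∷ []) ((:x :* :x :+ :x :* (:x :+ :y)) :+ :x :* :y) (:con false) refl ⟩
  constPS false ≈⟨ constPS-zero ⟩
  zeroPS ∎))
  where open ≃-Reasoning

G≃th : G ≃ th 3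
G≃th = begin
  G ≈⟨ ring (F ∷ G ∷ []) :y (:x :+ (:x :+ :y)) refl ⟩
  F ⊞ (F ⊞ G) ≈⟨ R.+-cong F≃th (R.sym th-sum) ⟩
  th 1 ⊞ (th 1 ⊞ th 3) ≈⟨ ring (th 1 ∷ th 3 ∷ []) (:x :+ (:x :+ :y)) :y refl ⟩
  th 3 ∎
  where open ≃-Reasoning

-- Modular equations between r(x) and r(x^p)

⊞-0 : ∀ f g → (f ⊞ g) 0 ≡ f 0 xor g 0
⊞-0 f g = ⊞-at f g 0

⊠-0 : ∀ f g → (f ⊠ g) 0 ≡ f 0 ∧ g 0
⊠-0 f g = trans (⊠-at f g 0) (⊛-head f g)

constant-term : ∀ {n} → Expr n → Vec Bool n → Bool
constant-term (:var i) ρ = lookup ρ i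
constant-term (:con c) ρ = c
constant-term (a :+ b) ρ = constant-term a ρ xor constant-term b ρ
constant-term (a :* b) ρ = constant-term a ρ ∧ constant-term b ρ
constant-term (a :^ zero) ρ = true
constant-term (a :^ suc k) ρ = constant-term a ρ ∧ constant-term (a :^ k) ρ

constants : ∀ {n} → Vec PS n → Vec Bool n
constants [] = []
constants (f ∷ ρ) = f 0 ∷ constants ρ

constant-term-correct : ∀ {n} (e : Expr n) ρ → ⟦ e ⟧ᵉ ρ 0 ≡ constant-term e (constants ρ)
constant-term-correct (:var i) ρ = go i ρ
  where
  go : ∀ {n} (i : Fin n) ρ → lookup ρ i 0 ≡ lookup (constants ρ) i
  go zero (f ∷ ρ) = refl
  go (suc i) (f ∷ ρ) = go i ρ
constant-term-correct (:con c) ρ = refl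
constant-term-correct (a :+ b) ρ = trans (⊞-0 (⟦ a ⟧ᵉ ρ) (⟦ b ⟧ᵉ ρ)) (cong₂ _xor_ (constant-term-correct a ρ) (constant-term-correct b ρ))
constant-term-correct (a :* b) ρ = trans (⊠-0 (⟦ a ⟧ᵉ ρ) (⟦ b ⟧ᵉ ρ)) (cong₂ _∧_ (constant-term-correct a ρ) (constant-term-correct b ρ))
constant-term-correct (a :^ zero) ρ = refl
constant-term-correct (a :^ suc k) ρ = trans (⊠-0 (⟦ a ⟧ᵉ ρ) (⟦ a ⟧ᵉ ρ ^ k)) (cong₂ _∧_ (constant-term-correct a ρ) (constant-term-correct (a :^ k) ρ))

-- In e (e + 1) = 0 the second factor has constant term 1 and can be cancelled. The theta identities
-- give the modular equations only in this form, which leaves the roots 0 and 1; the constant term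
-- picks out 0.
artin-schreier : ∀ {n} (e : Expr n) ρ → constant-term e (constants ρ) ≡ false → ⟦ e :* e :+ e ⟧ᵉ ρ ≃ zeroPS → ⟦ e ⟧ᵉ ρ ≃ zeroPS
artin-schreier e ρ e0 p = ⊠-cancelʳ-zero 0 (⟦ e ⟧ᵉ ρ ⊞ oneP)
  (trans (⊞-0 (⟦ e ⟧ᵉ ρ) oneP) (cong (_xor true) (trans (constant-term-correct e ρ) e0)))
  (R.trans (R.distribˡ (⟦ e ⟧ᵉ ρ) (⟦ e ⟧ᵉ ρ) oneP) (R.trans (R.+-congˡ (R.*-identityʳ (⟦ e ⟧ᵉ ρ))) p))

V-1 : ∀ p → .{{_ : NonZero p}} → V p oneP ≃ oneP
V-1 p = V-const p true

V-F : ∀ p → .{{_ : NonZero p}} → V p F ≃ ⟦ :F :x ⟧ᵉ (V p r ∷ [])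
V-F p = R.trans (V-cong p F-def) (R.trans (V-⊠ p _ _) (R.*-congˡ (R.trans (V-⊠ p _ _)
  (R.*-cong (R.trans (V-⊠ p _ _) (R.*-cong 1+ 1+)) 1+))))
  where
  1+ : V p (r ⊞ oneP) ≃ V p r ⊞ oneP
  1+ = R.trans (V-⊞ p r oneP) (R.+-congˡ (V-1 p))

V-G : ∀ p → .{{_ : NonZero p}} → V p G ≃ ⟦ :G :x ⟧ᵉ (V p r ∷ [])
V-G p = R.trans (V-cong p G-def) (R.trans (V-⊠ p _ _) (R.*-cong
  (R.trans (V-⊠ p _ _) (R.*-congʳ (V-⊠ p r r))) (R.trans (V-⊞ p r oneP) (R.+-congˡ (V-1 p)))))

V-th1 : ∀ p → .{{_ : NonZero p}} → .{{_ : NonZero (1 * p)}} → V p F ≃ th (1 * p)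
V-th1 p = R.trans (V-cong p F≃th) (th-V p 1)

V-th3 : ∀ p → .{{_ : NonZero p}} → .{{_ : NonZero (3 * p)}} → V p G ≃ th (3 * p)
V-th3 p = R.trans (V-cong p G≃th) (th-V p 3)

th-^8 : ∀ c → .{{_ : NonZero c}} → .{{_ : NonZero (c * 2)}} → .{{_ : NonZero (c * 2 * 2)}} → .{{_ : NonZero (c * 2 * 2 * 2)}} →
  th c ^ 8 ≃ th (c * 2 * 2 * 2)
th-^8 c = begin
  th c ^ 8 ≈⟨ ring (th c ∷ []) (:x :^ 8) (:sq (:sq (:sq :x))) refl ⟩
  ((th c ⊠ th c) ⊠ (th c ⊠ th c)) ⊠ ((th c ⊠ th c) ⊠ (th c ⊠ th c)) ≈⟨ R.*-cong 4th 4th ⟩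
  th (c * 2 * 2) ⊠ th (c * 2 * 2) ≈⟨ th-square (c * 2 * 2) ⟩
  th (c * 2 * 2 * 2) ∎
  where
  open ≃-Reasoning
  :sq : ∀ {n} → Expr n → Expr n
  :sq a = a :* a
  4th : (th c ⊠ th c) ⊠ (th c ⊠ th c) ≃ th (c * 2 * 2)
  4th = R.trans (R.*-cong (th-square c) (th-square c)) (th-square (c * 2))

th-^16 : ∀ c → .{{_ : NonZero c}} → .{{_ : NonZero (c * 2)}} → .{{_ : NonZero (c * 2 * 2)}} → .{{_ : NonZero (c * 2 * 2 * 2)}} → .{{_ : NonZero (c * 2 * 2 * 2 * 2)}} →
  th c ^ 16 ≃ th (c * 2 * 2 * 2 * 2)
th-^16 c = R.trans (ring (th c ∷ []) (:x :^ 16) (:x :^ 8 :* :x :^ 8) refl) (R.trans (R.*-cong (th-^8 c) (th-^8 c)) (th-square (c * 2 * 2 * 2)))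

level1-7 : F ⊠ V 7 F ≃ (F ⊠ V 7 F) ⊠ (F ⊠ V 7 F) ⊞ (F ^ 8 ⊞ V 7 F ^ 8)
level1-7 = begin
  F ⊠ V 7 F ≈⟨ R.*-cong F≃th (V-th1 7) ⟩
  th 1 ⊠ th 7 ≈⟨ th-7 ⟩
  (th 1 ⊠ th 7) ⊠ (th 1 ⊠ th 7) ⊞ (th 8 ⊞ th 56)
    ≈⟨ R.+-cong (R.*-cong (R.*-cong F≃th (V-th1 7)) (R.*-cong F≃th (V-th1 7))) (R.+-cong (R.trans (^-cong 8 F≃th) (th-^8 1)) (R.trans (^-cong 8 (V-th1 7)) (th-^8 7))) ⟨
  (F ⊠ V 7 F) ⊠ (F ⊠ V 7 F) ⊞ (F ^ 8 ⊞ V 7 F ^ 8) ∎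
  where open ≃-Reasoning

G≃V3F : G ≃ V 3 F
G≃V3F = R.trans G≃th (R.sym (V-th1 3))

-- The substitution of x³ for x carries F to G and commutes with `V 7`, so this relation is the
-- image of `level1-7`.
level1-7-G : G ⊠ V 7 G ≃ (G ⊠ V 7 G) ⊠ (G ⊠ V 7 G) ⊞ (G ^ 8 ⊞ V 7 G ^ 8)
level1-7-G = begin
  G ⊠ V 7 G ≈⟨ R.*-cong G≃V3F V7G ⟩
  V 3 F ⊠ V 3 (V 7 F) ≈⟨ V-⊠ 3 F (V 7 F) ⟨
  V 3 (F ⊠ V 7 F) ≈⟨ V-cong 3 level1-7 ⟩
  V 3 ((F ⊠ V 7 F) ⊠ (F ⊠ V 7 F) ⊞ (F ^ 8 ⊞ V 7 F ^ 8))
    ≈⟨ R.trans (V-⊞ 3 _ _) (R.+-cong (R.trans (V-⊠ 3 _ _) (R.*-cong (V-⊠ 3 F (V 7 F)) (V-⊠ 3 F (V 7 F))))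
         (R.trans (V-⊞ 3 _ _) (R.+-cong (V-^ 3 F 8) (V-^ 3 (V 7 F) 8)))) ⟩
  (V 3 F ⊠ V 3 (V 7 F)) ⊠ (V 3 F ⊠ V 3 (V 7 F)) ⊞ (V 3 F ^ 8 ⊞ V 3 (V 7 F) ^ 8)
    ≈⟨ R.+-cong (R.*-cong (R.*-cong G≃V3F V7G) (R.*-cong G≃V3F V7G)) (R.+-cong (^-cong 8 G≃V3F) (^-cong 8 V7G)) ⟨
  (G ⊠ V 7 G) ⊠ (G ⊠ V 7 G) ⊞ (G ^ 8 ⊞ V 7 G ^ 8) ∎
  where
  open ≃-Reasoning
  V7G : V 7 G ≃ V 3 (V 7 F)
  V7G = R.trans (V-cong 7 G≃V3F) (V-V-comm 7 3 (from-yes (coprime? 3 7)) F)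

-- At r and its conjugate, `:R` is the product of r + r² = F + G with its conjugate, and `:S` is the
-- sum of the two mixed products of F and G, which are the theta products of `th-39` when p = 13.
:R :S : ∀ {n} → Expr n → Expr n → Expr n
:R a b = a :* (a :+ :1) :* (b :* (b :+ :1))
:S a b = :F a :* :G b :+ :G a :* :F b

Φ₇ Φ₁₃ : ∀ {n} → Expr n → Expr n → Expr n
Φ₇ a b = (a :+ b) :^ 8 :+ :R a b :* (:1 :+ (a :+ b) :^ 2)
Φ₁₃ a b = (a :+ b) :^ 14 :+ (:R a b :+ :R a b :^ 2 :* (a :+ b) :^ 2)

-- The relation for F and the relation for G add up to `Φ₇` (`Φ₇` + 1); neither alone has this
-- shape.
modular-7 : ⟦ Φ₇ :x :y ⟧ᵉ (r ∷ V 7 r ∷ []) ≃ zeroPS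
modular-7 = artin-schreier (Φ₇ :x :y) ρ refl (begin
  ⟦ Φ₇ :x :y :* Φ₇ :x :y :+ Φ₇ :x :y ⟧ᵉ ρ
    ≈⟨ ring ρ (Φ₇ :x :y :* Φ₇ :x :y :+ Φ₇ :x :y) (:L :F :+ :L :G) refl ⟩
  ⟦ :L :F :+ :L :G ⟧ᵉ ρ ≈⟨ R.+-cong LF LG ⟩
  zeroPS ⊞ zeroPS ≈⟨ R.+-identityˡ zeroPS ⟩
  zeroPS ∎)
  where
  open ≃-Reasoning
  ρ = r ∷ V 7 r ∷ []
  :L : (Expr 2 → Expr 2) → Expr 2
  :L h = h :x :* h :y :+ ((h :x :* h :y) :* (h :x :* h :y) :+ (h :x :^ 8 :+ h :y :^ 8))
  level : ∀ {f f′ g g′} → f ≃ f′ → g ≃ g′ → f ⊠ g ≃ (f ⊠ g) ⊠ (f ⊠ g) ⊞ (f ^ 8 ⊞ g ^ 8) → f′ ⊠ g′ ⊞ ((f′ ⊠ g′) ⊠ (f′ ⊠ g′) ⊞ (f′ ^ 8 ⊞ g′ ^ 8)) ≃ zeroPS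
  level e e′ l = R.trans (R.+-cong (R.sym (R.*-cong e e′)) (R.sym (R.+-cong (R.*-cong (R.*-cong e e′) (R.*-cong e e′)) (R.+-cong (^-cong 8 e) (^-cong 8 e′)))))
    (R.trans (R.+-congˡ (R.sym l)) (+-self _))
  LF : ⟦ :L :F ⟧ᵉ ρ ≃ zeroPS
  LF = level F-def (V-F 7) level1-7
  LG : ⟦ :L :G ⟧ᵉ ρ ≃ zeroPS
  LG = level G-def (V-G 7) level1-7-G

-- Expressed in r and its conjugate, `th-39` says Z² + Z = 0. Moreover Z is `Φ₁₃` times the square
-- of u, and u is nonzero because its coefficient at x is 1.
modular-13 : ⟦ Φ₁₃ :x :y ⟧ᵉ (r ∷ V 13 r ∷ []) ≃ zeroPS
modular-13 = cancel-u (cancel-u (begin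
  (⟦ Φ₁₃ :x :y ⟧ᵉ ρ ⊠ u) ⊠ u ≈⟨ ring ρ ((Φ₁₃ :x :y :* (:x :+ :y)) :* (:x :+ :y)) :Z refl ⟩
  ⟦ :Z ⟧ᵉ ρ ≈⟨ artin-schreier :Z ρ refl Z²+Z ⟩
  zeroPS ∎))
  where
  open ≃-Reasoning
  ρ = r ∷ V 13 r ∷ []
  u = r ⊞ V 13 r
  cancel-u : ∀ {f} → f ⊠ u ≃ zeroPS → f ≃ zeroPS
  cancel-u = ⊠-cancelʳ-zero 1 u (⊞-at r (V 13 r) 1)
  :Z : Expr 2
  :Z = (:x :+ :y) :^ 16 :+ (:S :x :y :+ :S :x :y :^ 2)
  :s₁ :s₂ :A : Expr 2
  :s₁ = :F :x :* :G :y
  :s₂ = :G :x :* :F :y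
  :A = (:F :x :^ 16 :+ :G :y :^ 16) :+ (:G :x :^ 16 :+ :F :y :^ 16)
  s₁ : th 1 ⊠ th 39 ≃ ⟦ :s₁ ⟧ᵉ ρ
  s₁ = R.*-cong (R.trans (R.sym F≃th) F-def) (R.trans (R.sym (V-th3 13)) (V-G 13))
  s₂ : th 3 ⊠ th 13 ≃ ⟦ :s₂ ⟧ᵉ ρ
  s₂ = R.*-cong (R.trans (R.sym G≃th) G-def) (R.trans (R.sym (V-th1 13)) (V-F 13))
  A≃ : (th 16 ⊞ th 624) ⊞ (th 48 ⊞ th 208) ≃ ⟦ :A ⟧ᵉ ρ
  A≃ = R.sym (R.+-cong
    (R.+-cong (R.trans (^-cong 16 (R.trans (R.sym F-def) F≃th)) (th-^16 1)) (R.trans (^-cong 16 (R.trans (R.sym (V-G 13)) (V-th3 13))) (th-^16 39)))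
    (R.+-cong (R.trans (^-cong 16 (R.trans (R.sym G-def) G≃th)) (th-^16 3)) (R.trans (^-cong 16 (R.trans (R.sym (V-F 13)) (V-th1 13))) (th-^16 13))))
  fourth : ∀ {f g} → f ≃ g → (f ⊠ f) ⊠ (f ⊠ f) ≃ (g ⊠ g) ⊠ (g ⊠ g)
  fourth e = R.*-cong (R.*-cong e e) (R.*-cong e e)
  Z²+Z : ⟦ :Z :* :Z :+ :Z ⟧ᵉ ρ ≃ zeroPS
  Z²+Z = begin
    ⟦ :Z :* :Z :+ :Z ⟧ᵉ ρ
      ≈⟨ ring ρ (:Z :* :Z :+ :Z) ((:s₁ :+ :s₂) :+ (((:s₁ :* :s₁) :* (:s₁ :* :s₁) :+ (:s₂ :* :s₂) :* (:s₂ :* :s₂)) :+ :A)) refl ⟩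
    ⟦ (:s₁ :+ :s₂) :+ (((:s₁ :* :s₁) :* (:s₁ :* :s₁) :+ (:s₂ :* :s₂) :* (:s₂ :* :s₂)) :+ :A) ⟧ᵉ ρ
      ≈⟨ R.+-congʳ (R.trans (R.sym (R.+-cong s₁ s₂)) (R.trans th-39 (R.+-cong (R.+-cong (fourth s₁) (fourth s₂)) A≃))) ⟩
    ⟦ (((:s₁ :* :s₁) :* (:s₁ :* :s₁) :+ (:s₂ :* :s₂) :* (:s₂ :* :s₂)) :+ :A) :+ (((:s₁ :* :s₁) :* (:s₁ :* :s₁) :+ (:s₂ :* :s₂) :* (:s₂ :* :s₂)) :+ :A) ⟧ᵉ ρ
      ≈⟨ +-self _ ⟩
    zeroPS ∎

-- φ describes the multiplication by ±p on the odd integers, parametrised by ι.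
module _ (p : ℕ) .{{_ : NonZero p}} (prime : Prime p) (φ : ℤ → ℤ)
         (ι-φ : ∀ k → ι (φ k) *ᶻ ι (φ k) ≡ (+ p *ᶻ ι k) *ᶻ (+ p *ᶻ ι k))
         (φ-injective : ∀ {k l} → φ k ≡ φ l → k ≡ l)
         (φ-surjective : ∀ k z → ι k ≡ z *ᶻ + p → ∃[ l ] φ l ≡ k) where

  private
    sq-φ : ∀ k → sq (ι (φ k)) ≡ p * p * sq (ι k)
    sq-φ k = begin
      ∣ ι (φ k) *ᶻ ι (φ k) ∣ ≡⟨ cong ∣_∣ (ι-φ k) ⟩
      ∣ (+ p *ᶻ ι k) *ᶻ (+ p *ᶻ ι k) ∣ ≡⟨ ℤₚ.abs-* (+ p *ᶻ ι k) (+ p *ᶻ ι k) ⟩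
      ∣ + p *ᶻ ι k ∣ * ∣ + p *ᶻ ι k ∣ ≡⟨ cong₂ _*_ (ℤₚ.abs-* (+ p) (ι k)) (ℤₚ.abs-* (+ p) (ι k)) ⟩
      (p * ∣ ι k ∣) * (p * ∣ ι k ∣) ≡⟨ rearrange p ∣ ι k ∣ ⟩
      p * p * (∣ ι k ∣ * ∣ ι k ∣) ≡⟨ cong (p * p *_) (ℤₚ.abs-* (ι k) (ι k)) ⟨
      p * p * sq (ι k) ∎
      where
      open ≡-Reasoning
      rearrange : ∀ p a → (p * a) * (p * a) ≡ p * p * (a * a)
      rearrange = ℕ-Solver.solve-∀

    surjective : ∀ k → p ∣ sq (ι k) → ∃[ l ] φ l ≡ k
    surjective k d with euclidsLemma ∣ ι k ∣ ∣ ι k ∣ prime (subst (p ∣_) (ℤₚ.abs-* (ι k) (ι k)) d)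
    ... | inj₁ d′ with ∣ᵤ⇒∣ {+ p} {ι k} d′
    ... | dividesᶻ z e = φ-surjective k z e
    surjective k d | inj₂ d′ with ∣ᵤ⇒∣ {+ p} {ι k} d′
    ... | dividesᶻ z e = φ-surjective k z e

  -- A square divisible by the prime p is divisible by p², so the terms of `th 1` at multiples of p
  -- are exactly those in the image of `φ`. Hence the exponents of `U p (th 1)` are p times those of
  -- `th 1`, and the two halves of `T p` cancel.
  U-th1 : U p (th 1) ≃ V p (th 1)
  U-th1 = R.sym (V-unique p (th 1) (U p (th 1)) on off)
    where
    g = Gen-th 1
    one* : ∀ k → 1 * sq (ι k) ≡ sq (ι k)
    one* k = ℕₚ.*-identityˡ (sq (ι k))
    on : ∀ n → th 1 (p * (n * p)) ≡ th 1 n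
    on n = trans (series g (p * (n * p))) (trans (cong odd (trans (↭-length (∼bag⇒↭ (unique∧set⇒bag (uniq g _)
      (Uniqueₚ.map⁺ φ-injective (uniq g n)) (mk⇔ to from)))) (Lₚ.length-map φ (fib g n)))) (sym (series g n)))
      where
      comm : ∀ p n → p * (n * p) ≡ p * p * n
      comm = ℕ-Solver.solve-∀
      to : ∀ {k} → k ∈ fib g (p * (n * p)) → k ∈ map φ (fib g n)
      to {k} k∈ with surjective k (divides (n * p) (trans (trans (sym (one* k)) (sound g k∈)) (ℕₚ.*-comm p (n * p))))
      ... | l , refl = ∈-map⁺ φ (complete′ g l (trans (one* l) (ℕₚ.*-cancelˡ-≡ (sq (ι l)) n (p * p) {{ℕₚ.m*n≢0 p p}}
        (trans (sym (sq-φ l)) (trans (sym (one* (φ l))) (trans (sound g k∈) (comm p n)))))))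
      from : ∀ {k} → k ∈ map φ (fib g n) → k ∈ fib g (p * (n * p))
      from k∈ with ∈-map⁻ φ k∈
      ... | l , l∈ , refl = complete′ g (φ l) (trans (one* (φ l)) (trans (sq-φ l)
        (trans (cong (p * p *_) (trans (sym (one* l)) (sound g l∈))) (sym (comm p n)))))
    off : ∀ n → ¬ (p ∣ n) → th 1 (p * n) ≡ false
    off n p∤n = trans (series g (p * n)) (empty (fib g (p * n)) λ k k∈ → p∤n (p∣n k (trans (sym (one* k)) (sound g k∈))))
      where
      empty : ∀ (l : List ℤ) → (∀ k → ¬ (k ∈ l)) → odd (length l) ≡ false
      empty [] _ = refl
      empty (k ∷ l) none = ⊥-elim (none k (here refl))
      p∣n : ∀ k → sq (ι k) ≡ p * n → p ∣ n
      p∣n k e with surjective k (divides n (trans e (ℕₚ.*-comm p n)))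
      ... | l , refl = divides (sq (ι l)) (trans (ℕₚ.*-cancelˡ-≡ n (p * sq (ι l)) p
        (trans (sym e) (trans (sq-φ l) (ℕₚ.*-assoc p p (sq (ι l)))))) (ℕₚ.*-comm p (sq (ι l))))

  T-F : T p F ≃ zeroPS
  T-F = R.trans (T-cong p F≃th) (R.trans (T≃U⊞V p (th 1)) (R.trans (R.+-congʳ U-th1) (+-self (V p (th 1)))))

T₇-F : T 7 F ≃ zeroPS
T₇-F = T-F 7 (from-yes (prime? 7)) φ square (λ {k} {l} e → ℤₚ.neg-injective (ℤₚ.*-cancelˡ-≡ (+ 7) (-ᶻ k) (-ᶻ l) (ℤ-Group.∙-cancelʳ (-ᶻ + 2) _ _ e)))
  -- The preimage is -(k + 2) / 7, written without division by means of 4 k + 1 = 7 z.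
  (λ k z e → k -ᶻ + 2 *ᶻ z , surj k z e)
  where
  φ : ℤ → ℤ
  -- Here `ι (φ k)` is -7 times `ι k`: since 7 is 3 modulo 4, the sign is needed to land again on 1
  -- modulo 4.
  φ k = + 7 *ᶻ (-ᶻ k) -ᶻ + 2
  square : ∀ k → (+ 4 *ᶻ (+ 7 *ᶻ (-ᶻ k) -ᶻ + 2) +ᶻ 1ℤ) *ᶻ (+ 4 *ᶻ (+ 7 *ᶻ (-ᶻ k) -ᶻ + 2) +ᶻ 1ℤ) ≡ (+ 7 *ᶻ (+ 4 *ᶻ k +ᶻ 1ℤ)) *ᶻ (+ 7 *ᶻ (+ 4 *ᶻ k +ᶻ 1ℤ))
  square = solve-∀
  surj : ∀ k z → ι k ≡ z *ᶻ + 7 → φ (k -ᶻ + 2 *ᶻ z) ≡ k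
  surj k z e = trans (l₁ k z) (trans (cong (λ w → + 2 *ᶻ w -ᶻ + 7 *ᶻ k -ᶻ + 2) (sym e)) (l₂ k))
    where
    l₁ : ∀ k z → + 7 *ᶻ (-ᶻ (k -ᶻ + 2 *ᶻ z)) -ᶻ + 2 ≡ + 2 *ᶻ (z *ᶻ + 7) -ᶻ + 7 *ᶻ k -ᶻ + 2
    l₁ = solve-∀
    l₂ : ∀ k → + 2 *ᶻ (+ 4 *ᶻ k +ᶻ 1ℤ) -ᶻ + 7 *ᶻ k -ᶻ + 2 ≡ k
    l₂ = solve-∀

T₁₃-F : T 13 F ≃ zeroPS
T₁₃-F = T-F 13 (from-yes (prime? 13)) φ square (λ {k} {l} e → ℤₚ.*-cancelˡ-≡ (+ 13) k l (ℤ-Group.∙-cancelʳ (+ 3) _ _ e))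
  (λ k z e → + 10 *ᶻ z -ᶻ + 3 *ᶻ k -ᶻ 1ℤ , surj k z e)
  where
  φ : ℤ → ℤ
  φ k = + 13 *ᶻ k +ᶻ + 3
  square : ∀ k → (+ 4 *ᶻ (+ 13 *ᶻ k +ᶻ + 3) +ᶻ 1ℤ) *ᶻ (+ 4 *ᶻ (+ 13 *ᶻ k +ᶻ + 3) +ᶻ 1ℤ) ≡ (+ 13 *ᶻ (+ 4 *ᶻ k +ᶻ 1ℤ)) *ᶻ (+ 13 *ᶻ (+ 4 *ᶻ k +ᶻ 1ℤ))
  square = solve-∀
  surj : ∀ k z → ι k ≡ z *ᶻ + 13 → φ (+ 10 *ᶻ z -ᶻ + 3 *ᶻ k -ᶻ 1ℤ) ≡ k
  surj k z e = trans (l₁ k z) (trans (cong (λ w → + 10 *ᶻ w -ᶻ + 39 *ᶻ k -ᶻ + 10) (sym e)) (l₂ k))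
    where
    l₁ : ∀ k z → + 13 *ᶻ (+ 10 *ᶻ z -ᶻ + 3 *ᶻ k -ᶻ 1ℤ) +ᶻ + 3 ≡ + 10 *ᶻ (z *ᶻ + 13) -ᶻ + 39 *ᶻ k -ᶻ + 10
    l₁ = solve-∀
    l₂ : ∀ k → + 10 *ᶻ (+ 4 *ᶻ k +ᶻ 1ℤ) -ᶻ + 39 *ᶻ k -ᶻ + 10 ≡ k
    l₂ = solve-∀

T-G : ∀ p → .{{_ : NonZero p}} → Coprime 3 p → T p F ≃ zeroPS → T p G ≃ zeroPS
T-G p c e = R.trans (T-cong p G≃V3F) (R.trans (T-V-comm p 3 c F) (R.trans (V-cong 3 e) (V-zero 3)))
  where
  V-zero : ∀ p → .{{_ : NonZero p}} → V p zeroPS ≃ zeroPS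
  V-zero p = R.trans (V-cong p (R.sym constPS-zero)) (R.trans (V-const p false) constPS-zero)

-- Recurrences for T p (rⁿ)

-- The exponents (i , j) of the monomials of a polynomial over 𝔽₂ in two variables. As a recurrence,
-- i is the offset of the index and j the power of the multiplier; the leading term comes first in
-- the relations below.
Relation : Set
Relation = List (ℕ × ℕ)

:Σ : ∀ {n} → Relation → Expr n → Expr n → Expr n
:Σ [] a b = :con false
:Σ ((i , j) ∷ l) a b = a :^ i :* b :^ j :+ :Σ l a b

:Σ-correct : ∀ {n} l (a b : Expr n) ρ → ⟦ :Σ l a b ⟧ᵉ ρ ≃ sumPS (λ (i , j) → ⟦ a ⟧ᵉ ρ ^ i ⊠ ⟦ b ⟧ᵉ ρ ^ j) l
:Σ-correct [] a b ρ = constPS-zero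
:Σ-correct ((i , j) ∷ l) a b ρ = R.+-congˡ (:Σ-correct l a b ρ)

T-recurrence : ∀ p → .{{_ : NonZero p}} → ∀ s l →
  ⟦ :Σ l :x :y ⟧ᵉ (s ∷ V p s ∷ []) ≃ zeroPS → ⟦ :Σ l :y :x ⟧ᵉ (s ∷ V p s ∷ []) ≃ zeroPS →
  ∀ f → sumPS (λ (i , j) → s ^ j ⊠ T p (f ⊠ s ^ i)) l ≃ zeroPS
T-recurrence p s l e e′ = T-relation p (λ (i , j) → s ^ i) (λ (i , j) → s ^ j) l
  (R.trans (sumPS-cong (λ (i , j) → R.*-congˡ (V-^ p s j)) l) (R.trans (R.sym (:Σ-correct l :x :y _)) e))
  (R.trans (sumPS-cong (λ (i , j) → R.trans (R.*-congˡ (V-^ p s i)) (R.*-comm _ _)) l) (R.trans (R.sym (:Σ-correct l :y :x _)) e′))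

R₇ R₁₃ : Relation
R₇ = (8 , 0) ∷ (0 , 8) ∷ (1 , 1) ∷ (1 , 2) ∷ (2 , 1) ∷ (2 , 2) ∷ (3 , 1) ∷ (3 , 2) ∷ (4 , 1) ∷ (4 , 2) ∷ (1 , 3) ∷ (1 , 4) ∷ (2 , 3) ∷ (2 , 4) ∷ []
R₁₃ = (14 , 0) ∷ (12 , 2) ∷ (10 , 4) ∷ (8 , 6) ∷ (6 , 8) ∷ (4 , 10) ∷ (2 , 12) ∷ (0 , 14) ∷ (1 , 1) ∷ (1 , 2) ∷ (2 , 1) ∷ (2 , 2)
  ∷ (6 , 4) ∷ (6 , 2) ∷ (4 , 2) ∷ (4 , 6) ∷ (2 , 6) ∷ (2 , 4) ∷ []

module PowersOf-r (p : ℕ) .{{_ : NonZero p}} (l : Relation)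
  (e : ⟦ :Σ l :x :y ⟧ᵉ (r ∷ V p r ∷ []) ≃ zeroPS) (e′ : ⟦ :Σ l :y :x ⟧ᵉ (r ∷ V p r ∷ []) ≃ zeroPS)
  (coprime-2 : Coprime 2 p) (coprime-3 : Coprime 3 p) (T-F≃0 : T p F ≃ zeroPS) where

  t : ℕ → PS
  t k = T p (r ^ k)

  recurrence : ∀ k → sumPS (λ (i , j) → r ^ j ⊠ t (k + i)) l ≃ zeroPS
  recurrence k = R.trans (sumPS-cong (λ (i , j) → R.*-congˡ (T-cong p (^-homo-* r k i))) l) (T-recurrence p r l e e′ (r ^ k))

  t-double : ∀ k → t (k + k) ≃ t k ⊠ t k
  t-double k = R.trans (T-cong p (^-homo-* r k k)) (T-square p coprime-2 (r ^ k))

  square-of-zero : ∀ {f g} → f ≃ g ⊠ g → g ≃ zeroPS → f ≃ constPS false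
  square-of-zero a b = R.trans a (R.trans (R.*-congˡ b) (R.trans (R.zeroʳ _) (R.sym constPS-zero)))

  t₀ : t 0 ≃ zeroPS
  t₀ = R.trans (T≃U⊞V p oneP) (R.trans (R.+-cong U-one (V-1 p)) (+-self oneP))
    where
    U-one : U p oneP ≃ oneP
    U-one = R.trans (U-cong p (R.trans (R.sym (V-1 p)) (R.sym (R.*-identityˡ (V p oneP)))))
      (R.trans (U-⊠-V p oneP oneP) (R.trans (R.*-identityʳ _) (one-at p)))
      where
      one-at : ∀ p → .{{_ : NonZero p}} → U p oneP ≃ oneP
      one-at (suc p) = mk λ { zero → cong oneP (ℕₚ.*-zeroʳ (suc p)) ; (suc n) → refl }

  T-constant-free : ∀ f → f 0 ≡ false → T p f 0 ≡ false
  T-constant-free f f0 = trans (at (T≃U⊞V p f) 0) (trans (⊞-0 (U p f) (V p f)) (cong₂ _xor_ (trans (cong f (ℕₚ.*-zeroʳ p)) f0) (V-0 p)))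
    where
    V-0 : ∀ p → .{{_ : NonZero p}} → V p f 0 ≡ false
    V-0 (suc p) = f0

  -- Since F + G = r + r² is annihilated, t 1 equals its own square; its constant term then decides
  -- between 0 and 1.
  t₁ : t 1 ≃ zeroPS
  t₁ = artin-schreier :x (t 1 ∷ []) (T-constant-free (r ^ 1) (⊠-0 r oneP)) (begin
    t 1 ⊠ t 1 ⊞ t 1 ≈⟨ R.+-congʳ (t-double 1) ⟨
    t 2 ⊞ t 1 ≈⟨ T-⊞ p (r ^ 2) (r ^ 1) ⟨
    T p (r ^ 2 ⊞ r ^ 1) ≈⟨ T-cong p (R.trans (ring (r ∷ []) (:x :^ 2 :+ :x :^ 1) (:x :+ :x :* :x) refl) (R.sym F⊞G)) ⟩
    T p (F ⊞ G) ≈⟨ T-⊞ p F G ⟩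
    T p F ⊞ T p G ≈⟨ R.+-cong T-F≃0 (T-G p coprime-3 T-F≃0) ⟩
    zeroPS ⊞ zeroPS ≈⟨ R.+-identityˡ zeroPS ⟩
    zeroPS ∎)
    where open ≃-Reasoning

  t₂ : t 2 ≃ constPS false
  t₂ = square-of-zero (t-double 1) t₁

  t₄ : t 4 ≃ constPS false
  t₄ = square-of-zero (t-double 2) (R.trans t₂ constPS-zero)

  -- G is r³ + r⁴, and t 4 vanishes as the fourth power of t 1.
  t₃ : t 3 ≃ zeroPS
  t₃ = begin
    t 3 ≈⟨ R.trans (R.+-congˡ (R.trans t₄ constPS-zero)) (R.+-identityʳ (t 3)) ⟨
    t 3 ⊞ t 4 ≈⟨ T-⊞ p (r ^ 3) (r ^ 4) ⟨
    T p (r ^ 3 ⊞ r ^ 4) ≈⟨ T-cong p (R.trans (ring (r ∷ []) (:x :^ 3 :+ :x :^ 4) (:G :x) refl) (R.sym G-def)) ⟩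
    T p G ≈⟨ T-G p coprime-3 T-F≃0 ⟩
    zeroPS ∎
    where open ≃-Reasoning

  -- One instance of the recurrence with the values known so far substituted. The values of `τ` at
  -- other indices are fillers: if an instance needs one of them, `known` is `nothing` there and
  -- `evaluate` fails.
  module _ {n} (b : ℕ) (ρ : Vec PS n) (τ : ℕ → Expr (suc n)) (known : ∀ m → Maybe (t (b + m) ≃ ⟦ τ m ⟧ᵉ (r ∷ ρ))) where

    :recurrence : Relation → ℕ → Expr (suc n)
    :recurrence [] k = :con false
    :recurrence ((i , j) ∷ l) k = :x :^ j :* τ (k + i) :+ :recurrence l k

    evaluate : ∀ k l → Maybe (⟦ :recurrence l k ⟧ᵉ (r ∷ ρ) ≃ sumPS (λ (i , j) → r ^ j ⊠ t (b + (k + i))) l)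
    evaluate k [] = just constPS-zero
    evaluate k ((i , j) ∷ l) = Maybe.zipWith (λ a b → R.+-cong (R.*-congˡ (R.sym a)) b) (known (k + i)) (evaluate k l)

  -- As r begins with x, its k-th power begins with x^k. For k = p this gives the coefficient of x
  -- in t p, and so the nonvanishing that selects the right root of the quadratic equations.
  r^k-at-k : ∀ k → (r ^ k) k ≡ true
  r^k-at-k k = trans (at (shifted k) k) (trans (cong (shN k (tl r ^ k)) (sym (ℕₚ.+-identityʳ k))) (trans (shN-+ k (tl r ^ k) 0) (one k)))
    where
    shifted : ∀ k → r ^ k ≃ shN k (tl r ^ k)
    shifted zero = R.refl
    shifted (suc k) = R.trans (R.*-cong r-shift (shifted k)) (R.trans (sh-⊠ (tl r) _) (sh-cong (R.trans (R.*-comm (tl r) _)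
      (R.trans (shN-⊠ k (tl r ^ k) (tl r)) (shN-cong k (R.*-comm (tl r ^ k) (tl r)))))))
      where
      r-shift : r ≃ sh (tl r)
      r-shift = mk λ { zero → refl ; (suc n) → refl }
    one : ∀ k → (tl r ^ k) 0 ≡ true
    one zero = refl
    one (suc k) = trans (⊠-0 (tl r) (tl r ^ k)) (one k)

:q : ∀ {n} → Expr (suc n)
:q = :x :+ :x :* :x

q : PS
q = r ⊞ r ⊠ r

q-1 : q 1 ≡ true
q-1 = trans (⊞-at r (r ⊠ r) 1) (cong (true xor_) (⊠-at r r 1))

-- Values of T 7 on low powers of r

module Level7 where
  ρ₀ : Vec PS 2
  ρ₀ = r ∷ V 7 r ∷ []
  open PowersOf-r 7 R₇
    (R.trans (ring ρ₀ (:Σ R₇ :x :y) (Φ₇ :x :y) refl) modular-7) (R.trans (ring ρ₀ (:Σ R₇ :y :x) (Φ₇ :x :y) refl) modular-7)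
    (from-yes (coprime? 2 7)) (from-yes (coprime? 3 7)) T₇-F public

  zero′ : ∀ {f} → f ≃ zeroPS → f ≃ constPS false
  zero′ e = R.trans e (R.sym constPS-zero)

  τ : ℕ → Expr 3
  τ 5 = :y
  τ 7 = :z
  τ 10 = :y :* :y
  τ _ = :con false

  known : ∀ m → Maybe (t m ≃ ⟦ τ m ⟧ᵉ (r ∷ t 5 ∷ t 7 ∷ []))
  known 0 = just (zero′ t₀)
  known 1 = just (zero′ t₁)
  known 2 = just t₂
  known 3 = just (zero′ t₃)
  known 4 = just t₄
  known 5 = just R.refl
  known 6 = just (square-of-zero (t-double 3) t₃)
  known 7 = just R.refl
  known 8 = just (square-of-zero (t-double 4) (R.trans t₄ constPS-zero))
  known 10 = just (t-double 5)
  known 12 = just (square-of-zero (t-double 6) (R.trans (square-of-zero (t-double 3) t₃) constPS-zero))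
  known _ = nothing

  ρ : Vec PS 3
  ρ = r ∷ t 5 ∷ t 7 ∷ []

  :rec : ℕ → Expr 3
  :rec = :recurrence 0 (t 5 ∷ t 7 ∷ []) τ known R₇

  rec₂ : ⟦ :rec 2 ⟧ᵉ ρ ≃ zeroPS
  rec₂ = R.trans (Maybe.from-just (evaluate 0 _ τ known 2 R₇)) (recurrence 2)

  rec₄ : ⟦ :rec 4 ⟧ᵉ ρ ≃ zeroPS
  rec₄ = R.trans (Maybe.from-just (evaluate 0 _ τ known 4 R₇)) (recurrence 4)

  -- The instance of the recurrence at 4 is this identity multiplied by `q`.
  t₇′ : t 7 ≃ (oneP ⊞ r ⊠ r) ⊠ t 5
  t₇′ = ⊠-cancelʳ 1 q q-1 (⊞-zero⇒≃ (R.trans (ring ρ (:z :* :q :+ ((:1 :+ :x :* :x) :* :y) :* :q) (:rec 4) refl) rec₄))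

  t₇-1 : t 7 1 ≡ true
  t₇-1 = trans (at (T≃U⊞V 7 (r ^ 7)) 1) (trans (⊞-at (U 7 (r ^ 7)) (V 7 (r ^ 7)) 1) (trans (xor-identityʳ _) (r^k-at-k 7)))

  -- The factor 1 + r² does not change the coefficient of x, because r has no constant term; so the
  -- coefficient is that of t 7.
  t₅-1 : t 5 1 ≡ true
  t₅-1 = begin
    t 5 1 ≡⟨ xor-identityʳ (t 5 1) ⟨
    t 5 1 xor false ≡⟨ cong (t 5 1 xor_) r²t₅ ⟨
    t 5 1 xor (r ⊠ (r ⊠ t 5)) 1 ≡⟨ ⊞-at (t 5) _ 1 ⟨
    (t 5 ⊞ r ⊠ (r ⊠ t 5)) 1 ≡⟨ at (ring ρ (:y :+ :x :* (:x :* :y)) ((:1 :+ :x :* :x) :* :y) refl) 1 ⟩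
    ((oneP ⊞ r ⊠ r) ⊠ t 5) 1 ≡⟨ at t₇′ 1 ⟨
    t 7 1 ≡⟨ t₇-1 ⟩
    true ∎
    where
    open ≡-Reasoning
    r²t₅ : (r ⊠ (r ⊠ t 5)) 1 ≡ false
    r²t₅ = trans (⊠-at r (r ⊠ t 5) 1) (trans (xor-identityʳ _) (⊠-0 r (t 5)))

  -- The instance at 2 reads (t 5 + q) t 5 = 0, and t 5 is nonzero.
  t₅ : t 5 ≃ q
  t₅ = ⊞-zero⇒≃ (⊠-cancelʳ-zero 1 (t 5) t₅-1 (R.trans (ring ρ ((:y :+ :q) :* :y) (:rec 2) refl) rec₂))

  t₇ : t 7 ≃ (oneP ⊞ r ⊠ r) ⊠ q
  t₇ = R.trans t₇′ (R.*-congˡ t₅)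

-- Values of T 13 on low powers of r

opaque
  unfolding _⊞_

  r^5-at-13 : (r ^ 5) 13 ≡ false
  r^5-at-13 = refl

square-zero-expr : ∀ {n} (e : Expr n) ρ → ⟦ e :* e ⟧ᵉ ρ ≃ zeroPS → ⟦ e ⟧ᵉ ρ ≃ zeroPS
square-zero-expr e ρ = square-zero

module Level13 where
  ρ₀ : Vec PS 2
  ρ₀ = r ∷ V 13 r ∷ []
  open PowersOf-r 13 R₁₃
    (R.trans (ring ρ₀ (:Σ R₁₃ :x :y) (Φ₁₃ :x :y) refl) modular-13) (R.trans (ring ρ₀ (:Σ R₁₃ :y :x) (Φ₁₃ :x :y) refl) modular-13)
    (from-yes (coprime? 2 13)) (from-yes (coprime? 3 13)) T₁₃-F public

  zero′ : ∀ {f} → f ≃ zeroPS → f ≃ constPS false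
  zero′ e = R.trans e (R.sym constPS-zero)

  double-zero : ∀ k → t k ≃ constPS false → t (k + k) ≃ constPS false
  double-zero k e = square-of-zero (t-double k) (R.trans e constPS-zero)

  t₆ : t 6 ≃ constPS false
  t₆ = square-of-zero (t-double 3) t₃

  t₈ : t 8 ≃ constPS false
  t₈ = double-zero 4 t₄

  t₁₂ : t 12 ≃ constPS false
  t₁₂ = double-zero 6 t₆

  t₁₆ : t 16 ≃ constPS false
  t₁₆ = double-zero 8 t₈

  t₁₃-1 : t 13 1 ≡ true
  t₁₃-1 = trans (at (T≃U⊞V 13 (r ^ 13)) 1) (trans (⊞-at (U 13 (r ^ 13)) (V 13 (r ^ 13)) 1) (trans (xor-identityʳ _) (r^k-at-k 13)))

  t₅-1 : t 5 1 ≡ false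
  t₅-1 = trans (at (T≃U⊞V 13 (r ^ 5)) 1) (trans (⊞-at (U 13 (r ^ 5)) (V 13 (r ^ 5)) 1) (trans (xor-identityʳ _) r^5-at-13))

  module Step₁ where
    ρ : Vec PS 3
    ρ = r ∷ t 5 ∷ t 7 ∷ []

    τ : ℕ → Expr 3
    τ 10 = :y :* :y
    τ 14 = :z :* :z
    τ _ = :con false

    known : ∀ m → Maybe (t m ≃ ⟦ τ m ⟧ᵉ ρ)
    known 0 = just (zero′ t₀)
    known 1 = just (zero′ t₁)
    known 2 = just t₂
    known 4 = just t₄
    known 6 = just t₆
    known 8 = just t₈
    known 10 = just (t-double 5)
    known 12 = just t₁₂
    known 14 = just (t-double 7)
    known _ = nothing

    -- At index 0 only t 14 = (t 7)² and r⁴ t 10 = r⁴ (t 5)² survive, so the instance is a perfect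
    -- square.
    t₇ : t 7 ≃ r ⊠ r ⊠ t 5
    t₇ = ⊞-zero⇒≃ (square-zero-expr (:z :+ :x :* :x :* :y) ρ (R.trans
      (ring ρ ((:z :+ :x :* :x :* :y) :* (:z :+ :x :* :x :* :y)) (:recurrence 0 _ τ known R₁₃ 0) refl)
      (R.trans (Maybe.from-just (evaluate 0 _ τ known 0 R₁₃)) (recurrence 0))))

  module Step₂ where
    ρ : Vec PS 3
    ρ = r ∷ t 5 ∷ t 9 ∷ []

    τ : ℕ → Expr 3
    τ 5 = :y
    τ 7 = :x :* :x :* :y
    τ 10 = :y :* :y
    τ 14 = (:x :* :x :* :y) :* (:x :* :x :* :y)
    τ 18 = :z :* :z
    τ 20 = (:y :* :y) :* (:y :* :y)
    τ _ = :con false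

    known : ∀ m → Maybe (t m ≃ ⟦ τ m ⟧ᵉ ρ)
    known 4 = just t₄
    known 5 = just R.refl
    known 6 = just t₆
    known 7 = just Step₁.t₇
    known 8 = just t₈
    known 10 = just (t-double 5)
    known 12 = just t₁₂
    known 14 = just (R.trans (t-double 7) (R.*-cong Step₁.t₇ Step₁.t₇))
    known 16 = just t₁₆
    known 18 = just (t-double 9)
    known 20 = just (R.trans (t-double 10) (R.*-cong (t-double 5) (t-double 5)))
    known _ = nothing

    :rec : ℕ → Expr 3
    :rec = :recurrence 0 _ τ known R₁₃

    rec₄ : ⟦ :rec 4 ⟧ᵉ ρ ≃ zeroPS
    rec₄ = R.trans (Maybe.from-just (evaluate 0 _ τ known 4 R₁₃)) (recurrence 4)

    rec₆ : ⟦ :rec 6 ⟧ᵉ ρ ≃ zeroPS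
    rec₆ = R.trans (Maybe.from-just (evaluate 0 _ τ known 6 R₁₃)) (recurrence 6)

    -- The unknown t 9 enters the instance at 4 through t 18 and the instance at 6 through r² t 18.
    -- In the combination without it, the square of t 5 (t 5 + q) is left. The root q is excluded by
    -- the coefficient of x, which is 0 for t 5 because x¹³ does not occur in r⁵.
    t₅ : t 5 ≃ zeroPS
    t₅ = ⊠-cancelʳ-zero 1 (t 5 ⊞ q) (trans (⊞-at (t 5) q 1) (cong₂ _xor_ t₅-1 q-1))
      (square-zero-expr (:y :* (:y :+ :q)) ρ (R.trans
        (ring ρ ((:y :* (:y :+ :q)) :* (:y :* (:y :+ :q))) (:rec 6 :+ (:x :* :x) :* :rec 4) refl)
        (R.trans (R.+-cong rec₆ (R.trans (R.*-congˡ rec₄) (R.zeroʳ _))) (R.+-identityˡ zeroPS))))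

  t₇ : t 7 ≃ zeroPS
  t₇ = R.trans Step₁.t₇ (R.trans (R.*-congˡ Step₂.t₅) (R.zeroʳ _))

  t₁₀ : t 10 ≃ constPS false
  t₁₀ = square-of-zero (t-double 5) Step₂.t₅

  t₁₄ : t 14 ≃ constPS false
  t₁₄ = square-of-zero (t-double 7) t₇

  t₂₀ : t 20 ≃ constPS false
  t₂₀ = double-zero 10 t₁₀

  t₂₄ : t 24 ≃ constPS false
  t₂₄ = double-zero 12 t₁₂

  module Step₃ where
    ρ : Vec PS 2
    ρ = r ∷ t 9 ∷ []

    τ : ℕ → Expr 2
    τ 18 = :y :* :y
    τ _ = :con false

    known : ∀ m → Maybe (t m ≃ ⟦ τ m ⟧ᵉ ρ)
    known 4 = just t₄
    known 5 = just (zero′ Step₂.t₅)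
    known 6 = just t₆
    known 8 = just t₈
    known 10 = just t₁₀
    known 12 = just t₁₂
    known 14 = just t₁₄
    known 16 = just t₁₆
    known 18 = just (t-double 9)
    known _ = nothing

    t₉ : t 9 ≃ zeroPS
    t₉ = square-zero (R.trans (ring ρ (:y :* :y) (:recurrence 0 _ τ known R₁₃ 4) refl)
      (R.trans (Maybe.from-just (evaluate 0 _ τ known 4 R₁₃)) (recurrence 4)))

  t₁₈ : t 18 ≃ constPS false
  t₁₈ = square-of-zero (t-double 9) Step₃.t₉

  module Step₄ where
    ρ : Vec PS 2
    ρ = r ∷ t 11 ∷ []

    τ : ℕ → Expr 2
    τ 14 = :y :* :y
    τ _ = :con false

    known : ∀ m → Maybe (t (8 + m) ≃ ⟦ τ m ⟧ᵉ ρ)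
    known 0 = just t₈
    known 1 = just (zero′ Step₃.t₉)
    known 2 = just t₁₀
    known 4 = just t₁₂
    known 6 = just t₁₄
    known 8 = just t₁₆
    known 10 = just t₁₈
    known 12 = just t₂₀
    known 14 = just (t-double 11)
    known _ = nothing

    t₁₁ : t 11 ≃ zeroPS
    t₁₁ = square-zero (R.trans (ring ρ (:y :* :y) (:recurrence 8 _ τ known R₁₃ 0) refl)
      (R.trans (Maybe.from-just (evaluate 8 _ τ known 0 R₁₃)) (recurrence 8)))

  t₂₂ : t 22 ≃ constPS false
  t₂₂ = square-of-zero (t-double 11) Step₄.t₁₁

  module Step₅ where
    ρ : Vec PS 2
    ρ = r ∷ t 13 ∷ []

    τ : ℕ → Expr 2
    τ 1 = :y
    τ 14 = :y :* :y
    τ _ = :con false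

    known : ∀ m → Maybe (t (12 + m) ≃ ⟦ τ m ⟧ᵉ ρ)
    known 0 = just t₁₂
    known 1 = just R.refl
    known 2 = just t₁₄
    known 4 = just t₁₆
    known 6 = just t₁₈
    known 8 = just t₂₀
    known 10 = just t₂₂
    known 12 = just t₂₄
    known 14 = just (t-double 13)
    known _ = nothing

    -- The instance at 12 reads (t 13 + q) t 13 = 0, and x occurs in t 13.
    t₁₃ : t 13 ≃ q
    t₁₃ = ⊞-zero⇒≃ (⊠-cancelʳ-zero 1 (t 13) t₁₃-1 (R.trans
      (ring ρ ((:y :+ :q) :* :y) (:recurrence 12 _ τ known R₁₃ 0) refl)
      (R.trans (Maybe.from-just (evaluate 12 _ τ known 0 R₁₃)) (recurrence 12))))

-- Polynomials over 𝔽₂ and windows of linear recurrences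

Poly : Set
Poly = List Bool

ev : Poly → PS → PS
ev p s = eval 1 (s ∷ []) p

infixl 6 _+ᵖ_
_+ᵖ_ : Poly → Poly → Poly
_+ᵖ_ = add 1

infixl 7 _*ᵖ_
_*ᵖ_ : Poly → Poly → Poly
_*ᵖ_ = mul 1

shift : ℕ → Poly → Poly
shift zero p = p
shift (suc j) p = false ∷ shift j p

ev-shift : ∀ j p s → ev (shift j p) s ≃ s ^ j ⊠ ev p s
ev-shift zero p s = R.sym (R.*-identityˡ _)
ev-shift (suc j) p s = R.trans (R.+-congʳ constPS-zero) (R.trans (R.+-identityˡ _)
  (R.trans (R.*-congˡ (ev-shift j p s)) (R.sym (R.*-assoc s (s ^ j) (ev p s)))))

ev-cong : ∀ p {s s′} → s ≃ s′ → ev p s ≃ ev p s′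
ev-cong [] e = R.refl
ev-cong (c ∷ p) e = R.+-congˡ (R.*-cong e (ev-cong p e))

-- Only the 40 lowest binary digits are used.
bits : ℕ → Poly
bits n = go 40 n
  where
  go : ℕ → ℕ → Poly
  go zero n = []
  go (suc k) zero = []
  go (suc k) n = (n % 2 ≡ᵇ 1) ∷ go k (n / 2)

Bounded : ℕ → Relation → Set
Bounded d = All (λ m → proj₁ m < suc d)

nth : List Poly → ℕ → Poly
nth [] i = []
nth (p ∷ w) zero = p
nth (p ∷ w) (suc i) = nth w i

-- The entry that follows the window. The relation passed here lacks its leading term, since in
-- characteristic 2 that term equals the sum of all the others.
next : Relation → List Poly → Poly
next [] w = []
next ((i , j) ∷ l) w = shift j (nth w i) +ᵖ next l w

step : Relation → List Poly → List Poly
step l [] = []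
step l (p ∷ w) = w ++ next l (p ∷ w) ∷ []

iterate : Relation → List Poly → ℕ → List Poly
iterate l w zero = w
iterate l w (suc n) = iterate l (step l w) n

nth-++-< : ∀ w (p : Poly) i → i < length w → nth (w ++ p ∷ []) i ≡ nth w i
nth-++-< (q ∷ w) p zero _ = refl
nth-++-< (q ∷ w) p (suc i) (s≤s h) = nth-++-< w p i h

nth-++-length : ∀ w (p : Poly) → nth (w ++ p ∷ []) (length w) ≡ p
nth-++-length [] p = refl
nth-++-length (q ∷ w) p = nth-++-length w p

-- A window of d consecutive polynomials, moved along a linear recurrence of order d.
module Window (_~_ : PS → Poly → Set) (s : PS)
  (~-resp : ∀ {f g p} → f ≃ g → f ~ p → g ~ p) (~-zero : zeroPS ~ [])
  (~-add : ∀ {f g p q} → f ~ p → g ~ q → (f ⊞ g) ~ (p +ᵖ q)) (~-shift : ∀ j {f p} → f ~ p → (s ^ j ⊠ f) ~ shift j p)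
  (d : ℕ) (l : Relation) (bounded : Bounded d l)
  (a : ℕ → PS) (recurrence : ∀ n → sumPS (λ (i , j) → s ^ j ⊠ a (n + i)) ((suc d , 0) ∷ l) ≃ zeroPS) where

  Tracks : ℕ → List Poly → Set
  Tracks n w = (length w ≡ suc d) × (∀ i → i < suc d → a (n + i) ~ nth w i)

  next-~ : ∀ n w l → Bounded d l → Tracks n w → sumPS (λ (i , j) → s ^ j ⊠ a (n + i)) l ~ next l w
  next-~ n w [] [] t = ~-zero
  next-~ n w ((i , j) ∷ l) (h ∷ b) t = ~-add (~-shift j (proj₂ t i h)) (next-~ n w l b t)

  step-tracks : ∀ n w → Tracks n w → Tracks (suc n) (step l w)
  step-tracks n (p ∷ w) t@(len , tr) = trans (Lₚ.length-++ w) (trans (ℕₚ.+-comm (length w) 1) len) , go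
    where
    len′ : length w ≡ d
    len′ = ℕₚ.suc-injective len
    new : a (n + suc d) ~ next l (p ∷ w)
    new = ~-resp (R.sym (⊞-zero⇒≃ (R.trans (R.+-congʳ (R.sym (R.*-identityˡ _))) (recurrence n)))) (next-~ n (p ∷ w) l bounded t)
    go : ∀ i → i < suc d → a (suc n + i) ~ nth (w ++ next l (p ∷ w) ∷ []) i
    go i (s≤s h) with ℕₚ.m≤n⇒m<n∨m≡n h
    ... | inj₁ i<d = subst₂ _~_ (cong a (ℕₚ.+-suc n i)) (sym (nth-++-< w _ i (subst (i <_) (sym len′) i<d))) (tr (suc i) (s≤s i<d))
    ... | inj₂ refl = subst₂ _~_ (cong a (ℕₚ.+-suc n i)) (sym (trans (cong (nth (w ++ next l (p ∷ w) ∷ [])) (sym len′)) (nth-++-length w _))) new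

  iterate-tracks : ∀ m n w → Tracks m w → Tracks (n + m) (iterate l w n)
  iterate-tracks m zero w t = t
  iterate-tracks m (suc n) w t = subst (λ k → Tracks k (iterate l (step l w) n)) (ℕₚ.+-suc n m) (iterate-tracks (suc m) n (step l w) (step-tracks m w t))

  tracks : ∀ w → Tracks 0 w → ∀ n → a n ~ nth (iterate l w n) 0
  tracks w t n = subst (λ f → f ~ nth (iterate l w n) 0) (cong a (trans (ℕₚ.+-identityʳ (n + 0)) (ℕₚ.+-identityʳ n)))
    (proj₂ (iterate-tracks 0 n w t) 0 (s≤s z≤n))

T-const : ∀ p → .{{_ : NonZero p}} → ∀ c f → T p (constPS c ⊠ f) ≃ constPS c ⊠ T p f
T-const p true f = R.trans (T-cong p (R.*-identityˡ f)) (R.sym (R.*-identityˡ _))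
T-const p false f = R.trans (T-zero p (R.trans (R.*-congʳ constPS-zero) (R.zeroˡ f))) (R.sym (R.trans (R.*-congʳ constPS-zero) (R.zeroˡ _)))

-- The action of T p on polynomials in r, given the images of r⁰, r¹, … as a window.
hecke : Relation → List Poly → Poly → Poly
hecke l w [] = []
hecke l w (c ∷ f) = (if c then nth w 0 else []) +ᵖ hecke l (step l w) f

module OnPolynomials (p : ℕ) .{{_ : NonZero p}} (d : ℕ) (l : Relation) (bounded : Bounded d l)
  (recurrence : ∀ n → sumPS (λ (i , j) → r ^ j ⊠ T p (r ^ (n + i))) ((suc d , 0) ∷ l) ≃ zeroPS) where

  open Window (λ f p → f ≃ ev p r) r (λ e e′ → R.trans (R.sym e) e′) R.refl
    (λ {f} {g} {p} {q} e e′ → R.trans (R.+-cong e e′) (R.sym (eval-add 1 (r ∷ []) p q)))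
    (λ j {f} {p} e → R.trans (R.*-congˡ e) (R.sym (ev-shift j p r)))
    d l bounded (λ k → T p (r ^ k)) recurrence public

  hecke-tracks : ∀ f n w → Tracks n w → T p (r ^ n ⊠ ev f r) ≃ ev (hecke l w f) r
  hecke-tracks [] n w t = T-zero p (R.zeroʳ (r ^ n))
  hecke-tracks (c ∷ f) n w t = begin
    T p (r ^ n ⊠ (constPS c ⊞ r ⊠ ev f r))
      ≈⟨ T-cong p (ring (r ^ n ∷ constPS c ∷ r ∷ ev f r ∷ []) (:x :* (:y :+ :z :* :w)) (:y :* :x :+ (:z :* :x) :* :w) refl) ⟩
    T p (constPS c ⊠ r ^ n ⊞ r ^ suc n ⊠ ev f r)
      ≈⟨ T-⊞ p _ _ ⟩
    T p (constPS c ⊠ r ^ n) ⊞ T p (r ^ suc n ⊠ ev f r)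
      ≈⟨ R.+-cong (R.trans (T-const p c (r ^ n)) (head c)) (hecke-tracks f (suc n) (step l w) (step-tracks n w t)) ⟩
    ev (if c then nth w 0 else []) r ⊞ ev (hecke l (step l w) f) r
      ≈⟨ eval-add 1 (r ∷ []) (if c then nth w 0 else []) _ ⟨
    ev ((if c then nth w 0 else []) +ᵖ hecke l (step l w) f) r ∎
    where
    open ≃-Reasoning
    head : ∀ c → constPS c ⊠ T p (r ^ n) ≃ ev (if c then nth w 0 else []) r
    head true = R.trans (R.*-identityˡ _) (R.trans (T-cong p (mk λ m → cong (λ k → (r ^ k) m) (sym (ℕₚ.+-identityʳ n)))) (proj₂ t 0 (s≤s z≤n)))
    head false = R.trans (R.*-congʳ constPS-zero) (R.zeroˡ _)

  hecke-correct : ∀ w → Tracks 0 w → ∀ f → T p (ev f r) ≃ ev (hecke l w f) r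
  hecke-correct w t f = R.trans (T-cong p (R.sym (R.*-identityˡ _))) (hecke-tracks f 0 w t)

all-bounded : ∀ d l → Maybe (Bounded d l)
all-bounded d [] = just []
all-bounded d ((i , j) ∷ l) with i ℕₚ.<? suc d
... | yes h = Maybe.map (h ∷_) (all-bounded d l)
... | no _ = nothing

l₇ l₁₃ : Relation
l₇ = drop 1 R₇
l₁₃ = drop 1 R₁₃

qᵖ : Poly
qᵖ = bits 6

-- The images of 1, r, r², ... as polynomials in r, where `bits 6` is r + r² and `bits 5` is 1 + r².
-- The nonzero ones belong to r⁵ and r⁷ for p = 7, and to r¹³ for p = 13.
w₇ w₁₃ : List Poly
w₇ = [] ∷ [] ∷ [] ∷ [] ∷ [] ∷ qᵖ ∷ [] ∷ bits 5 *ᵖ qᵖ ∷ []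
w₁₃ = [] ∷ [] ∷ [] ∷ [] ∷ [] ∷ [] ∷ [] ∷ [] ∷ [] ∷ [] ∷ [] ∷ [] ∷ [] ∷ qᵖ ∷ []

ev-of : ∀ {s} e p → isZero 1 (normalise e +ᵖ p) ≡ true → ⟦ e ⟧ᵉ (s ∷ []) ≃ ev p s
ev-of {s} e p z = R.trans (R.sym (normalise-sound (s ∷ []) e))
  (⊞-zero⇒≃ (R.trans (R.sym (eval-add 1 (s ∷ []) (normalise e) p)) (isZero-sound 1 (s ∷ []) (normalise e +ᵖ p) z)))

below : ∀ {P : ℕ → Set} d → All P (upTo d) → ∀ i → i < d → P i
below d all i h = All.lookup all (∈-upTo⁺ h)

module T₇ where
  open Level7
  open OnPolynomials 7 7 l₇ (Maybe.from-just (all-bounded 7 l₇)) recurrence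

  initial : Tracks 0 w₇
  initial = refl , below 8 (t₀ ∷ t₁ ∷ z t₂ ∷ t₃ ∷ z t₄ ∷ R.trans t₅ (ev-of :q qᵖ refl) ∷ R.trans (t-double 3) (R.trans (R.*-congˡ t₃) (R.zeroʳ _))
      ∷ R.trans t₇ (ev-of ((:1 :+ :x :* :x) :* :q) (bits 5 *ᵖ qᵖ) refl) ∷ [])
    where
    z : ∀ {f} → f ≃ constPS false → f ≃ zeroPS
    z e = R.trans e constPS-zero

  T-poly : ∀ f → T 7 (ev f r) ≃ ev (hecke l₇ w₇ f) r
  T-poly = hecke-correct w₇ initial

module T₁₃ where
  open Level13
  open OnPolynomials 13 13 l₁₃ (Maybe.from-just (all-bounded 13 l₁₃)) recurrence

  initial : Tracks 0 w₁₃
  initial = refl , below 14 (t₀ ∷ t₁ ∷ z t₂ ∷ t₃ ∷ z t₄ ∷ Step₂.t₅ ∷ z t₆ ∷ t₇ ∷ z t₈ ∷ Step₃.t₉ ∷ z t₁₀ ∷ Step₄.t₁₁ ∷ z t₁₂ ∷ R.trans Step₅.t₁₃ (ev-of :q qᵖ refl) ∷ [])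
    where
    z : ∀ {f} → f ≃ constPS false → f ≃ zeroPS
    z e = R.trans e constPS-zero

  T-poly : ∀ f → T 13 (ev f r) ≃ ev (hecke l₁₃ w₁₃ f) r
  T-poly = hecke-correct w₁₃ initial

-- The action on B yⁿ modulo N1

⟦⟧ᵉ-cong : ∀ {n} (e : Expr n) ρ ρ′ → (∀ i → lookup ρ i ≃ lookup ρ′ i) → ⟦ e ⟧ᵉ ρ ≃ ⟦ e ⟧ᵉ ρ′
⟦⟧ᵉ-cong (:var i) ρ ρ′ h = h i
⟦⟧ᵉ-cong (:con c) ρ ρ′ h = R.refl
⟦⟧ᵉ-cong (a :+ b) ρ ρ′ h = R.+-cong (⟦⟧ᵉ-cong a ρ ρ′ h) (⟦⟧ᵉ-cong b ρ ρ′ h)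
⟦⟧ᵉ-cong (a :* b) ρ ρ′ h = R.*-cong (⟦⟧ᵉ-cong a ρ ρ′ h) (⟦⟧ᵉ-cong b ρ ρ′ h)
⟦⟧ᵉ-cong (a :^ k) ρ ρ′ h = ^-cong k (⟦⟧ᵉ-cong a ρ ρ′ h)

pair-cong : ∀ {f f′ g g′} → f ≃ f′ → g ≃ g′ → ∀ i → lookup (f ∷ g ∷ []) i ≃ lookup (f′ ∷ g′ ∷ []) i
pair-cong a b zero = a
pair-cong a b (suc zero) = b

-- Modular equations for G and recurrences in y

Ψ₇ Ψ₁₃ : Relation
Ψ₇ = (8 , 0) ∷ (0 , 8) ∷ (1 , 1) ∷ (2 , 2) ∷ []
Ψ₁₃ = (14 , 0) ∷ (12 , 2) ∷ (10 , 4) ∷ (8 , 6) ∷ (6 , 8) ∷ (4 , 10) ∷ (2 , 12) ∷ (0 , 14) ∷ (1 , 1) ∷ (9 , 1) ∷ (1 , 9) ∷ []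

G-relation-7 : ⟦ :Σ Ψ₇ :x :y ⟧ᵉ (G ∷ V 7 G ∷ []) ≃ zeroPS
G-relation-7 = R.trans (ring ρ (:Σ Ψ₇ :x :y) (:x :* :y :+ ((:x :* :y) :* (:x :* :y) :+ (:x :^ 8 :+ :y :^ 8))) refl)
  (R.trans (R.+-congʳ level1-7-G) (+-self _))
  where
  ρ : Vec PS 2
  ρ = G ∷ V 7 G ∷ []

-- (u⁴ + u³ + u w)¹⁴ + w³ (w + u + 1) (1 + (u⁴ + u³ + u w)⁸), which is Ψ₁₃ for G and its 13-th conjugate
-- in terms of u = r + s and w = r s, divided by the modular equation u¹⁴ + R + R² u² with R = w (w + u + 1).
cofactor : Relation
cofactor =
  (0 , 2) ∷ (2 , 3) ∷ (2 , 4) ∷ (3 , 3) ∷ (4 , 4) ∷ (4 , 6) ∷ (6 , 4) ∷ (6 , 5) ∷ (6 , 6) ∷ (6 , 7) ∷ (6 , 8) ∷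
  (7 , 5) ∷ (7 , 7) ∷ (8 , 5) ∷ (9 , 5) ∷ (10 , 7) ∷ (10 , 8) ∷ (11 , 7) ∷ (12 , 6) ∷ (12 , 8) ∷ (12 , 10) ∷
  (14 , 1) ∷ (14 , 2) ∷ (14 , 3) ∷ (14 , 4) ∷ (14 , 5) ∷ (14 , 6) ∷ (14 , 8) ∷ (15 , 1) ∷ (15 , 3) ∷ (15 , 5) ∷
  (16 , 1) ∷ (16 , 2) ∷ (16 , 5) ∷ (16 , 6) ∷ (16 , 8) ∷ (17 , 1) ∷ (17 , 5) ∷ (18 , 1) ∷ (18 , 2) ∷ (18 , 8) ∷
  (19 , 1) ∷ (20 , 1) ∷ (20 , 2) ∷ (21 , 1) ∷ (22 , 1) ∷ (22 , 2) ∷ (22 , 3) ∷ (22 , 4) ∷ (23 , 1) ∷ (23 , 3) ∷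
  (24 , 1) ∷ (25 , 1) ∷ (26 , 1) ∷ (26 , 2) ∷ (27 , 1) ∷ (28 , 0) ∷ (28 , 1) ∷ (29 , 1) ∷ (30 , 0) ∷ (32 , 0) ∷
  (34 , 0) ∷ (36 , 0) ∷ (36 , 2) ∷ (38 , 0) ∷ (40 , 0) ∷ (42 , 0) ∷ []

G-relation-13 : ⟦ :Σ Ψ₁₃ :x :y ⟧ᵉ (G ∷ V 13 G ∷ []) ≃ zeroPS
G-relation-13 = begin
  ⟦ :Σ Ψ₁₃ :x :y ⟧ᵉ (G ∷ V 13 G ∷ [])
    ≈⟨ ring (G ∷ V 13 G ∷ []) (:Σ Ψ₁₃ :x :y) (:ψ (:x :+ :y) (:x :* :y)) refl ⟩
  ⟦ :ψ :x :y ⟧ᵉ (G ⊞ V 13 G ∷ G ⊠ V 13 G ∷ [])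
    ≈⟨ ⟦⟧ᵉ-cong (:ψ :x :y) (G ⊞ V 13 G ∷ G ⊠ V 13 G ∷ []) (⟦ :e ⟧ᵉ (u ∷ w ∷ []) ∷ ⟦ :p ⟧ᵉ (u ∷ w ∷ []) ∷ []) (pair-cong sum product) ⟩
  ⟦ :ψ :e :p ⟧ᵉ (u ∷ w ∷ [])
    ≈⟨ ring (u ∷ w ∷ []) (:ψ :e :p) (:φ :* :Σ cofactor :x :y) refl ⟩
  ⟦ :φ ⟧ᵉ (u ∷ w ∷ []) ⊠ ⟦ :Σ cofactor :x :y ⟧ᵉ (u ∷ w ∷ [])
    ≈⟨ R.*-congʳ (R.trans (ring ρ ((:x :+ :y) :^ 14 :+ (:R′ :+ :R′ :^ 2 :* (:x :+ :y) :^ 2)) (Φ₁₃ :x :y) refl) modular-13) ⟩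
  zeroPS ⊠ ⟦ :Σ cofactor :x :y ⟧ᵉ (u ∷ w ∷ [])
    ≈⟨ R.zeroˡ _ ⟩
  zeroPS ∎
  where
  open ≃-Reasoning
  ρ : Vec PS 2
  ρ = r ∷ V 13 r ∷ []
  u = r ⊞ V 13 r
  w = r ⊠ V 13 r
  :ψ : ∀ {n} → Expr n → Expr n → Expr n
  :ψ a b = a :^ 14 :+ b :* (:1 :+ a :^ 8)
  :e :p :r′ :φ :R′ : Expr 2
  :e = :x :^ 4 :+ (:x :^ 3 :+ :x :* :y)
  :p = :y :^ 3 :* (:y :+ :x :+ :1)
  :r′ = :y :* (:y :+ :x :+ :1)
  :φ = :x :^ 14 :+ (:r′ :+ :r′ :^ 2 :* :x :^ 2)
  :R′ = (:x :* :y) :* ((:x :* :y) :+ (:x :+ :y) :+ :1)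
  sum : G ⊞ V 13 G ≃ ⟦ :e ⟧ᵉ (u ∷ w ∷ [])
  sum = R.trans (R.+-cong G-def (V-G 13)) (ring ρ (:G :x :+ :G :y) ((:x :+ :y) :^ 4 :+ ((:x :+ :y) :^ 3 :+ (:x :+ :y) :* (:x :* :y))) refl)
  product : G ⊠ V 13 G ≃ ⟦ :p ⟧ᵉ (u ∷ w ∷ [])
  product = R.trans (R.*-cong G-def (V-G 13)) (ring ρ (:G :x :* :G :y) ((:x :* :y) :^ 3 :* ((:x :* :y) :+ (:x :+ :y) :+ :1)) refl)

y : PS
y = G ⊠ G

module _ (p : ℕ) .{{_ : NonZero p}} (Ψ : Relation) (relation : ⟦ :Σ Ψ :x :y ⟧ᵉ (G ∷ V p G ∷ []) ≃ zeroPS)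
  (frobenius-xy : isZero 2 (normalise (:Σ Ψ (:x :* :x) (:y :* :y) :+ :Σ Ψ :x :y :* :Σ Ψ :x :y)) ≡ true)
  (frobenius-yx : isZero 2 (normalise (:Σ Ψ (:y :* :y) (:x :* :x) :+ :Σ Ψ :x :y :* :Σ Ψ :x :y)) ≡ true) where

  private
    ρ : Vec PS 2
    ρ = G ∷ V p G ∷ []
    squared : ⟦ :Σ Ψ :x :y :* :Σ Ψ :x :y ⟧ᵉ ρ ≃ zeroPS
    squared = R.trans (R.*-congˡ relation) (R.zeroʳ _)
    env : ∀ i → lookup (y ∷ V p y ∷ []) i ≃ lookup (⟦ :x :* :x ⟧ᵉ ρ ∷ ⟦ :y :* :y ⟧ᵉ ρ ∷ []) i
    env = pair-cong R.refl (V-⊠ p G G)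
    substitute : ∀ l (a b : Expr 2) → ⟦ :Σ l a b ⟧ᵉ (⟦ :x :* :x ⟧ᵉ ρ ∷ ⟦ :y :* :y ⟧ᵉ ρ ∷ []) ≃
      sumPS (λ (i , j) → ⟦ a ⟧ᵉ (⟦ :x :* :x ⟧ᵉ ρ ∷ ⟦ :y :* :y ⟧ᵉ ρ ∷ []) ^ i ⊠ ⟦ b ⟧ᵉ (⟦ :x :* :x ⟧ᵉ ρ ∷ ⟦ :y :* :y ⟧ᵉ ρ ∷ []) ^ j) l
    substitute l a b = :Σ-correct l a b _

  -- The coefficients lie in 𝔽₂, so the square of the relation for G is the same relation for y. The
  -- two Frobenius hypotheses check this for both orders of the variables, and thereby also the
  -- symmetry of the relation.
  y-recurrence : ∀ f → sumPS (λ (i , j) → y ^ j ⊠ T p (f ⊠ y ^ i)) Ψ ≃ zeroPS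
  y-recurrence = T-recurrence p y Ψ
    (R.trans (⟦⟧ᵉ-cong (:Σ Ψ :x :y) (y ∷ V p y ∷ []) (⟦ :x :* :x ⟧ᵉ ρ ∷ ⟦ :y :* :y ⟧ᵉ ρ ∷ []) env) (R.trans (substitute Ψ :x :y) (R.trans (R.sym (:Σ-correct Ψ (:x :* :x) (:y :* :y) ρ))
      (R.trans (ring ρ (:Σ Ψ (:x :* :x) (:y :* :y)) (:Σ Ψ :x :y :* :Σ Ψ :x :y) frobenius-xy) squared))))
    (R.trans (⟦⟧ᵉ-cong (:Σ Ψ :y :x) (y ∷ V p y ∷ []) (⟦ :x :* :x ⟧ᵉ ρ ∷ ⟦ :y :* :y ⟧ᵉ ρ ∷ []) env) (R.trans (substitute Ψ :y :x) (R.trans (R.sym (:Σ-correct Ψ (:y :* :y) (:x :* :x) ρ))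
      (R.trans (ring ρ (:Σ Ψ (:y :* :y) (:x :* :x)) (:Σ Ψ :x :y :* :Σ Ψ :x :y) frobenius-yx) squared))))

compose : Poly → Poly → Poly
compose [] g = []
compose (c ∷ f) g = (c ∷ []) +ᵖ g *ᵖ compose f g

ev-compose : ∀ f g s → ev (compose f g) s ≃ ev f (ev g s)
ev-compose [] g s = R.refl
ev-compose (c ∷ f) g s = R.trans (eval-add 1 (s ∷ []) (c ∷ []) (g *ᵖ compose f g)) (R.+-cong (R.trans (R.+-congˡ (R.zeroʳ s)) (R.+-identityʳ _))
  (R.trans (eval-mul 1 (s ∷ []) g (compose f g)) (R.*-congˡ (ev-compose f g s))))

Fᵖ Gᵖ yᵖ : Poly
Fᵖ = normalise (:F :x)
Gᵖ = normalise (:G :x)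
yᵖ = Gᵖ *ᵖ Gᵖ

ev-F : F ≃ ev Fᵖ r
ev-F = R.trans F-def (R.sym (normalise-sound (r ∷ []) (:F :x)))

ev-G : G ≃ ev Gᵖ r
ev-G = R.trans G-def (R.sym (normalise-sound (r ∷ []) (:G :x)))

ev-y : y ≃ ev yᵖ r
ev-y = R.trans (R.*-cong ev-G ev-G) (R.sym (eval-mul 1 (r ∷ []) Gᵖ Gᵖ))

-- Representation by p modulo N1 = G·𝔽₂[y] in the module with basis B, G over 𝔽₂[y].
record Rep (B f : PS) (p : Poly) : Set where
  constructor rep
  field
    ν : Poly
    equation : f ≃ B ⊠ ev p y ⊞ G ⊠ ev ν y

Rep-resp : ∀ {B f g p} → f ≃ g → Rep B f p → Rep B g p
Rep-resp e (rep ν e′) = rep ν (R.trans (R.sym e) e′)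

Rep-zero : ∀ {B} → Rep B zeroPS []
Rep-zero {B} = rep [] (R.sym (R.trans (R.+-cong (R.zeroʳ B) (R.zeroʳ G)) (R.+-identityˡ zeroPS)))

Rep-⊞ : ∀ {B f g p p′} → Rep B f p → Rep B g p′ → Rep B (f ⊞ g) (p +ᵖ p′)
Rep-⊞ {B} {f} {g} {p} {p′} (rep ν e) (rep ν′ e′) = rep (ν +ᵖ ν′) (R.trans (R.+-cong e e′)
  (R.trans (ring (B ∷ ev p y ∷ ev p′ y ∷ G ∷ ev ν y ∷ ev ν′ y ∷ [])
    ((:x :* :y :+ :w :* :a) :+ (:x :* :z :+ :w :* :b)) (:x :* (:y :+ :z) :+ :w :* (:a :+ :b)) refl)
    (R.sym (R.+-cong (R.*-congˡ (eval-add 1 (y ∷ []) p p′)) (R.*-congˡ (eval-add 1 (y ∷ []) ν ν′))))))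

Rep-shift : ∀ {B} j {f p} → Rep B f p → Rep B (y ^ j ⊠ f) (shift j p)
Rep-shift {B} j {f} {p} (rep ν e) = rep (shift j ν) (R.trans (R.*-congˡ e)
  (R.trans (ring (y ^ j ∷ B ∷ ev p y ∷ G ∷ ev ν y ∷ []) (:x :* (:y :* :z :+ :w :* :a)) (:y :* (:x :* :z) :+ :w :* (:x :* :a)) refl)
    (R.sym (R.+-cong (R.*-congˡ (ev-shift j p y)) (R.*-congˡ (ev-shift j ν y))))))

module Action (p : ℕ) .{{_ : NonZero p}} (d : ℕ) (l : Relation) (bounded : Bounded d l)
  (y-rec : ∀ f → sumPS (λ (i , j) → y ^ j ⊠ T p (f ⊠ y ^ i)) ((suc d , 0) ∷ l) ≃ zeroPS)
  (H : Poly → Poly) (T-poly : ∀ f → T p (ev f r) ≃ ev (H f) r)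
  (B : PS) (Bᵖ : Poly) (ev-B : B ≃ ev Bᵖ r) where

  open Window (Rep B) y Rep-resp Rep-zero Rep-⊞ Rep-shift
    d l bounded (λ n → T p (B ⊠ y ^ n))
    (λ n → R.trans (sumPS-cong (λ (i , j) → R.*-congˡ (T-cong p (R.trans (R.*-congˡ (^-homo-* y n i)) (R.sym (R.*-assoc B (y ^ n) (y ^ i)))))) ((suc d , 0) ∷ l))
      (y-rec (B ⊠ y ^ n)))
    public

  -- With everything rewritten in r, its vanishing certifies that `o` represents the image of B yⁿ,
  -- with `ν` as the component in N1. Such certificates are needed for the first window only; the
  -- recurrence does the rest.
  residue : ℕ → Poly → Poly → Poly
  residue n o ν = H (Bᵖ *ᵖ pow 1 yᵖ n) +ᵖ (Bᵖ *ᵖ compose o yᵖ +ᵖ Gᵖ *ᵖ compose ν yᵖ)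

  Rep-initial : ∀ n o ν → isZero 1 (residue n o ν) ≡ true → Rep B (T p (B ⊠ y ^ n)) o
  Rep-initial n o ν z = rep ν (begin
    T p (B ⊠ y ^ n) ≈⟨ T-cong p (R.trans (R.*-cong ev-B (R.trans (^-cong n ev-y) (R.sym (eval-pow 1 (r ∷ []) yᵖ n))))
                        (R.sym (eval-mul 1 (r ∷ []) Bᵖ (pow 1 yᵖ n)))) ⟩
    T p (ev (Bᵖ *ᵖ pow 1 yᵖ n) r) ≈⟨ T-poly (Bᵖ *ᵖ pow 1 yᵖ n) ⟩
    ev (H (Bᵖ *ᵖ pow 1 yᵖ n)) r
      ≈⟨ ⊞-zero⇒≃ (R.trans (R.sym (eval-add 1 (r ∷ []) (H (Bᵖ *ᵖ pow 1 yᵖ n)) (Bᵖ *ᵖ compose o yᵖ +ᵖ Gᵖ *ᵖ compose ν yᵖ))) (isZero-sound 1 (r ∷ []) (residue n o ν) z)) ⟩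
    ev (Bᵖ *ᵖ compose o yᵖ +ᵖ Gᵖ *ᵖ compose ν yᵖ) r
      ≈⟨ R.trans (eval-add 1 (r ∷ []) (Bᵖ *ᵖ compose o yᵖ) (Gᵖ *ᵖ compose ν yᵖ)) (R.+-cong
           (R.trans (eval-mul 1 (r ∷ []) Bᵖ (compose o yᵖ)) (R.*-cong (R.sym ev-B) (R.trans (ev-compose o yᵖ r) (ev-cong o (R.sym ev-y)))))
           (R.trans (eval-mul 1 (r ∷ []) Gᵖ (compose ν yᵖ)) (R.*-cong (R.sym ev-G) (R.trans (ev-compose ν yᵖ r) (ev-cong ν (R.sym ev-y)))))) ⟩
    B ⊠ ev o y ⊞ G ⊠ ev ν y ∎)
    where open ≃-Reasoning

  residues : ℕ → List Poly → List Poly → Bool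
  residues n (o ∷ os) (ν ∷ νs) = isZero 1 (residue n o ν) ∧ residues (suc n) os νs
  residues n _ _ = true

  initial : ∀ n os νs → length os ≡ length νs → residues n os νs ≡ true → ∀ i → i < length os → Rep B (T p (B ⊠ y ^ (n + i))) (nth os i)
  initial n (o ∷ os) (ν ∷ νs) len z i h with isZero 1 (residue n o ν) in zn
  initial n (o ∷ os) (ν ∷ νs) len z zero h | true = subst (λ k → Rep B (T p (B ⊠ y ^ k)) o) (sym (ℕₚ.+-identityʳ n)) (Rep-initial n o ν zn)
  initial n (o ∷ os) (ν ∷ νs) len z (suc i) (s≤s h) | true = subst (λ k → Rep B (T p (B ⊠ y ^ k)) (nth os i)) (sym (ℕₚ.+-suc n i))
    (initial (suc n) os νs (ℕₚ.suc-injective len) z i h)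

  action : ∀ os νs → length os ≡ suc d → length os ≡ length νs → residues 0 os νs ≡ true →
           ∀ n → Rep B (T p (B ⊠ y ^ n)) (nth (iterate l os n) 0)
  action os νs len len′ z = tracks os (len , λ i h → initial 0 os νs len′ z i (subst (i <_) (sym len) h))

m₇ m₁₃ : Relation
m₇ = drop 1 Ψ₇
m₁₃ = drop 1 Ψ₁₃

B₅ : PS
B₅ = F ⊠ F ⊠ G

B₅ᵖ : Poly
B₅ᵖ = Fᵖ *ᵖ Fᵖ *ᵖ Gᵖ

ev-B₅ : B₅ ≃ ev B₅ᵖ r
ev-B₅ = R.trans (R.*-cong (R.trans (R.*-cong ev-F ev-F) (R.sym (eval-mul 1 (r ∷ []) Fᵖ Fᵖ))) ev-G) (R.sym (eval-mul 1 (r ∷ []) (Fᵖ *ᵖ Fᵖ) Gᵖ))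

y-rec-7 : ∀ f → sumPS (λ (i , j) → y ^ j ⊠ T 7 (f ⊠ y ^ i)) Ψ₇ ≃ zeroPS
y-rec-7 = y-recurrence 7 Ψ₇ G-relation-7 refl refl

y-rec-13 : ∀ f → sumPS (λ (i , j) → y ^ j ⊠ T 13 (f ⊠ y ^ i)) Ψ₁₃ ≃ zeroPS
y-rec-13 = y-recurrence 13 Ψ₁₃ G-relation-13 refl refl

module A₁-7 = Action 7 7 m₇ (Maybe.from-just (all-bounded 7 m₇)) y-rec-7 (hecke l₇ w₇) T₇.T-poly F Fᵖ ev-F
module A₁-13 = Action 13 13 m₁₃ (Maybe.from-just (all-bounded 13 m₁₃)) y-rec-13 (hecke l₁₃ w₁₃) T₁₃.T-poly F Fᵖ ev-F
module A₅-7 = Action 7 7 m₇ (Maybe.from-just (all-bounded 7 m₇)) y-rec-7 (hecke l₇ w₇) T₇.T-poly B₅ B₅ᵖ ev-B₅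
module A₅-13 = Action 13 13 m₁₃ (Maybe.from-just (all-bounded 13 m₁₃)) y-rec-13 (hecke l₁₃ w₁₃) T₁₃.T-poly B₅ B₅ᵖ ev-B₅

-- Entry n encodes in binary the polynomial o(y) with T p (B yⁿ) = B o(y) modulo N1; for instance 16
-- stands for y⁴. The components in N1 are the second tables given to `action` below.
init₁-7 init₁-13 init₅-7 init₅-13 : List Poly
init₁-7 = map bits (0 ∷ 1 ∷ 0 ∷ 4 ∷ 2 ∷ 16 ∷ 8 ∷ 64 ∷ [])
init₁-13 = map bits (0 ∷ 0 ∷ 1 ∷ 2 ∷ 0 ∷ 0 ∷ 16 ∷ 32 ∷ 4 ∷ 8 ∷ 272 ∷ 546 ∷ 64 ∷ 136 ∷ [])
init₅-7 = map bits (0 ∷ 1 ∷ 0 ∷ 4 ∷ 2 ∷ 17 ∷ 8 ∷ 68 ∷ [])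
init₅-13 = map bits (0 ∷ 0 ∷ 1 ∷ 2 ∷ 0 ∷ 0 ∷ 17 ∷ 34 ∷ 4 ∷ 8 ∷ 273 ∷ 546 ∷ 68 ∷ 128 ∷ [])

action₁-7 : ∀ n → Rep F (T 7 (F ⊠ y ^ n)) (nth (iterate m₇ init₁-7 n) 0)
action₁-7 = A₁-7.action init₁-7 (map bits (0 ∷ 0 ∷ 1 ∷ 0 ∷ 0 ∷ 0 ∷ 16 ∷ 8 ∷ [])) refl refl refl

action₁-13 : ∀ n → Rep F (T 13 (F ⊠ y ^ n)) (nth (iterate m₁₃ init₁-13 n) 0)
action₁-13 = A₁-13.action init₁-13 (map bits (0 ∷ 0 ∷ 0 ∷ 0 ∷ 0 ∷ 1 ∷ 2 ∷ 0 ∷ 0 ∷ 0 ∷ 0 ∷ 0 ∷ 8 ∷ 272 ∷ [])) refl refl refl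

action₅-7 : ∀ n → Rep B₅ (T 7 (B₅ ⊠ y ^ n)) (nth (iterate m₇ init₅-7 n) 0)
action₅-7 = A₅-7.action init₅-7 (map bits (1 ∷ 0 ∷ 4 ∷ 2 ∷ 16 ∷ 8 ∷ 64 ∷ 2 ∷ [])) refl refl refl

action₅-13 : ∀ n → Rep B₅ (T 13 (B₅ ⊠ y ^ n)) (nth (iterate m₁₃ init₅-13 n) 0)
action₅-13 = A₅-13.action init₅-13 (map bits (0 ∷ 0 ∷ 0 ∷ 1 ∷ 2 ∷ 4 ∷ 8 ∷ 0 ∷ 0 ∷ 4 ∷ 8 ∷ 256 ∷ 514 ∷ 1088 ∷ [])) refl refl refl

-- Nicolas–Serre codes

dbl : ℕ → ℕ
dbl zero = zero
dbl (suc n) = suc (suc (dbl n))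

digit : Bool → ℕ → ℕ
digit false m = dbl m
digit true m = suc (dbl m)

b→ℕ : Bool → ℕ
b→ℕ false = 0
b→ℕ true = 1

half : ℕ → ℕ
half 0 = 0
half 1 = 0
half (suc (suc n)) = suc (half n)

bit : ℕ → Bool
bit 0 = false
bit 1 = true
bit (suc (suc n)) = bit n

digit-half : ∀ n → digit (bit n) (half n) ≡ n
digit-half 0 = refl
digit-half 1 = refl
digit-half (suc (suc n)) = trans (digit-suc (bit n) (half n)) (cong (λ k → 2 + k) (digit-half n))
  where
  digit-suc : ∀ i m → digit i (suc m) ≡ suc (suc (digit i m))
  digit-suc false m = refl
  digit-suc true m = refl

half-dbl : ∀ m → half (dbl m) ≡ m
half-dbl zero = refl
half-dbl (suc m) = cong suc (half-dbl m)

half-digit : ∀ i m → half (digit i m) ≡ m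
half-digit false m = half-dbl m
half-digit true zero = refl
half-digit true (suc m) = cong suc (half-digit true m)

bit-digit : ∀ i m → bit (digit i m) ≡ i
bit-digit false zero = refl
bit-digit false (suc m) = bit-digit false m
bit-digit true zero = refl
bit-digit true (suc m) = bit-digit true m

half-≤ : ∀ n → half n ≤ n
half-≤ 0 = z≤n
half-≤ 1 = z≤n
half-≤ (suc (suc n)) = s≤s (ℕₚ.≤-trans (half-≤ n) (ℕₚ.n≤1+n n))

half-< : ∀ n → half (suc n) ≤ n
half-< zero = z≤n
half-< (suc n) = s≤s (half-≤ n)

-- The Nicolas–Serre code (a , b) of n: the binary digits of n at even places are those of a, those at odd places those of b.
codeF : ℕ → ℕ → ℕ × ℕ
codeF zero n = 0 , 0
codeF (suc f) n = digit (bit n) (proj₂ (codeF f (half n))) , proj₁ (codeF f (half n))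

code : ℕ → ℕ × ℕ
code n = codeF n n

codeF-0 : ∀ f → codeF f 0 ≡ (0 , 0)
codeF-0 zero = refl
codeF-0 (suc f) rewrite codeF-0 f = refl

codeF-stable : ∀ f f′ n → n ≤ f → n ≤ f′ → codeF f n ≡ codeF f′ n
codeF-stable f f′ zero _ _ = trans (codeF-0 f) (sym (codeF-0 f′))
codeF-stable (suc f) (suc f′) (suc n) (s≤s h) (s≤s h′)
  rewrite codeF-stable f f′ (half (suc n)) (ℕₚ.≤-trans (half-< n) h) (ℕₚ.≤-trans (half-< n) h′) = refl

code-half : ∀ n → code n ≡ (digit (bit n) (proj₂ (code (half n))) , proj₁ (code (half n)))
code-half zero = refl
code-half (suc n) rewrite codeF-stable n (half (suc n)) (half (suc n)) (half-< n) ℕₚ.≤-refl = refl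

code-digit : ∀ i m → code (digit i m) ≡ (digit i (proj₂ (code m)) , proj₁ (code m))
code-digit i m = trans (code-half (digit i m)) (cong₂ (λ j k → digit j (proj₂ (code k)) , proj₁ (code k)) (bit-digit i m) (half-digit i m))

code-injective : ∀ n n′ → code n ≡ code n′ → n ≡ n′
code-injective n n′ = go n n′ n ℕₚ.≤-refl
  where
  digits : ∀ n n′ → code n ≡ code n′ → bit n ≡ bit n′ × code (half n) ≡ code (half n′)
  digits n n′ e = trans (sym (bit-digit (bit n) _)) (trans (cong bit e₁) (bit-digit (bit n′) _)) ,
      cong₂ _,_ (cong proj₂ e′) (trans (sym (half-digit (bit n) _)) (trans (cong half e₁) (half-digit (bit n′) _)))
    where
    e′ = trans (sym (code-half n)) (trans e (code-half n′))
    e₁ = cong proj₁ e′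
  zero-code : ∀ f n → n ≤ f → code 0 ≡ code n → 0 ≡ n
  zero-code f zero h e = refl
  zero-code (suc f) (suc n) (s≤s h) e with digits 0 (suc n) e
  ... | b , c = trans (cong₂ digit b (zero-code f (half (suc n)) (ℕₚ.≤-trans (half-< n) h) c)) (digit-half (suc n))
  go : ∀ n n′ f → n ≤ f → code n ≡ code n′ → n ≡ n′
  go zero n′ f h e = zero-code n′ n′ ℕₚ.≤-refl e
  go (suc n) n′ (suc f) (s≤s h) e with digits (suc n) n′ e
  ... | b , c = trans (sym (digit-half (suc n))) (trans (cong₂ digit b (go (half (suc n)) (half n′) f (ℕₚ.≤-trans (half-< n) h) c)) (digit-half n′))

idxF : ℕ → ℕ → ℕ → ℕ
idxF zero a b = 0
idxF (suc f) a b = digit (bit a) (idxF f b (half a))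

idx : ℕ × ℕ → ℕ
idx (a , b) = idxF (2 * a + 3 * b) a b

-- The recursion passes from (a , b) to (b , half of a), which strictly decreases 2 a + 3 b away
-- from the origin; this is the fuel that `idx` supplies.
code-idxF : ∀ f a b → 2 * a + 3 * b ≤ f → code (idxF f a b) ≡ (a , b)
code-idxF zero zero zero h = refl
code-idxF (suc f) a b h = trans (code-digit (bit a) (idxF f b (half a)))
  (cong₂ _,_ (trans (cong (digit (bit a)) (cong proj₂ ih)) (digit-half a)) (cong proj₁ ih))
  where
  smaller : ∀ a b → 2 * a + 3 * b ≤ suc f → 2 * b + 3 * half a ≤ f
  smaller zero zero h = z≤n
  smaller zero (suc b) h = ℕₚ.≤-pred (ℕₚ.≤-trans (subst₂ _≤_ (e₁ b) (e₂ b) (ℕₚ.m≤m+n (3 + 2 * b) b)) h)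
    where
    e₁ : ∀ b → 3 + 2 * b ≡ suc (2 * suc b + 3 * 0)
    e₁ = ℕ-Solver.solve-∀
    e₂ : ∀ b → 3 + 2 * b + b ≡ 2 * 0 + 3 * suc b
    e₂ = ℕ-Solver.solve-∀
  smaller (suc a) b h = ℕₚ.≤-pred (ℕₚ.≤-trans (s≤s (ℕₚ.+-monoʳ-≤ (2 * b) (3half a)))
      (ℕₚ.≤-trans (subst₂ _≤_ (e₁ a b) (e₂ a b) (ℕₚ.m≤m+n (2 + 2 * b + 2 * a) b)) h))
    where
    3half : ∀ a → 3 * half (suc a) ≤ suc (2 * a)
    3half 0 = z≤n
    3half 1 = ℕₚ.≤-refl
    3half (suc (suc a)) rewrite ℕₚ.*-suc 3 (half (suc a)) | ℕₚ.*-suc 2 (suc a) | ℕₚ.*-suc 2 a =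
      ℕₚ.≤-trans (ℕₚ.+-monoʳ-≤ 3 (3half a)) (ℕₚ.n≤1+n _)
    e₁ : ∀ a b → 2 + 2 * b + 2 * a ≡ suc (2 * b + suc (2 * a))
    e₁ = ℕ-Solver.solve-∀
    e₂ : ∀ a b → 2 + 2 * b + 2 * a + b ≡ 2 * suc a + 3 * b
    e₂ = ℕ-Solver.solve-∀
  ih : code (idxF f b (half a)) ≡ (b , half a)
  ih = code-idxF f b (half a) (smaller a b h)

code-idx : ∀ v → code (idx v) ≡ v
code-idx (a , b) = code-idxF (2 * a + 3 * b) a b ℕₚ.≤-refl

idx-code : ∀ n → idx (code n) ≡ n
idx-code n = code-injective (idx (code n)) n (code-idx (code n))

-- Removing the last binary digit of n exchanges the coordinates of the code and so carries the
-- first degree to the second, and the second to twice the first, up to the contribution of the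
-- digit. The pair is closed under taking sections.
deg₀ deg₁ : ℕ × ℕ → ℕ
deg₀ (a , b) = 2 * a + 3 * b
deg₁ (a , b) = 3 * a + 4 * b

dbl≡2* : ∀ m → dbl m ≡ 2 * m
dbl≡2* zero = refl
dbl≡2* (suc m) = trans (cong (λ k → 2 + k) (dbl≡2* m)) (sym (ℕₚ.*-suc 2 m))

digit≡ : ∀ i m → digit i m ≡ b→ℕ i + 2 * m
digit≡ false m = dbl≡2* m
digit≡ true m = cong suc (dbl≡2* m)

deg₀-digit : ∀ i m → deg₀ (code (digit i m)) ≡ 2 * b→ℕ i + deg₁ (code m)
deg₀-digit i m = trans (cong deg₀ (code-digit i m)) (trans (cong (λ x → 2 * x + 3 * proj₁ (code m)) (digit≡ i _)) (lemma (b→ℕ i) (proj₁ (code m)) (proj₂ (code m))))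
  where
  lemma : ∀ i a b → 2 * (i + 2 * b) + 3 * a ≡ 2 * i + (3 * a + 4 * b)
  lemma = ℕ-Solver.solve-∀

deg₁-digit : ∀ i m → deg₁ (code (digit i m)) ≡ 3 * b→ℕ i + 2 * deg₀ (code m)
deg₁-digit i m = trans (cong deg₁ (code-digit i m)) (trans (cong (λ x → 3 * x + 4 * proj₁ (code m)) (digit≡ i _)) (lemma (b→ℕ i) (proj₁ (code m)) (proj₂ (code m))))
  where
  lemma : ∀ i a b → 3 * (i + 2 * b) + 4 * a ≡ 3 * i + 2 * (2 * a + 3 * b)
  lemma = ℕ-Solver.solve-∀

-- Matrix entries (n′ , n) of the operators lowering a, lowering b, and of the identity.
symA symB symI : ℕ × ℕ → ℕ × ℕ → Bool
symA (a , b) (a′ , b′) = (a ≡ᵇ suc a′) ∧ (b ≡ᵇ b′)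
symB (a , b) (a′ , b′) = (a ≡ᵇ a′) ∧ (b ≡ᵇ suc b′)
symI (a , b) (a′ , b′) = (a ≡ᵇ a′) ∧ (b ≡ᵇ b′)

dbl-≡ᵇ : ∀ m n → (dbl m ≡ᵇ dbl n) ≡ (m ≡ᵇ n)
dbl-≡ᵇ zero zero = refl
dbl-≡ᵇ zero (suc n) = refl
dbl-≡ᵇ (suc m) zero = refl
dbl-≡ᵇ (suc m) (suc n) = dbl-≡ᵇ m n

dbl-≢ᵇ : ∀ m n → (dbl m ≡ᵇ suc (dbl n)) ≡ false
dbl-≢ᵇ zero n = refl
dbl-≢ᵇ (suc m) zero = refl
dbl-≢ᵇ (suc m) (suc n) = dbl-≢ᵇ m n

dbl-≢ᵇ′ : ∀ m n → (suc (dbl m) ≡ᵇ dbl n) ≡ false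
dbl-≢ᵇ′ m zero = refl
dbl-≢ᵇ′ zero (suc n) = refl
dbl-≢ᵇ′ (suc m) (suc n) = dbl-≢ᵇ′ m n

Symbol : Set
Symbol = Bool × Bool × Bool

symbol : Symbol → ℕ × ℕ → ℕ × ℕ → Bool
symbol (x , y , z) v v′ = (x ∧ symA v v′) xor ((y ∧ symB v v′) xor (z ∧ symI v v′))

-- The first coordinate of the code of `digit i m` is `digit i b`, the second is a, where (a , b) is
-- the code of m. Lowering the second lowers a and keeps the parity. Lowering the first takes odd to
-- even and leaves m alone, or takes even to odd with a borrow that lowers b.
section : Symbol → Bool → Bool → Symbol
section (x , y , z) false false = y , false , z
section (x , y , z) true true = y , false , z
section (x , y , z) true false = false , false , x
section (x , y , z) false true = false , x , false

swap-digit : Bool → ℕ × ℕ → ℕ × ℕ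
swap-digit i (a , b) = digit i b , a

symbol-section : ∀ ε i j v v′ → symbol ε (swap-digit i v) (swap-digit j v′) ≡ symbol (section ε i j) v v′
symbol-section (x , y , z) false false (a , b) (a′ , b′)
  rewrite dbl-≢ᵇ b b′ | dbl-≡ᵇ b b′ | ∧-zeroʳ x | ∧-comm (b ≡ᵇ b′) (a ≡ᵇ suc a′) | ∧-comm (b ≡ᵇ b′) (a ≡ᵇ a′) = refl
symbol-section (x , y , z) true true (a , b) (a′ , b′)
  rewrite dbl-≢ᵇ b b′ | dbl-≡ᵇ b b′ | ∧-zeroʳ x | ∧-comm (b ≡ᵇ b′) (a ≡ᵇ suc a′) | ∧-comm (b ≡ᵇ b′) (a ≡ᵇ a′) = refl
symbol-section (x , y , z) true false (a , b) (a′ , b′)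
  rewrite dbl-≢ᵇ′ b b′ | dbl-≡ᵇ b b′ | ∧-zeroʳ y | ∧-zeroʳ z | ∧-comm (b ≡ᵇ b′) (a ≡ᵇ a′) = xor-identityʳ _
symbol-section (x , y , z) false true (a , b) (a′ , b′)
  rewrite dbl-≢ᵇ b b′ | dbl-≡ᵇ b (suc b′) | ∧-zeroʳ y | ∧-zeroʳ z | ∧-comm (b ≡ᵇ suc b′) (a ≡ᵇ a′) = refl

-- Sections of linear recurrences

co : Poly → PS
co [] n = false
co (c ∷ p) zero = c
co (c ∷ p) (suc n) = co p n

co-add : ∀ p q → co (p +ᵖ q) ≃ co p ⊞ co q
co-add p q = mk λ n → trans (go p q n) (sym (⊞-at (co p) (co q) n))
  where
  go : ∀ p q n → co (p +ᵖ q) n ≡ co p n xor co q n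
  go [] q n = refl
  go (a ∷ p) [] n = sym (xor-identityʳ _)
  go (a ∷ p) (b ∷ q) zero = refl
  go (a ∷ p) (b ∷ q) (suc n) = go p q n

co-shift : ∀ j p → co (shift j p) ≃ shN j (co p)
co-shift zero p = R.refl
co-shift (suc j) p = mk λ { zero → refl ; (suc n) → at (co-shift j p) n }

co-isZero : ∀ p → isZero 1 p ≡ true → co p ≃ zeroPS
co-isZero p z = mk (go p z)
  where
  go : ∀ p → isZero 1 p ≡ true → ∀ n → co p n ≡ false
  go [] z n = refl
  go (false ∷ p) z zero = refl
  go (false ∷ p) z (suc n) = go p z n

shN-zero : ∀ j → shN j zeroPS ≃ zeroPS
shN-zero zero = R.refl
shN-zero (suc j) = R.trans (sh-cong (shN-zero j)) sh-zero

shN-sumPS : ∀ {A : Set} j (h : A → PS) l → shN j (sumPS h l) ≃ sumPS (shN j ∘ h) l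
shN-sumPS j h [] = shN-zero j
shN-sumPS j h (a ∷ l) = R.trans (shN-⊞ j (h a) (sumPS h l)) (R.+-congˡ (shN-sumPS j h l))

shN-shN : ∀ j k f → shN j (shN k f) ≃ shN (j + k) f
shN-shN zero k f = R.refl
shN-shN (suc j) k f = sh-cong (shN-shN j k f)

sumPS-congᴬ : ∀ {A : Set} {h h′ : A → PS} {l} → All (λ a → h a ≃ h′ a) l → sumPS h l ≃ sumPS h′ l
sumPS-congᴬ [] = R.refl
sumPS-congᴬ (e ∷ es) = R.+-cong e (sumPS-congᴬ es)

-- In characteristic 2 only the diagonal of a symmetric double sum survives.
sumPS-symmetric : ∀ {A : Set} (h : A → A → PS) → (∀ a b → h a b ≃ h b a) → ∀ l → sumPS (λ a → sumPS (h a) l) l ≃ sumPS (λ a → h a a) l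
sumPS-symmetric h s [] = R.refl
sumPS-symmetric h s (x ∷ l) = begin
  (h x x ⊞ X) ⊞ sumPS (λ a → h a x ⊞ sumPS (h a) l) l
    ≈⟨ R.+-congˡ (R.trans (sumPS-⊞ (λ a → h a x) (λ a → sumPS (h a) l) l) (R.+-cong (sumPS-cong (λ a → s a x) l) (sumPS-symmetric h s l))) ⟩
  (h x x ⊞ X) ⊞ (X ⊞ D)
    ≈⟨ ring (h x x ∷ X ∷ D ∷ []) ((:x :+ :y) :+ (:y :+ :z)) (:x :+ :z) refl ⟩
  h x x ⊞ D ∎
  where
  open ≃-Reasoning
  X = sumPS (h x) l
  D = sumPS (λ a → h a a) l

dbl≡+ : ∀ n → dbl n ≡ n + n
dbl≡+ zero = refl
dbl≡+ (suc n) = cong suc (trans (cong suc (dbl≡+ n)) (sym (ℕₚ.+-suc n n)))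

dbl-+ : ∀ m k → dbl (m + k) ≡ dbl m + dbl k
dbl-+ zero k = refl
dbl-+ (suc m) k = cong (λ n → 2 + n) (dbl-+ m k)

digit-+ : ∀ i m k → digit i (m + k) ≡ digit i m + dbl k
digit-+ false m k = dbl-+ m k
digit-+ true m k = cong suc (dbl-+ m k)

sec : Bool → PS → PS
sec j f m = f (digit j m)

sec-⊞ : ∀ j f g → sec j (f ⊞ g) ≃ sec j f ⊞ sec j g
sec-⊞ j f g = mk λ m → trans (⊞-at f g (digit j m)) (sym (⊞-at (sec j f) (sec j g) m))

sec-cong : ∀ j {f g} → f ≃ g → sec j f ≃ sec j g
sec-cong j e = mk λ m → at e (digit j m)

sec-sumPS : ∀ {A : Set} j (h : A → PS) l → sec j (sumPS h l) ≃ sumPS (sec j ∘ h) l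
sec-sumPS j h [] = R.refl
sec-sumPS j h (a ∷ l) = R.trans (sec-⊞ j (h a) (sumPS h l)) (R.+-congˡ (sec-sumPS j h l))

sec-shN : ∀ j t f → sec j (shN (dbl t) f) ≃ shN t (sec j f)
sec-shN j t f = mk (go j t)
  where
  go : ∀ j t m → shN (dbl t) f (digit j m) ≡ shN t (sec j f) m
  go j zero m = refl
  go false (suc t) zero = refl
  go true (suc t) zero = refl
  go false (suc t) (suc m) = go false t m
  go true (suc t) (suc m) = go true t m

module Recurrence (d : ℕ) (l : Relation) where

  Sat : (ℕ → PS) → Set
  Sat a = ∀ n → a (n + suc d) ≃ sumPS (λ (i , j) → shN j (a (n + i))) l

  -- Applying the recurrence to each term on its own right-hand side gives a double sum symmetric in
  -- the two terms; the off-diagonal part cancels. This is the Frobenius map at the level of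
  -- operators.
  Sat-double : ∀ {a} → Sat a → ∀ n → a (n + dbl (suc d)) ≃ sumPS (λ (i , j) → shN (dbl j) (a (n + dbl i))) l
  Sat-double {a} s n = begin
    a (n + dbl (suc d))
      ≈⟨ reindex (trans (cong (λ k → n + k) (dbl≡+ (suc d))) (sym (ℕₚ.+-assoc n (suc d) (suc d)))) ⟩
    a (n + suc d + suc d)
      ≈⟨ s (n + suc d) ⟩
    sumPS (λ (i , j) → shN j (a (n + suc d + i))) l
      ≈⟨ sumPS-cong (λ (i , j) → shN-cong j (R.trans (reindex (swap i)) (s (n + i)))) l ⟩
    sumPS (λ (i , j) → shN j (sumPS (λ (i′ , j′) → shN j′ (a (n + i + i′))) l)) l
      ≈⟨ sumPS-cong (λ (i , j) → R.trans (shN-sumPS j _ l) (sumPS-cong (λ (i′ , j′) → shN-shN j j′ (a (n + i + i′))) l)) l ⟩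
    sumPS (λ (i , j) → sumPS (λ (i′ , j′) → shN (j + j′) (a (n + i + i′))) l) l
      ≈⟨ sumPS-symmetric (λ (i , j) (i′ , j′) → shN (j + j′) (a (n + i + i′))) symmetric l ⟩
    sumPS (λ (i , j) → shN (j + j) (a (n + i + i))) l
      ≈⟨ sumPS-cong (λ (i , j) → R.trans (shN-cong (j + j) (reindex (trans (ℕₚ.+-assoc n i i) (cong (λ k → n + k) (sym (dbl≡+ i))))))
           (shN-reindex (sym (dbl≡+ j)) (a (n + dbl i)))) l ⟩
    sumPS (λ (i , j) → shN (dbl j) (a (n + dbl i))) l ∎
    where
    open ≃-Reasoning
    reindex : ∀ {m m′} → m ≡ m′ → a m ≃ a m′
    reindex refl = R.refl
    shN-reindex : ∀ {j j′} → j ≡ j′ → ∀ f → shN j f ≃ shN j′ f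
    shN-reindex refl f = R.refl
    swap : ∀ i → n + suc d + i ≡ n + i + suc d
    swap i = trans (ℕₚ.+-assoc n (suc d) i) (trans (cong (λ k → n + k) (ℕₚ.+-comm (suc d) i)) (sym (ℕₚ.+-assoc n i (suc d))))
    symmetric : ∀ e e′ → shN (proj₂ e + proj₂ e′) (a (n + proj₁ e + proj₁ e′)) ≃ shN (proj₂ e′ + proj₂ e) (a (n + proj₁ e′ + proj₁ e))
    symmetric (i , j) (i′ , j′) = R.trans (shN-reindex (ℕₚ.+-comm j j′) _) (shN-cong (j′ + j)
      (reindex (trans (ℕₚ.+-assoc n i i′) (trans (cong (λ k → n + k) (ℕₚ.+-comm i i′)) (sym (ℕₚ.+-assoc n i′ i))))))

  -- The doubled recurrence relates only indices of equal parity and shifts degrees by even amounts,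
  -- so on a section both can be halved, which gives back the original recurrence.
  Sat-section : ∀ {a} → Sat a → ∀ i j → Sat (λ m → sec j (a (digit i m)))
  Sat-section {a} s i j m = R.trans (sec-cong j (R.trans (reindex (digit-+ i m (suc d))) (Sat-double {a} s (digit i m))))
    (R.trans (sec-sumPS j _ l) (sumPS-cong (λ (i′ , j′) → R.trans (sec-shN j j′ (a (digit i m + dbl i′)))
      (shN-cong j′ (sec-cong j (reindex (sym (digit-+ i m i′)))))) l))
    where
    reindex : ∀ {m m′} → m ≡ m′ → a m ≃ a m′
    reindex refl = R.refl

  Sat-zero : Sat (λ _ → zeroPS)
  Sat-zero n = go l
    where
    go : ∀ l → zeroPS ≃ sumPS (λ (i , j) → shN j zeroPS) l
    go [] = R.refl
    go ((i , j) ∷ l) = R.trans (R.sym (R.+-identityˡ zeroPS)) (R.+-cong (R.sym (shN-zero j)) (go l))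

  Sat-⊞ : ∀ {a b} → Sat a → Sat b → Sat (λ n → a n ⊞ b n)
  Sat-⊞ {a} {b} s t n = R.trans (R.+-cong (s n) (t n)) (R.trans (R.sym (sumPS-⊞ _ _ l))
    (sumPS-cong (λ (i , j) → R.sym (shN-⊞ j (a (n + i)) (b (n + i)))) l))

  Sat-unique : Bounded d l → ∀ {a b} → Sat a → Sat b → (∀ i → i < suc d → a i ≃ b i) → ∀ n → a n ≃ b n
  Sat-unique bounded {a} {b} s t init n = go (suc n) n ℕₚ.≤-refl
    where
    go : ∀ N n → n < N → a n ≃ b n
    go (suc N) n (s≤s h) with ℕₚ.<-≤-connex n (suc d)
    ... | inj₁ n<D = init n n<D
    ... | inj₂ D≤n = subst (λ k → a k ≃ b k) (ℕₚ.m∸n+n≡m D≤n) (R.trans (s (n ∸ suc d))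
      (R.trans (sumPS-congᴬ (All.map (λ {(i , j)} i<D → shN-cong j (go N _ (ℕₚ.<-≤-trans
        (subst (n ∸ suc d + i <_) (ℕₚ.m∸n+n≡m D≤n) (ℕₚ.+-monoʳ-< (n ∸ suc d) i<D)) h))) bounded)) (R.sym (t (n ∸ suc d)))))

  iterate-suc : ∀ w n → iterate l w (suc n) ≡ step l (iterate l w n)
  iterate-suc w zero = refl
  iterate-suc w (suc n) = iterate-suc (step l w) n

  step-length : ∀ w → length (step l w) ≡ length w
  step-length [] = refl
  step-length (p ∷ w) = trans (Lₚ.length-++ w) (ℕₚ.+-comm (length w) 1)

  iterate-length : ∀ w n → length (iterate l w n) ≡ length w
  iterate-length w zero = refl
  iterate-length w (suc n) = trans (iterate-length (step l w) n) (step-length w)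

  values : List Poly → ℕ → Poly
  values w n = nth (iterate l w n) 0

  nth-step : ∀ w i → length w ≡ suc d → i < d → nth (step l w) i ≡ nth w (suc i)
  nth-step (p ∷ w) i len h = nth-++-< w _ i (subst (i <_) (sym (ℕₚ.suc-injective len)) h)

  nth-step-last : ∀ w → length w ≡ suc d → nth (step l w) d ≡ next l w
  nth-step-last (p ∷ w) len = trans (cong (nth (step l (p ∷ w))) (sym (ℕₚ.suc-injective len))) (nth-++-length w _)

  values-shift : ∀ w → length w ≡ suc d → ∀ i n → i < suc d → nth (iterate l w n) i ≡ values w (n + i)
  values-shift w len zero n h = cong (values w) (sym (ℕₚ.+-identityʳ n))
  values-shift w len (suc i) n (s≤s h) = begin
    nth (iterate l w n) (suc i) ≡⟨ nth-step (iterate l w n) i (trans (iterate-length w n) len) h ⟨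
    nth (step l (iterate l w n)) i ≡⟨ cong (λ v → nth v i) (iterate-suc w n) ⟨
    nth (iterate l w (suc n)) i ≡⟨ values-shift w len i (suc n) (ℕₚ.m<n⇒m<1+n h) ⟩
    values w (suc n + i) ≡⟨ cong (values w) (ℕₚ.+-suc n i) ⟨
    values w (n + suc i) ∎
    where open ≡-Reasoning

  co-next : ∀ l w → co (next l w) ≃ sumPS (λ (i , j) → shN j (co (nth w i))) l
  co-next [] w = R.refl
  co-next ((i , j) ∷ l) w = R.trans (co-add (shift j (nth w i)) _) (R.+-cong (co-shift j (nth w i)) (co-next l w))

  Sat-values : Bounded d l → ∀ w → length w ≡ suc d → Sat (co ∘ values w)
  Sat-values bounded w len n = R.trans (mk λ m → cong (λ p → co p m) last)
    (R.trans (co-next l (iterate l w n)) (sumPS-congᴬ (All.map (λ {(i , j)} h → shN-cong j (mk λ m → cong (λ p → co p m) (values-shift w len i n h))) bounded)))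
    where
    last : values w (n + suc d) ≡ next l (iterate l w n)
    last = begin
      values w (n + suc d) ≡⟨ cong (values w) (ℕₚ.+-suc n d) ⟩
      values w (suc n + d) ≡⟨ values-shift w len d (suc n) ℕₚ.≤-refl ⟨
      nth (iterate l w (suc n)) d ≡⟨ cong (λ v → nth v d) (iterate-suc w n) ⟩
      nth (step l (iterate l w n)) d ≡⟨ nth-step-last (iterate l w n) (trans (iterate-length w n) len) ⟩
      next l (iterate l w n) ∎
      where open ≡-Reasoning

-- Finite certificates for matrices closed under sections

maskXor : List Bool → (ℕ → Bool) → Bool
maskXor [] f = false
maskXor (b ∷ bs) f = (b ∧ f 0) xor maskXor bs (f ∘ suc)

maskSum : List Bool → (ℕ → PS) → PS
maskSum [] f = zeroPS
maskSum (b ∷ bs) f = (if b then f 0 else zeroPS) ⊞ maskSum bs (f ∘ suc)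

maskSumᵖ : List Bool → (ℕ → Poly) → Poly
maskSumᵖ [] f = []
maskSumᵖ (b ∷ bs) f = (if b then f 0 else []) +ᵖ maskSumᵖ bs (f ∘ suc)

co-maskSum : ∀ bs f → co (maskSumᵖ bs f) ≃ maskSum bs (co ∘ f)
co-maskSum [] f = R.refl
co-maskSum (b ∷ bs) f = R.trans (co-add (if b then f 0 else []) _) (R.+-cong (co-if b) (co-maskSum bs (f ∘ suc)))
  where
  co-if : ∀ b → co (if b then f 0 else []) ≃ (if b then co (f 0) else zeroPS)
  co-if false = R.refl
  co-if true = R.refl

maskSum-at : ∀ bs f n → maskSum bs f n ≡ maskXor bs (λ k → f k n)
maskSum-at [] f n = refl
maskSum-at (b ∷ bs) f n = trans (⊞-at (if b then f 0 else zeroPS) _ n) (cong₂ _xor_ (at-if b) (maskSum-at bs (f ∘ suc) n))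
  where
  at-if : ∀ b → (if b then f 0 else zeroPS) n ≡ b ∧ f 0 n
  at-if false = refl
  at-if true = refl

maskXor-xor : ∀ bs f g → maskXor bs (λ k → f k xor g k) ≡ maskXor bs f xor maskXor bs g
maskXor-xor [] f g = refl
maskXor-xor (b ∷ bs) f g = trans (cong₂ _xor_ (∧-distribˡ-xor b (f 0) (g 0)) (maskXor-xor bs (f ∘ suc) (g ∘ suc)))
  (xor-interchange (b ∧ f 0) (b ∧ g 0) _ _)

_xorˢ_ : Symbol → Symbol → Symbol
(x , y , z) xorˢ (x′ , y′ , z′) = x xor x′ , y xor y′ , z xor z′

maskSymbol : List Bool → (ℕ → Symbol) → Symbol
maskSymbol [] f = false , false , false
maskSymbol (b ∷ bs) f = (if b then f 0 else (false , false , false)) xorˢ maskSymbol bs (f ∘ suc)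

symbol-xor : ∀ ε ε′ v v′ → symbol (ε xorˢ ε′) v v′ ≡ symbol ε v v′ xor symbol ε′ v v′
symbol-xor (x , y , z) (x′ , y′ , z′) v v′ = begin
  ((x xor x′) ∧ a) xor (((y xor y′) ∧ b) xor ((z xor z′) ∧ c))
    ≡⟨ cong₂ _xor_ (∧-distribʳ-xor a x x′) (cong₂ _xor_ (∧-distribʳ-xor b y y′) (∧-distribʳ-xor c z z′)) ⟩
  ((x ∧ a) xor (x′ ∧ a)) xor (((y ∧ b) xor (y′ ∧ b)) xor ((z ∧ c) xor (z′ ∧ c)))
    ≡⟨ cong (((x ∧ a) xor (x′ ∧ a)) xor_) (xor-interchange (y ∧ b) (y′ ∧ b) (z ∧ c) (z′ ∧ c)) ⟩
  ((x ∧ a) xor (x′ ∧ a)) xor (((y ∧ b) xor (z ∧ c)) xor ((y′ ∧ b) xor (z′ ∧ c)))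
    ≡⟨ xor-interchange (x ∧ a) (x′ ∧ a) _ _ ⟩
  ((x ∧ a) xor ((y ∧ b) xor (z ∧ c))) xor ((x′ ∧ a) xor ((y′ ∧ b) xor (z′ ∧ c))) ∎
  where
  open ≡-Reasoning
  a = symA v v′
  b = symB v v′
  c = symI v v′

maskSymbol-correct : ∀ bs f v v′ → symbol (maskSymbol bs f) v v′ ≡ maskXor bs (λ k → symbol (f k) v v′)
maskSymbol-correct [] f v v′ = refl
maskSymbol-correct (b ∷ bs) f v v′ = trans (symbol-xor (if b then f 0 else (false , false , false)) _ v v′)
  (cong₂ _xor_ (symbol-if b) (maskSymbol-correct bs (f ∘ suc) v v′))
  where
  symbol-if : ∀ b → symbol (if b then f 0 else (false , false , false)) v v′ ≡ b ∧ symbol (f 0) v v′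
  symbol-if false = refl
  symbol-if true = refl

-- An operator on 𝔽₂[y], given by a window of a linear recurrence together with a symbol; its four sections
-- are sums of operators of the same list, and it lowers deg₀ and deg₁ by at least drop₀ and drop₁.
record State : Set where
  constructor state
  field
    win : List Poly
    symb : Symbol
    c₀₀ c₀₁ c₁₀ c₁₁ : List Bool
    drop₀ drop₁ : ℕ
open State public

mask : State → Bool → Bool → List Bool
mask s false false = c₀₀ s
mask s false true = c₀₁ s
mask s true false = c₁₀ s
mask s true true = c₁₁ s

lookupS : List State → ℕ → State
lookupS [] k = state [] (false , false , false) [] [] [] [] 0 0
lookupS (s ∷ ss) zero = s
lookupS (s ∷ ss) (suc k) = lookupS ss k

everyOther : Poly → Poly
everyOther [] = []
everyOther (c ∷ []) = c ∷ []
everyOther (c ∷ _ ∷ p) = c ∷ everyOther p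

secᵖ : Bool → Poly → Poly
secᵖ false p = everyOther p
secᵖ true p = everyOther (drop 1 p)

co-everyOther : ∀ p m → co (everyOther p) m ≡ co p (dbl m)
co-everyOther [] m = refl
co-everyOther (c ∷ []) zero = refl
co-everyOther (c ∷ []) (suc m) = refl
co-everyOther (c ∷ _ ∷ p) zero = refl
co-everyOther (c ∷ _ ∷ p) (suc m) = co-everyOther p m

co-sec : ∀ j p → co (secᵖ j p) ≃ sec j (co p)
co-sec false p = mk (co-everyOther p)
co-sec true p = mk λ m → trans (co-everyOther (drop 1 p) m) (co-drop p (dbl m))
  where
  co-drop : ∀ p n → co (drop 1 p) n ≡ co p (suc n)
  co-drop [] n = refl
  co-drop (c ∷ p) n = refl

allᵇ : (ℕ → Bool) → ℕ → Bool
allᵇ f zero = true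
allᵇ f (suc n) = f n ∧ allᵇ f n

∧-split : ∀ {a b} → a ∧ b ≡ true → a ≡ true × b ≡ true
∧-split {true} e = refl , e

allᵇ-sound : ∀ f n → allᵇ f n ≡ true → ∀ k → k < n → f k ≡ true
allᵇ-sound f (suc n) e k (s≤s h) with ∧-split {f n} e | ℕₚ.m≤n⇒m<n∨m≡n h
... | a , b | inj₁ k<n = allᵇ-sound f n b k k<n
... | a , b | inj₂ refl = a

≤ᵇ-sound : ∀ m n → (m ≤ᵇ n) ≡ true → m ≤ n
≤ᵇ-sound m n e = ℕₚ.≤ᵇ⇒≤ m n (subst Data.Bool.T (sym e) tt)

<ᵇ-sound : ∀ m n → (m <ᵇ n) ≡ true → m < n
<ᵇ-sound m n e = ℕₚ.<ᵇ⇒< m n (subst Data.Bool.T (sym e) tt)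

maskAll : List Bool → (ℕ → Bool) → Bool
maskAll [] f = true
maskAll (b ∷ bs) f = (not b ∨ f 0) ∧ maskAll bs (f ∘ suc)

maskXor-witness : ∀ bs f g → maskAll bs f ≡ true → maskXor bs g ≡ true → ∃[ k ] (f k ≡ true × g k ≡ true)
maskXor-witness (false ∷ bs) f g a x with maskXor-witness bs (f ∘ suc) (g ∘ suc) a x
... | k , p , q = suc k , p , q
maskXor-witness (true ∷ bs) f g a x with g 0 in g0 | ∧-split {f 0} a
... | true | f0 , _ = 0 , f0 , g0
... | false | _ , a′ with maskXor-witness bs (f ∘ suc) (g ∘ suc) a′ x
... | k , p , q = suc k , p , q

infix 4 _≡ᵇᵇ_
_≡ᵇᵇ_ : Bool → Bool → Bool
a ≡ᵇᵇ b = not (a xor b)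

≡ᵇᵇ-sound : ∀ a b → (a ≡ᵇᵇ b) ≡ true → a ≡ b
≡ᵇᵇ-sound false false e = refl
≡ᵇᵇ-sound true true e = refl

_≡ˢ_ : Symbol → Symbol → Bool
(x , y , z) ≡ˢ (x′ , y′ , z′) = (x ≡ᵇᵇ x′) ∧ ((y ≡ᵇᵇ y′) ∧ (z ≡ᵇᵇ z′))

≡ˢ-sound : ∀ ε ε′ → (ε ≡ˢ ε′) ≡ true → ε ≡ ε′
≡ˢ-sound (x , y , z) (x′ , y′ , z′) e with ∧-split {x ≡ᵇᵇ x′} e
... | a , e′ with ∧-split {y ≡ᵇᵇ y′} e′
... | b , c = cong₂ _,_ (≡ᵇᵇ-sound x x′ a) (cong₂ _,_ (≡ᵇᵇ-sound y y′ b) (≡ᵇᵇ-sound z z′ c))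

both : (Bool → Bool → Bool) → Bool
both f = (f false false ∧ f false true) ∧ (f true false ∧ f true true)

both-sound : ∀ f → both f ≡ true → ∀ i j → f i j ≡ true
both-sound f e i j with ∧-split {f false false ∧ f false true} e
both-sound f e false false | a , b = proj₁ (∧-split a)
both-sound f e false true | a , b = proj₂ (∧-split {f false false} a)
both-sound f e true false | a , b = proj₁ (∧-split b)
both-sound f e true true | a , b = proj₂ (∧-split {f true false} b)

module Check (d : ℕ) (l : Relation) where

  section-ok : List State → Bool → List Bool → ℕ → ℕ → List Poly → Bool
  section-ok ss j c zero m w = true
  -- One index of a section corresponds to two indices of the operator, hence the double step;
  -- `start` has fixed the parity of the index beforehand.
  section-ok ss j c (suc f) m w = isZero 1 (secᵖ j (nth w 0) +ᵖ maskSumᵖ c (λ k → nth (win (lookupS ss k)) m))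
    ∧ section-ok ss j c f (suc m) (step l (step l w))

  start : Bool → List Poly → List Poly
  start false w = w
  start true w = step l w

  section-ij-ok symbol-ij-ok drop-ij-ok : List State → ℕ → Bool → Bool → Bool
  section-ij-ok ss k i j = section-ok ss j (mask (lookupS ss k) i j) (suc d) 0 (start i (win (lookupS ss k)))
  symbol-ij-ok ss k i j = maskSymbol (mask (lookupS ss k) i j) (symb ∘ lookupS ss) ≡ˢ section (symb (lookupS ss k)) i j

  -- These inequalities lift the drops of state k′ between m and m′ to those of state k between
  -- `digit i m` and `digit j m′`. The two kinds of drop are exchanged because the two degrees are,
  -- and the factor 2 is the one in `deg₁-digit`.
  drop-ok : List State → ℕ → Bool → Bool → ℕ → Bool
  drop-ok ss k i j k′ = (k′ <ᵇ length ss) ∧ ((2 * b→ℕ j + drop₀ (lookupS ss k) ≤ᵇ 2 * b→ℕ i + drop₁ (lookupS ss k′))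
    ∧ (3 * b→ℕ j + drop₁ (lookupS ss k) ≤ᵇ 3 * b→ℕ i + 2 * drop₀ (lookupS ss k′)))

  drop-ij-ok ss k i j = maskAll (mask (lookupS ss k) i j) (drop-ok ss k i j)

  -- The induction by halving stops at index 0. There the polynomial must be constant, and unless
  -- both claimed drops are 0 the symbol must cancel that constant.
  base-ok : List State → ℕ → Bool
  base-ok ss k = isZero 1 (drop 1 (nth (win (lookupS ss k)) 0))
    ∧ ((drop₀ (lookupS ss k) + drop₁ (lookupS ss k) ≡ᵇ 0) ∨ not (co (nth (win (lookupS ss k)) 0) 0 xor proj₂ (proj₂ (symb (lookupS ss k)))))

  state-ok : List State → ℕ → Bool
  state-ok ss k = (length (win (lookupS ss k)) ≡ᵇ suc d) ∧ (both (section-ij-ok ss k) ∧ (both (symbol-ij-ok ss k) ∧ (both (drop-ij-ok ss k) ∧ base-ok ss k)))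

  states-ok : List State → Bool
  states-ok ss = allᵇ (state-ok ss) (length ss)

module Certificate (d : ℕ) (l : Relation) (bounded : Bounded d l) (ss : List State) (ok : Check.states-ok d l ss ≡ true) where
  open Check d l
  open Recurrence d l

  st : ℕ → State
  st = lookupS ss

  entry : ℕ → ℕ → ℕ → Bool
  entry k n n′ = co (values (win (st k)) n) n′ xor symbol (symb (st k)) (code n) (code n′)

  module OK (k : ℕ) (k<S : k < length ss) where
    private
      all = allᵇ-sound (state-ok ss) (length ss) ok k k<S
      s₁ = ∧-split {length (win (st k)) ≡ᵇ suc d} all
      s₂ = ∧-split {both (section-ij-ok ss k)} (proj₂ s₁)
      s₃ = ∧-split {both (symbol-ij-ok ss k)} (proj₂ s₂)
      s₄ = ∧-split {both (drop-ij-ok ss k)} (proj₂ s₃)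
    win-length : length (win (st k)) ≡ suc d
    win-length = ℕₚ.≡ᵇ⇒≡ _ (suc d) (subst Data.Bool.T (sym (proj₁ s₁)) tt)
    sections : ∀ i j → section-ij-ok ss k i j ≡ true
    sections = both-sound (section-ij-ok ss k) (proj₁ s₂)
    symbols : ∀ i j → maskSymbol (mask (st k) i j) (symb ∘ st) ≡ section (symb (st k)) i j
    symbols i j = ≡ˢ-sound _ _ (both-sound (symbol-ij-ok ss k) (proj₁ s₃) i j)
    drops : ∀ i j → drop-ij-ok ss k i j ≡ true
    drops = both-sound (drop-ij-ok ss k) (proj₁ s₄)
    base : base-ok ss k ≡ true
    base = proj₂ s₄

  section-check : ∀ j c f m w → section-ok ss j c f m w ≡ true → ∀ k → k < f →
    sec j (co (values w (dbl k))) ≃ maskSum c (λ k′ → co (nth (win (st k′)) (m + k)))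
  section-check j c (suc f) m w e zero h = ⊞-zero⇒≃ (begin
    sec j (co (nth w 0)) ⊞ maskSum c (λ k′ → co (nth (win (st k′)) (m + 0)))
      ≈⟨ R.+-cong (R.sym (co-sec j (nth w 0))) (R.trans (mk λ n → cong (λ i → maskSum c (λ k′ → co (nth (win (st k′)) i)) n) (ℕₚ.+-identityʳ m))
           (R.sym (co-maskSum c (λ k′ → nth (win (st k′)) m)))) ⟩
    co (secᵖ j (nth w 0)) ⊞ co (maskSumᵖ c (λ k′ → nth (win (st k′)) m))
      ≈⟨ co-add (secᵖ j (nth w 0)) _ ⟨
    co (secᵖ j (nth w 0) +ᵖ maskSumᵖ c (λ k′ → nth (win (st k′)) m))
      ≈⟨ co-isZero (secᵖ j (nth w 0) +ᵖ maskSumᵖ c (λ k′ → nth (win (st k′)) m)) (proj₁ (∧-split e)) ⟩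
    zeroPS ∎)
    where open ≃-Reasoning
  section-check j c (suc f) m w e (suc k) (s≤s h) = R.trans
    (section-check j c f (suc m) (step l (step l w)) (proj₂ (∧-split {isZero 1 (secᵖ j (nth w 0) +ᵖ maskSumᵖ c (λ k → nth (win (st k)) m))} e)) k h)
    (mk λ n → cong (λ i → maskSum c (λ k′ → co (nth (win (st k′)) i)) n) (sym (ℕₚ.+-suc m k)))

  values-digit : ∀ i w m → values (start i w) (dbl m) ≡ values w (digit i m)
  values-digit false w m = refl
  values-digit true w m = refl

  maskIn : List Bool → ℕ → Bool
  maskIn [] k = false
  maskIn (b ∷ bs) zero = b
  maskIn (b ∷ bs) (suc k) = maskIn bs k

  Sat-maskSum : ∀ c (a : ℕ → ℕ → PS) → (∀ k → maskIn c k ≡ true → Sat (a k)) → Sat (λ m → maskSum c (λ k → a k m))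
  Sat-maskSum [] a s = Sat-zero
  Sat-maskSum (false ∷ c) a s = Sat-⊞ {λ _ → zeroPS} {λ m → maskSum c (λ k → a (suc k) m)} Sat-zero (Sat-maskSum c (a ∘ suc) (s ∘ suc))
  Sat-maskSum (true ∷ c) a s = Sat-⊞ {a 0} {λ m → maskSum c (λ k → a (suc k) m)} (s 0 refl) (Sat-maskSum c (a ∘ suc) (s ∘ suc))

  maskAll-sound : ∀ c f → maskAll c f ≡ true → ∀ k → maskIn c k ≡ true → f k ≡ true
  maskAll-sound (true ∷ c) f e zero refl = proj₁ (∧-split e)
  maskAll-sound (b ∷ c) f e (suc k) h = maskAll-sound c (f ∘ suc) (proj₂ (∧-split {not b ∨ f 0} e)) k h

  drop-bounds : ∀ k i j k′ → drop-ok ss k i j k′ ≡ true → (k′ < length ss)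
    × (2 * b→ℕ j + drop₀ (st k) ≤ 2 * b→ℕ i + drop₁ (st k′)) × (3 * b→ℕ j + drop₁ (st k) ≤ 3 * b→ℕ i + 2 * drop₀ (st k′))
  drop-bounds k i j k′ e with ∧-split {k′ <ᵇ length ss} e
  ... | a , e′ with ∧-split {2 * b→ℕ j + drop₀ (st k) ≤ᵇ 2 * b→ℕ i + drop₁ (st k′)} e′
  ... | b , c = <ᵇ-sound _ _ a , ≤ᵇ-sound _ _ b , ≤ᵇ-sound _ _ c

  -- Both sides satisfy the same recurrence, so agreement at the first `suc d` indices, which the
  -- certificate checks, suffices.
  values-section : ∀ k → k < length ss → ∀ i j m → sec j (co (values (win (st k)) (digit i m))) ≃ maskSum (mask (st k) i j) (λ k′ → co (values (win (st k′)) m))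
  values-section k h i j = Sat-unique bounded {λ m → sec j (co (values (win (st k)) (digit i m)))} {λ m → maskSum c (λ k′ → co (values (win (st k′)) m))}
    (Sat-section {co ∘ values (win (st k))} (Sat-values bounded (win (st k)) (OK.win-length k h)) i j)
    (Sat-maskSum c (λ k′ m → co (values (win (st k′)) m)) λ k′ in-c → Sat-values bounded (win (st k′)) (OK.win-length k′ (inside k′ in-c)))
    λ m m<D → R.trans (mk λ n → cong (λ p → co p (digit j n)) (sym (values-digit i (win (st k)) m)))
      (R.trans (section-check j c (suc d) 0 (start i (win (st k))) (OK.sections k h i j) m m<D)
        (maskSum-cong c λ k′ in-c → mk λ n → cong (λ p → co p n) (values-shift (win (st k′)) (OK.win-length k′ (inside k′ in-c)) m 0 m<D)))
    where
    c = mask (st k) i j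
    inside : ∀ k′ → maskIn c k′ ≡ true → k′ < length ss
    inside k′ in-c = proj₁ (drop-bounds k i j k′ (maskAll-sound c (drop-ok ss k i j) (OK.drops k h i j) k′ in-c))
    maskSum-cong : ∀ c {f g : ℕ → PS} → (∀ k → maskIn c k ≡ true → f k ≃ g k) → maskSum c f ≃ maskSum c g
    maskSum-cong [] e = R.refl
    maskSum-cong (false ∷ c) e = R.+-congˡ (maskSum-cong c (e ∘ suc))
    maskSum-cong (true ∷ c) e = R.+-cong (e 0 refl) (maskSum-cong c (e ∘ suc))

  entry-section : ∀ k → k < length ss → ∀ i j m m′ → entry k (digit i m) (digit j m′) ≡ maskXor (mask (st k) i j) (λ k′ → entry k′ m m′)
  entry-section k h i j m m′ = begin
    co (values (win (st k)) (digit i m)) (digit j m′) xor symbol (symb (st k)) (code (digit i m)) (code (digit j m′))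
      ≡⟨ cong₂ _xor_ (trans (at (values-section k h i j m) m′) (maskSum-at c _ m′))
           (trans (cong₂ (symbol (symb (st k))) (code-digit i m) (code-digit j m′))
           (trans (symbol-section (symb (st k)) i j (code m) (code m′))
           (trans (cong (λ ε → symbol ε (code m) (code m′)) (sym (OK.symbols k h i j))) (maskSymbol-correct c (symb ∘ st) (code m) (code m′))))) ⟩
    maskXor c (λ k′ → co (values (win (st k′)) m) m′) xor maskXor c (λ k′ → symbol (symb (st k′)) (code m) (code m′))
      ≡⟨ maskXor-xor c _ _ ⟨
    maskXor c (λ k′ → entry k′ m m′) ∎
    where
    open ≡-Reasoning
    c = mask (st k) i j

  Lowers : ℕ → ℕ → ℕ → Set
  Lowers k n n′ = (deg₀ (code n′) + drop₀ (st k) ≤ deg₀ (code n)) × (deg₁ (code n′) + drop₁ (st k) ≤ deg₁ (code n))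

  symI-0 : ∀ n → symI (0 , 0) (code (suc n)) ≡ false
  symI-0 n = go (code (suc n)) refl
    where
    go : ∀ v → code (suc n) ≡ v → symI (0 , 0) v ≡ false
    go (suc _ , _) e = refl
    go (zero , suc _) e = refl
    go (zero , zero) e with () ← code-injective (suc n) 0 e

  symbol-0 : ∀ ε v → symI (0 , 0) v ≡ false → symbol ε (0 , 0) v ≡ false
  symbol-0 (x , y , z) (a , b) e rewrite e | ∧-zeroʳ x | ∧-zeroʳ z | ∧-zeroʳ (0 ≡ᵇ a) | ∧-zeroʳ y = refl

  lowers-0 : ∀ k → k < length ss → ∀ n′ → entry k 0 n′ ≡ true → Lowers k 0 n′
  lowers-0 k h n′ e with ∧-split {isZero 1 (drop 1 (nth (win (st k)) 0))} (OK.base k h)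
  lowers-0 k h (suc n) e | z , b with trans (sym e) (cong₂ _xor_
      (trans (sym (co-tail (nth (win (st k)) 0) n)) (at (co-isZero (drop 1 (nth (win (st k)) 0)) z) n)) (symbol-0 (symb (st k)) (code (suc n)) (symI-0 n)))
    where
    co-tail : ∀ p n → co (drop 1 p) n ≡ co p (suc n)
    co-tail [] n = refl
    co-tail (c ∷ p) n = refl
  ... | ()
  lowers-0 k h zero e | z , b with drop₀ (st k) + drop₁ (st k) in d≡
  ... | zero = ℕₚ.≤-reflexive (ℕₚ.m+n≡0⇒m≡0 (drop₀ (st k)) d≡) , ℕₚ.≤-reflexive (ℕₚ.m+n≡0⇒n≡0 (drop₀ (st k)) d≡)
  ... | suc _ = ⊥-elim (contradiction′ (co (nth (win (st k)) 0) 0) (symb (st k)) e b)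
    where
    contradiction′ : ∀ c ε → c xor symbol ε (0 , 0) (0 , 0) ≡ true → not (c xor proj₂ (proj₂ ε)) ≡ true → ⊥
    contradiction′ c (x , y , z) e b rewrite ∧-zeroʳ x | ∧-zeroʳ y | ∧-identityʳ z with c xor z
    contradiction′ c (x , y , z) () b | false
    contradiction′ c (x , y , z) e () | true

  add-bounds : ∀ {J K I L U V} → J + K ≤ I + L → U + L ≤ V → J + U + K ≤ I + V
  add-bounds {J} {K} {I} {L} {U} {V} p q = ℕₚ.+-cancelʳ-≤ L (J + U + K) (I + V)
    (subst₂ _≤_ (e₁ J K U L) (e₂ I L V) (ℕₚ.+-mono-≤ p q))
    where
    e₁ : ∀ J K U L → J + K + (U + L) ≡ J + U + K + L
    e₁ = ℕ-Solver.solve-∀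
    e₂ : ∀ I L V → I + L + V ≡ I + V + L
    e₂ = ℕ-Solver.solve-∀

  -- Induction on n by halving: a nonzero entry is a sum of entries of other states at the halved
  -- indices, so at least one of those is nonzero, and its drops lift through `drop-bounds`.
  lowers : ∀ k → k < length ss → ∀ n n′ → entry k n n′ ≡ true → Lowers k n n′
  lowers k h n = go n n ℕₚ.≤-refl k h
    where
    go : ∀ N n → n ≤ N → ∀ k → k < length ss → ∀ n′ → entry k n n′ ≡ true → Lowers k n n′
    go N zero _ k h n′ e = lowers-0 k h n′ e
    go (suc N) n@(suc n₀) (s≤s n≤N) k h n′ e
      with maskXor-witness (mask (st k) i j) (drop-ok ss k i j) (λ k′ → entry k′ m m′) (OK.drops k h i j)
             (trans (sym (entry-section k h i j m m′)) (trans (cong₂ (entry k) (digit-half n) (digit-half n′)) e))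
      where
      i = bit n
      j = bit n′
      m = half n
      m′ = half n′
    ... | k′ , dk , ek with drop-bounds k (bit n) (bit n′) k′ dk
    ... | k′<S , b₀ , b₁ with go N (half n) (ℕₚ.≤-trans (half-< n₀) n≤N) k′ k′<S (half n′) ek
    ... | ih₀ , ih₁ =
      subst₂ _≤_ (cong (_+ drop₀ (st k)) (e₀ n′)) (e₀ n) (add-bounds {2 * b→ℕ (bit n′)} {drop₀ (st k)} {2 * b→ℕ (bit n)} b₀ ih₁) ,
      subst₂ _≤_ (cong (_+ drop₁ (st k)) (e₁ n′)) (e₁ n) (add-bounds {3 * b→ℕ (bit n′)} {drop₁ (st k)} {3 * b→ℕ (bit n)} b₁
        (subst (_≤ 2 * deg₀ (code (half n))) (ℕₚ.*-distribˡ-+ 2 (deg₀ (code (half n′))) (drop₀ (st k′))) (ℕₚ.*-monoʳ-≤ 2 ih₀)))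
      where
      e₀ : ∀ n → 2 * b→ℕ (bit n) + deg₁ (code (half n)) ≡ deg₀ (code n)
      e₀ n = trans (sym (deg₀-digit (bit n) (half n))) (cong (deg₀ ∘ code) (digit-half n))
      e₁ : ∀ n → 3 * b→ℕ (bit n) + 2 * deg₀ (code (half n)) ≡ deg₁ (code n)
      e₁ n = trans (sym (deg₁-digit (bit n) (half n))) (cong (deg₁ ∘ code) (digit-half n))

-- The states of index 18 and 19 (30 and 31 for p = 13) are T p minus the lowering operator, on the two modules.
states₇ : List State
states₇ =
  state (map bits (0 ∷ 0 ∷ 0 ∷ 0 ∷ 0 ∷ 0 ∷ 1 ∷ 2 ∷ [])) (false , false , false) (bits 23) (bits 0) (bits 0) (bits 22) 7 10 ∷
  state (map bits (0 ∷ 0 ∷ 0 ∷ 0 ∷ 0 ∷ 0 ∷ 1 ∷ 0 ∷ [])) (false , false , false) (bits 20) (bits 0) (bits 0) (bits 2) 7 10 ∷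
  state (map bits (0 ∷ 0 ∷ 0 ∷ 0 ∷ 0 ∷ 1 ∷ 0 ∷ 4 ∷ [])) (false , false , false) (bits 0) (bits 1) (bits 1088) (bits 0) 6 9 ∷
  state (map bits (0 ∷ 0 ∷ 0 ∷ 0 ∷ 0 ∷ 1 ∷ 0 ∷ 2 ∷ [])) (false , false , false) (bits 3) (bits 2) (bits 2284) (bits 20) 6 9 ∷
  state (map bits (0 ∷ 0 ∷ 0 ∷ 1 ∷ 0 ∷ 1 ∷ 2 ∷ 20 ∷ [])) (false , false , false) (bits 0) (bits 17) (bits 5219) (bits 0) 5 7 ∷
  state (map bits (0 ∷ 0 ∷ 0 ∷ 0 ∷ 0 ∷ 0 ∷ 2 ∷ 6 ∷ [])) (false , false , false) (bits 3) (bits 23) (bits 3200) (bits 20) 5 7 ∷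
  state (map bits (0 ∷ 0 ∷ 0 ∷ 0 ∷ 1 ∷ 2 ∷ 4 ∷ 10 ∷ [])) (false , false , false) (bits 1120) (bits 0) (bits 0) (bits 1139) 4 6 ∷
  state (map bits (0 ∷ 0 ∷ 0 ∷ 0 ∷ 1 ∷ 0 ∷ 6 ∷ 0 ∷ [])) (false , false , false) (bits 1088) (bits 20) (bits 44) (bits 39) 4 6 ∷
  state (map bits (0 ∷ 0 ∷ 1 ∷ 2 ∷ 1 ∷ 2 ∷ 18 ∷ 32 ∷ [])) (false , true , false) (bits 2592) (bits 20) (bits 44) (bits 2628) 4 6 ∷
  state (map bits (0 ∷ 1 ∷ 0 ∷ 4 ∷ 2 ∷ 16 ∷ 8 ∷ 64 ∷ [])) (true , false , false) (bits 0) (bits 448) (bits 16384) (bits 0) 4 5 ∷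
  state (map bits (0 ∷ 0 ∷ 1 ∷ 2 ∷ 1 ∷ 0 ∷ 16 ∷ 42 ∷ [])) (false , false , false) (bits 6144) (bits 0) (bits 0) (bits 7184) 3 4 ∷
  state (map bits (0 ∷ 0 ∷ 1 ∷ 0 ∷ 0 ∷ 0 ∷ 16 ∷ 10 ∷ [])) (false , false , false) (bits 4099) (bits 0) (bits 0) (bits 3092) 3 4 ∷
  state (map bits (0 ∷ 1 ∷ 0 ∷ 4 ∷ 2 ∷ 16 ∷ 8 ∷ 64 ∷ [])) (false , false , false) (bits 0) (bits 1024) (bits 65536) (bits 0) 2 3 ∷
  state (map bits (0 ∷ 1 ∷ 0 ∷ 0 ∷ 0 ∷ 16 ∷ 8 ∷ 0 ∷ [])) (false , false , false) (bits 0) (bits 3075) (bits 143404) (bits 0) 2 3 ∷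
  state (map bits (1 ∷ 2 ∷ 4 ∷ 8 ∷ 20 ∷ 42 ∷ 84 ∷ 170 ∷ [])) (false , false , true) (bits 49152) (bits 0) (bits 0) (bits 51223) 1 2 ∷
  state (map bits (0 ∷ 0 ∷ 2 ∷ 6 ∷ 2 ∷ 2 ∷ 38 ∷ 120 ∷ [])) (false , false , false) (bits 3168) (bits 6167) (bits 196608) (bits 5219) 1 1 ∷
  state (map bits (1 ∷ 2 ∷ 4 ∷ 8 ∷ 20 ∷ 42 ∷ 84 ∷ 170 ∷ [])) (false , false , false) (bits 98304) (bits 0) (bits 0) (bits 100375) 0 0 ∷
  state (map bits (1 ∷ 0 ∷ 4 ∷ 4 ∷ 18 ∷ 8 ∷ 70 ∷ 98 ∷ [])) (false , false , false) (bits 68675) (bits 2071) (bits 208896) (bits 35927) 0 0 ∷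
  state (map bits (0 ∷ 1 ∷ 0 ∷ 4 ∷ 2 ∷ 16 ∷ 8 ∷ 64 ∷ [])) (true , false , false) (bits 0) (bits 448) (bits 16384) (bits 0) 4 5 ∷
  state (map bits (0 ∷ 1 ∷ 0 ∷ 4 ∷ 2 ∷ 17 ∷ 8 ∷ 68 ∷ [])) (true , false , false) (bits 0) (bits 449) (bits 17472) (bits 0) 4 5 ∷
  []

states₁₃ : List State
states₁₃ =
  state (map bits (0 ∷ 0 ∷ 0 ∷ 0 ∷ 0 ∷ 0 ∷ 0 ∷ 0 ∷ 0 ∷ 0 ∷ 0 ∷ 0 ∷ 1 ∷ 2 ∷ [])) (false , false , false) (bits 788) (bits 0) (bits 0) (bits 688) 8 10 ∷
  state (map bits (0 ∷ 0 ∷ 0 ∷ 0 ∷ 0 ∷ 0 ∷ 0 ∷ 1 ∷ 0 ∷ 0 ∷ 0 ∷ 0 ∷ 2 ∷ 0 ∷ [])) (false , false , false) (bits 0) (bits 4) (bits 525314) (bits 0) 7 11 ∷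
  state (map bits (0 ∷ 0 ∷ 0 ∷ 0 ∷ 0 ∷ 0 ∷ 1 ∷ 2 ∷ 0 ∷ 0 ∷ 1 ∷ 0 ∷ 4 ∷ 8 ∷ [])) (false , false , false) (bits 1024) (bits 0) (bits 0) (bits 1056) 7 10 ∷
  state (map bits (0 ∷ 0 ∷ 0 ∷ 0 ∷ 0 ∷ 0 ∷ 1 ∷ 0 ∷ 0 ∷ 0 ∷ 0 ∷ 0 ∷ 0 ∷ 8 ∷ [])) (false , false , false) (bits 3080) (bits 0) (bits 0) (bits 2152) 7 10 ∷
  state (map bits (0 ∷ 0 ∷ 0 ∷ 0 ∷ 0 ∷ 0 ∷ 0 ∷ 1 ∷ 0 ∷ 1 ∷ 0 ∷ 4 ∷ 2 ∷ 16 ∷ [])) (false , false , false) (bits 0) (bits 68) (bits 622883) (bits 0) 7 9 ∷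
  state (map bits (0 ∷ 0 ∷ 0 ∷ 0 ∷ 0 ∷ 1 ∷ 0 ∷ 5 ∷ 0 ∷ 1 ∷ 2 ∷ 5 ∷ 2 ∷ 272 ∷ [])) (false , false , false) (bits 0) (bits 384) (bits 4817664) (bits 0) 6 9 ∷
  state (map bits (0 ∷ 0 ∷ 0 ∷ 0 ∷ 0 ∷ 0 ∷ 0 ∷ 1 ∷ 0 ∷ 0 ∷ 0 ∷ 1 ∷ 2 ∷ 0 ∷ [])) (false , false , false) (bits 0) (bits 416) (bits 525424) (bits 0) 6 9 ∷
  state (map bits (0 ∷ 0 ∷ 0 ∷ 0 ∷ 0 ∷ 1 ∷ 1 ∷ 4 ∷ 1 ∷ 1 ∷ 6 ∷ 4 ∷ 16 ∷ 280 ∷ [])) (false , false , false) (bits 100452) (bits 32) (bits 4294512) (bits 2148) 6 8 ∷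
  state (map bits (0 ∷ 0 ∷ 0 ∷ 0 ∷ 0 ∷ 0 ∷ 0 ∷ 3 ∷ 0 ∷ 2 ∷ 1 ∷ 9 ∷ 7 ∷ 32 ∷ [])) (false , false , false) (bits 2048) (bits 416) (bits 525424) (bits 100736) 6 8 ∷
  state (map bits (0 ∷ 0 ∷ 0 ∷ 0 ∷ 0 ∷ 0 ∷ 0 ∷ 2 ∷ 0 ∷ 1 ∷ 0 ∷ 7 ∷ 5 ∷ 18 ∷ [])) (false , false , false) (bits 525156) (bits 484) (bits 99667) (bits 526016) 5 8 ∷
  state (map bits (0 ∷ 0 ∷ 0 ∷ 1 ∷ 0 ∷ 1 ∷ 2 ∷ 16 ∷ 0 ∷ 4 ∷ 0 ∷ 272 ∷ 10 ∷ 340 ∷ [])) (false , false , false) (bits 0) (bits 1152) (bits 41943040) (bits 0) 5 7 ∷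
  state (map bits (0 ∷ 0 ∷ 0 ∷ 0 ∷ 0 ∷ 1 ∷ 3 ∷ 0 ∷ 0 ∷ 0 ∷ 0 ∷ 0 ∷ 8 ∷ 280 ∷ [])) (false , false , false) (bits 3080) (bits 1120) (bits 8916992) (bits 2152) 5 7 ∷
  state (map bits (0 ∷ 0 ∷ 0 ∷ 0 ∷ 0 ∷ 1 ∷ 0 ∷ 1 ∷ 0 ∷ 4 ∷ 0 ∷ 16 ∷ 8 ∷ 320 ∷ [])) (false , false , false) (bits 0) (bits 2148) (bits 67338240) (bits 0) 5 7 ∷
  state (map bits (0 ∷ 0 ∷ 0 ∷ 0 ∷ 0 ∷ 0 ∷ 0 ∷ 7 ∷ 0 ∷ 0 ∷ 2 ∷ 2 ∷ 14 ∷ 0 ∷ [])) (false , false , false) (bits 524400) (bits 2060) (bits 12825600) (bits 525424) 5 7 ∷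
  state (map bits (0 ∷ 0 ∷ 1 ∷ 2 ∷ 0 ∷ 0 ∷ 16 ∷ 32 ∷ 4 ∷ 8 ∷ 272 ∷ 546 ∷ 64 ∷ 136 ∷ [])) (false , true , false) (bits 3670016) (bits 0) (bits 0) (bits 3145728) 5 6 ∷
  state (map bits (0 ∷ 0 ∷ 0 ∷ 0 ∷ 0 ∷ 2 ∷ 1 ∷ 8 ∷ 0 ∷ 0 ∷ 4 ∷ 0 ∷ 0 ∷ 522 ∷ [])) (false , false , false) (bits 35840) (bits 0) (bits 0) (bits 4196448) 4 6 ∷
  state (map bits (0 ∷ 0 ∷ 0 ∷ 1 ∷ 1 ∷ 0 ∷ 7 ∷ 22 ∷ 0 ∷ 5 ∷ 3 ∷ 284 ∷ 270 ∷ 76 ∷ [])) (false , false , false) (bits 4195328) (bits 1184) (bits 46237552) (bits 33984) 4 6 ∷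
  state (map bits (0 ∷ 0 ∷ 0 ∷ 1 ∷ 1 ∷ 2 ∷ 2 ∷ 18 ∷ 0 ∷ 7 ∷ 1 ∷ 276 ∷ 278 ∷ 582 ∷ [])) (false , false , false) (bits 8919828) (bits 3240) (bits 34223986) (bits 8985552) 4 6 ∷
  state (map bits (1 ∷ 2 ∷ 4 ∷ 9 ∷ 16 ∷ 33 ∷ 67 ∷ 149 ∷ 256 ∷ 518 ∷ 1030 ∷ 2320 ∷ 4096 ∷ 8572 ∷ [])) (false , false , true) (bits 17570928) (bits 3212) (bits 37991424) (bits 17669244) 4 6 ∷
  state (map bits (0 ∷ 0 ∷ 0 ∷ 0 ∷ 0 ∷ 1 ∷ 2 ∷ 1 ∷ 2 ∷ 4 ∷ 8 ∷ 16 ∷ 40 ∷ 336 ∷ [])) (false , false , false) (bits 0) (bits 98304) (bits 67108864) (bits 0) 4 5 ∷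
  state (map bits (0 ∷ 0 ∷ 0 ∷ 1 ∷ 0 ∷ 4 ∷ 2 ∷ 4 ∷ 2 ∷ 0 ∷ 2 ∷ 256 ∷ 40 ∷ 1040 ∷ [])) (false , false , false) (bits 0) (bits 65676) (bits 185827328) (bits 0) 3 5 ∷
  state (map bits (0 ∷ 1 ∷ 0 ∷ 5 ∷ 2 ∷ 17 ∷ 8 ∷ 81 ∷ 0 ∷ 256 ∷ 0 ∷ 1300 ∷ 522 ∷ 4356 ∷ [])) (true , false , false) (bits 0) (bits 540812) (bits 102694912) (bits 0) 3 5 ∷
  state (map bits (0 ∷ 0 ∷ 1 ∷ 2 ∷ 0 ∷ 0 ∷ 16 ∷ 32 ∷ 4 ∷ 8 ∷ 272 ∷ 546 ∷ 64 ∷ 136 ∷ [])) (false , false , false) (bits 33554432) (bits 0) (bits 0) (bits 34078720) 3 4 ∷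
  state (map bits (0 ∷ 0 ∷ 1 ∷ 0 ∷ 0 ∷ 0 ∷ 22 ∷ 8 ∷ 6 ∷ 2 ∷ 284 ∷ 10 ∷ 116 ∷ 16 ∷ [])) (false , false , false) (bits 46170900) (bits 100452) (bits 229376) (bits 13207408) 3 4 ∷
  state (map bits (0 ∷ 0 ∷ 0 ∷ 1 ∷ 0 ∷ 2 ∷ 0 ∷ 24 ∷ 6 ∷ 14 ∷ 28 ∷ 314 ∷ 102 ∷ 740 ∷ [])) (false , false , false) (bits 75538284) (bits 99468) (bits 34091603) (bits 79794944) 3 4 ∷
  state (map bits (0 ∷ 1 ∷ 0 ∷ 4 ∷ 2 ∷ 20 ∷ 8 ∷ 84 ∷ 0 ∷ 260 ∷ 10 ∷ 1028 ∷ 522 ∷ 5188 ∷ [])) (false , false , false) (bits 0) (bits 4751360) (bits 268435456) (bits 0) 2 3 ∷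
  state (map bits (0 ∷ 0 ∷ 1 ∷ 1 ∷ 2 ∷ 4 ∷ 28 ∷ 12 ∷ 4 ∷ 6 ∷ 286 ∷ 266 ∷ 606 ∷ 1088 ∷ [])) (false , false , false) (bits 46170900) (bits 4229344) (bits 260046848) (bits 13207408) 2 3 ∷
  state (map bits (0 ∷ 0 ∷ 2 ∷ 6 ∷ 2 ∷ 2 ∷ 42 ∷ 110 ∷ 12 ∷ 18 ∷ 566 ∷ 1628 ∷ 716 ∷ 808 ∷ [])) (false , false , false) (bits 75534108) (bits 37749760) (bits 877364819) (bits 113346416) 1 1 ∷
  state (map bits (1 ∷ 2 ∷ 6 ∷ 14 ∷ 18 ∷ 34 ∷ 106 ∷ 234 ∷ 264 ∷ 542 ∷ 1568 ∷ 3686 ∷ 4738 ∷ 9194 ∷ [])) (false , false , false) (bits 402653184) (bits 37751808) (bits 805306368) (bits 440467564) 0 0 ∷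
  state (map bits (1 ∷ 0 ∷ 6 ∷ 6 ∷ 20 ∷ 8 ∷ 114 ∷ 72 ∷ 268 ∷ 24 ∷ 1568 ∷ 1606 ∷ 5332 ∷ 2434 ∷ [])) (false , false , false) (bits 281580308) (bits 33557512) (bits 881852416) (bits 243832604) 0 0 ∷
  state (map bits (0 ∷ 0 ∷ 1 ∷ 2 ∷ 0 ∷ 0 ∷ 16 ∷ 32 ∷ 4 ∷ 8 ∷ 272 ∷ 546 ∷ 64 ∷ 136 ∷ [])) (false , true , false) (bits 3670016) (bits 0) (bits 0) (bits 3145728) 5 6 ∷
  state (map bits (0 ∷ 0 ∷ 1 ∷ 2 ∷ 0 ∷ 0 ∷ 17 ∷ 34 ∷ 4 ∷ 8 ∷ 273 ∷ 546 ∷ 68 ∷ 128 ∷ [])) (false , true , false) (bits 3671040) (bits 0) (bits 0) (bits 3146784) 5 6 ∷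
  []

-- Some windows occur both with and without a symbol. Without it, T 7 on the first module lowers
-- `deg₀` only by 2, the weight of a; once the lowering operator is subtracted, the certified drop
-- is 4.
states₇-ok : Check.states-ok 7 m₇ states₇ ≡ true
states₇-ok = refl

states₁₃-ok : Check.states-ok 13 m₁₃ states₁₃ ≡ true
states₁₃-ok = refl

module C₇ = Certificate 7 m₇ (Maybe.from-just (all-bounded 7 m₇)) states₇ states₇-ok
module C₁₃ = Certificate 13 m₁₃ (Maybe.from-just (all-bounded 13 m₁₃)) states₁₃ states₁₃-ok

-- Adapted bases

infix 4 _≈ᵖ_
record _≈ᵖ_ (p p′ : Poly) : Set where
  constructor mkᵖ
  field unᵖ : co p ≃ co p′
open _≈ᵖ_ public

reflᵖ : ∀ {p} → p ≈ᵖ p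
reflᵖ = mkᵖ R.refl

symᵖ : ∀ {p p′} → p ≈ᵖ p′ → p′ ≈ᵖ p
symᵖ (mkᵖ e) = mkᵖ (R.sym e)

transᵖ : ∀ {p p′ p″} → p ≈ᵖ p′ → p′ ≈ᵖ p″ → p ≈ᵖ p″
transᵖ (mkᵖ e) (mkᵖ e′) = mkᵖ (R.trans e e′)

infixl 6 _∔_

-- Opaque, since otherwise unification inverts the addition, at great cost.
opaque
  _∔_ : Poly → Poly → Poly
  _∔_ = _+ᵖ_

  ∔≡+ᵖ : ∀ p s → p ∔ s ≡ p +ᵖ s
  ∔≡+ᵖ p s = refl

  co-∔ : ∀ p s → co (p ∔ s) ≃ co p ⊞ co s
  co-∔ = co-add

∔-cong : ∀ {p p′ s s′} → p ≈ᵖ p′ → s ≈ᵖ s′ → p ∔ s ≈ᵖ p′ ∔ s′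
∔-cong {p} {p′} {s} {s′} (mkᵖ e) (mkᵖ e′) = mkᵖ (R.trans (co-∔ p s) (R.trans (R.+-cong e e′) (R.sym (co-∔ p′ s′))))

∔-interchange : ∀ a b c d → (a ∔ b) ∔ (c ∔ d) ≈ᵖ (a ∔ c) ∔ (b ∔ d)
∔-interchange a b c d = mkᵖ (R.trans (R.trans (co-∔ (a ∔ b) (c ∔ d)) (R.+-cong (co-∔ a b) (co-∔ c d)))
  (R.trans (+-interchange (co a) (co b) (co c) (co d)) (R.sym (R.trans (co-∔ (a ∔ c) (b ∔ d)) (R.+-cong (co-∔ a c) (co-∔ b d))))))

∔-comm : ∀ a b → a ∔ b ≈ᵖ b ∔ a
∔-comm a b = mkᵖ (R.trans (co-∔ a b) (R.trans (R.+-comm (co a) (co b)) (R.sym (co-∔ b a))))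

∔-assoc : ∀ a b c → (a ∔ b) ∔ c ≈ᵖ a ∔ (b ∔ c)
∔-assoc a b c = mkᵖ (R.trans (R.trans (co-∔ (a ∔ b) c) (R.+-congʳ (co-∔ a b))) (R.trans (R.+-assoc (co a) (co b) (co c))
  (R.sym (R.trans (co-∔ a (b ∔ c)) (R.+-congˡ (co-∔ b c))))))

∔-self : ∀ a → a ∔ a ≈ᵖ []
∔-self a = mkᵖ (R.trans (co-∔ a a) (+-self (co a)))

∔-identityʳ : ∀ a → a ∔ [] ≈ᵖ a
∔-identityʳ a = mkᵖ (R.trans (co-∔ a []) (R.+-identityʳ (co a)))

∔-identityˡ : ∀ a → [] ∔ a ≈ᵖ a
∔-identityˡ a = mkᵖ (R.trans (co-∔ [] a) (R.+-identityˡ (co a)))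

∔-cancel : ∀ a b → a ∔ (a ∔ b) ≈ᵖ b
∔-cancel a b = transᵖ (symᵖ (∔-assoc a a b)) (transᵖ (∔-cong (∔-self a) reflᵖ) (∔-identityˡ b))

≈ᵖ⇒∔-zero : ∀ {a b} → a ≈ᵖ b → a ∔ b ≈ᵖ []
≈ᵖ⇒∔-zero {a} {b} e = transᵖ (∔-cong e reflᵖ) (∔-self b)

∔-zero⇒≈ᵖ : ∀ {a b} → a ∔ b ≈ᵖ [] → a ≈ᵖ b
∔-zero⇒≈ᵖ {a} {b} (mkᵖ e) = mkᵖ (⊞-zero⇒≃ (R.trans (R.sym (co-∔ a b)) e))

∔-congˡ : ∀ a {b b′} → b ≈ᵖ b′ → a ∔ b ≈ᵖ a ∔ b′
∔-congˡ a e = ∔-cong (reflᵖ {a}) e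

∔-congʳ : ∀ b {a a′} → a ≈ᵖ a′ → a ∔ b ≈ᵖ a′ ∔ b
∔-congʳ b e = ∔-cong e (reflᵖ {b})

-- Additive operators, degrees, raising and lowering

mono : ℕ → Poly
mono n = shift n (true ∷ [])

co-mono : ∀ m n → co (mono m) n ≡ (m ≡ᵇ n)
co-mono zero zero = refl
co-mono zero (suc n) = refl
co-mono (suc m) zero = refl
co-mono (suc m) (suc n) = co-mono m n

linear : (ℕ → Poly) → Poly → Poly
linear h [] = []
linear h (false ∷ p) = linear (h ∘ suc) p
linear h (true ∷ p) = h 0 ∔ linear (h ∘ suc) p

linear-support : ∀ h p n′ → co (linear h p) n′ ≡ true → ∃[ n ] (co p n ≡ true × co (h n) n′ ≡ true)
linear-support h (false ∷ p) n′ e with linear-support (h ∘ suc) p n′ e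
... | n , a , b = suc n , a , b
linear-support h (true ∷ p) n′ e with co (h 0) n′ in h0
... | true = 0 , refl , h0
... | false with linear-support (h ∘ suc) p n′ (trans (cong (_xor co (linear (h ∘ suc) p) n′) (sym h0))
                  (trans (sym (trans (at (co-∔ (h 0) (linear (h ∘ suc) p)) n′) (⊞-at (co (h 0)) _ n′))) e))
... | n , a , b = suc n , a , b

linear-zero : ∀ h p → p ≈ᵖ [] → linear h p ≈ᵖ []
linear-zero h p (mkᵖ e) = mkᵖ (mk λ n → false-unless (co (linear h p) n) λ t → case linear-support h p n t of λ (m , a , _) → case trans (sym a) (at e m) of λ ())
  where
  false-unless : ∀ b → (b ≡ true → ⊥) → b ≡ false
  false-unless false _ = refl
  false-unless true f = ⊥-elim (f refl)

linear-+ᵖ : ∀ h p s → linear h (p +ᵖ s) ≈ᵖ linear h p ∔ linear h s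
linear-+ᵖ h [] s = symᵖ (∔-identityˡ (linear h s))
linear-+ᵖ h (c ∷ p) [] = symᵖ (∔-identityʳ _)
linear-+ᵖ h (false ∷ p) (false ∷ s) = linear-+ᵖ (h ∘ suc) p s
linear-+ᵖ h (true ∷ p) (false ∷ s) = transᵖ (∔-congˡ (h 0) (linear-+ᵖ (h ∘ suc) p s)) (symᵖ (∔-assoc (h 0) _ _))
linear-+ᵖ h (false ∷ p) (true ∷ s) = transᵖ (∔-congˡ (h 0) (linear-+ᵖ (h ∘ suc) p s))
  (transᵖ (symᵖ (∔-assoc (h 0) _ _)) (transᵖ (∔-congʳ _ (∔-comm (h 0) _)) (∔-assoc _ (h 0) _)))
linear-+ᵖ h (true ∷ p) (true ∷ s) = transᵖ (linear-+ᵖ (h ∘ suc) p s) (symᵖ (transᵖ (∔-interchange (h 0) _ (h 0) _)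
  (transᵖ (∔-congʳ _ (∔-self (h 0))) (∔-identityˡ _))))

opaque
  unfolding _∔_

  linear-∔ : ∀ h p s → linear h (p ∔ s) ≈ᵖ linear h p ∔ linear h s
  linear-∔ = linear-+ᵖ

record Additive (Φ : Poly → Poly) : Set where
  field
    +-hom : ∀ p s → Φ (p ∔ s) ≈ᵖ Φ p ∔ Φ s
    0-hom : ∀ p → p ≈ᵖ [] → Φ p ≈ᵖ []
  Φ-cong : ∀ {p s} → p ≈ᵖ s → Φ p ≈ᵖ Φ s
  Φ-cong {p} {s} e = ∔-zero⇒≈ᵖ (transᵖ (symᵖ (+-hom p s)) (0-hom (p ∔ s) (≈ᵖ⇒∔-zero e)))
open Additive public

linear-additive : ∀ h → Additive (linear h)
linear-additive h = record { +-hom = linear-∔ h ; 0-hom = linear-zero h }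

id-additive : Additive id
id-additive = record { +-hom = λ p s → reflᵖ ; 0-hom = λ p e → e }

∘-additive : ∀ {Φ Ψ} → Additive Φ → Additive Ψ → Additive (Φ ∘ Ψ)
∘-additive a b = record { +-hom = λ p s → transᵖ (Φ-cong a (+-hom b p s)) (+-hom a _ _) ; 0-hom = λ p e → 0-hom a _ (0-hom b p e) }

+-additive : ∀ {Φ Ψ} → Additive Φ → Additive Ψ → Additive (λ p → Φ p ∔ Ψ p)
+-additive {Φ} {Ψ} a b = record
  { +-hom = λ p s → transᵖ (∔-cong (+-hom a p s) (+-hom b p s)) (∔-interchange (Φ p) (Φ s) (Ψ p) (Ψ s))
  ; 0-hom = λ p e → transᵖ (∔-cong (0-hom a p e) (0-hom b p e)) (∔-identityˡ []) }

false∷-additive : Additive (false ∷_)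
false∷-additive = record
  { +-hom = λ p s → mkᵖ (mk λ { zero → sym (trans (at (co-∔ (false ∷ p) (false ∷ s)) 0) (⊞-at (co (false ∷ p)) _ 0))
                             ; (suc n) → trans (trans (at (co-∔ p s) n) (⊞-at (co p) (co s) n))
                                 (sym (trans (at (co-∔ (false ∷ p) (false ∷ s)) (suc n)) (⊞-at (co (false ∷ p)) _ (suc n)))) })
  ; 0-hom = λ p (mkᵖ e) → mkᵖ (mk λ { zero → refl ; (suc n) → at e n }) }

additive-linear : ∀ {Φ} → Additive Φ → ∀ p → Φ p ≈ᵖ linear (Φ ∘ mono) p
additive-linear a [] = 0-hom a [] reflᵖ
additive-linear a (false ∷ p) = additive-linear (∘-additive a false∷-additive) p
additive-linear {Φ} a (true ∷ p) = transᵖ (Φ-cong a (mkᵖ head-tail)) (transᵖ (+-hom a (mono 0) (false ∷ p))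
  (∔-congˡ (Φ (mono 0)) (additive-linear (∘-additive a false∷-additive) p)))
  where
  head-tail : co (true ∷ p) ≃ co (mono 0 ∔ (false ∷ p))
  head-tail = mk λ { zero → sym (trans (at (co-∔ (mono 0) (false ∷ p)) 0) (⊞-at (co (mono 0)) _ 0))
                   ; (suc n) → sym (trans (at (co-∔ (mono 0) (false ∷ p)) (suc n)) (⊞-at (co (mono 0)) _ (suc n))) }

linear-ext : ∀ {h h′} → (∀ n → h n ≈ᵖ h′ n) → ∀ p → linear h p ≈ᵖ linear h′ p
linear-ext e [] = reflᵖ
linear-ext e (false ∷ p) = linear-ext (e ∘ suc) p
linear-ext e (true ∷ p) = ∔-cong (e 0) (linear-ext (e ∘ suc) p)

additive-≈ : ∀ {Φ Ψ} → Additive Φ → Additive Ψ → (∀ n → Φ (mono n) ≈ᵖ Ψ (mono n)) → ∀ p → Φ p ≈ᵖ Ψ p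
additive-≈ a b e p = transᵖ (additive-linear a p) (transᵖ (linear-ext e p) (symᵖ (additive-linear b p)))

linear-mono : ∀ h n → linear h (mono n) ≈ᵖ h n
linear-mono h zero = ∔-identityʳ (h 0)
linear-mono h (suc n) = linear-mono (h ∘ suc) n

Below : ℕ → Poly → Set
Below d p = ∀ n → co p n ≡ true → deg₀ (code n) < d

Below-resp : ∀ {d p p′} → p ≈ᵖ p′ → Below d p → Below d p′
Below-resp (mkᵖ e) b n t = b n (trans (at e n) t)

Below-≤ : ∀ {d d′ p} → d ≤ d′ → Below d p → Below d′ p
Below-≤ h b n t = ℕₚ.<-≤-trans (b n t) h

Below-[] : ∀ d → Below d []
Below-[] d n ()

Below-0 : ∀ {p} → Below 0 p → p ≈ᵖ []
Below-0 {p} b = mkᵖ (mk λ n → go n (co p n) refl)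
  where
  go : ∀ n c → co p n ≡ c → c ≡ false
  go n false e = refl
  go n true e with () ← b n e

Below-+ : ∀ {d p s} → Below d p → Below d s → Below d (p ∔ s)
Below-+ {d} {p} {s} a b n t with co p n in e
... | true = a n e
... | false = b n (trans (cong (_xor co s n) (sym e)) (trans (sym (trans (at (co-∔ p s) n) (⊞-at (co p) (co s) n))) t))

Below-linear : ∀ {d h} δ → (∀ n n′ → co (h n) n′ ≡ true → deg₀ (code n′) + δ ≤ deg₀ (code n)) → ∀ {p} → Below d p → Below (d ∸ δ) (linear h p)
Below-linear {d} {h} δ low {p} b n′ t with linear-support h p n′ t
... | n , a , c = ℕₚ.m+n≤o⇒m≤o∸n (suc (deg₀ (code n′))) (ℕₚ.≤-trans (s≤s (low n n′ c)) (b n a))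

Below-raise : ∀ {d h} δ → (∀ n n′ → co (h n) n′ ≡ true → deg₀ (code n′) ≡ deg₀ (code n) + δ) → ∀ {p} → Below (d ∸ δ) p → Below d (linear h p)
Below-raise {d} {h} δ up {p} b n′ t with linear-support h p n′ t
... | n , a , c = subst (_< d) (sym (up n n′ c)) (lemma (deg₀ (code n)) (b n a))
  where
  lemma : ∀ m → m < d ∸ δ → m + δ < d
  lemma m h with ℕₚ.≤-total δ d
  ... | inj₁ δ≤d = ℕₚ.m≤o∸n⇒m+n≤o (suc m) δ≤d h
  ... | inj₂ d≤δ with () ← subst (m <_) (ℕₚ.m≤n⇒m∸n≡0 d≤δ) h

bounded-deg : ∀ p → ∃[ d ] Below d p
bounded-deg p = go p deg
  where
  deg = λ n → deg₀ (code n)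
  go : ∀ p (deg : ℕ → ℕ) → ∃[ d ] (∀ n → co p n ≡ true → deg n < d)
  go [] deg = 0 , λ n ()
  go (c ∷ p) deg with go p (deg ∘ suc)
  ... | d , b = suc (deg 0) + d , λ { zero t → ℕₚ.m≤m+n (suc (deg 0)) d ; (suc n) t → ℕₚ.≤-trans (b n t) (ℕₚ.m≤n+m d (suc (deg 0))) }

raiseA raiseB : ℕ → ℕ
raiseA n = idx (suc (proj₁ (code n)) , proj₂ (code n))
raiseB n = idx (proj₁ (code n) , suc (proj₂ (code n)))

lowerA′ lowerB′ : ℕ × ℕ → Poly
lowerA′ (zero , b) = []
lowerA′ (suc a , b) = mono (idx (a , b))
lowerB′ (a , zero) = []
lowerB′ (a , suc b) = mono (idx (a , b))

A A⁺ B B⁺ : Poly → Poly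
A = linear (lowerA′ ∘ code)
B = linear (lowerB′ ∘ code)
A⁺ = linear (mono ∘ raiseA)
B⁺ = linear (mono ∘ raiseB)

A-additive : Additive A
A-additive = linear-additive (lowerA′ ∘ code)

B-additive : Additive B
B-additive = linear-additive (lowerB′ ∘ code)

A⁺-additive : Additive A⁺
A⁺-additive = linear-additive (mono ∘ raiseA)

B⁺-additive : Additive B⁺
B⁺-additive = linear-additive (mono ∘ raiseB)

A-mono : ∀ n → A (mono n) ≈ᵖ lowerA′ (code n)
A-mono = linear-mono (lowerA′ ∘ code)

B-mono : ∀ n → B (mono n) ≈ᵖ lowerB′ (code n)
B-mono = linear-mono (lowerB′ ∘ code)

A⁺-mono : ∀ n → A⁺ (mono n) ≈ᵖ mono (raiseA n)
A⁺-mono = linear-mono (mono ∘ raiseA)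

B⁺-mono : ∀ n → B⁺ (mono n) ≈ᵖ mono (raiseB n)
B⁺-mono = linear-mono (mono ∘ raiseB)

≡⇒≈ᵖ : ∀ {p p′} → p ≡ p′ → p ≈ᵖ p′
≡⇒≈ᵖ refl = reflᵖ

A-idx : ∀ v → A (mono (idx v)) ≈ᵖ lowerA′ v
A-idx v = transᵖ (A-mono (idx v)) (≡⇒≈ᵖ (cong lowerA′ (code-idx v)))

B-idx : ∀ v → B (mono (idx v)) ≈ᵖ lowerB′ v
B-idx v = transᵖ (B-mono (idx v)) (≡⇒≈ᵖ (cong lowerB′ (code-idx v)))

A⁺-idx : ∀ a b → A⁺ (mono (idx (a , b))) ≈ᵖ mono (idx (suc a , b))
A⁺-idx a b = transᵖ (A⁺-mono (idx (a , b))) (≡⇒≈ᵖ (cong (λ (a , b) → mono (idx (suc a , b))) (code-idx (a , b))))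

B⁺-idx : ∀ a b → B⁺ (mono (idx (a , b))) ≈ᵖ mono (idx (a , suc b))
B⁺-idx a b = transᵖ (B⁺-mono (idx (a , b))) (≡⇒≈ᵖ (cong (λ (a , b) → mono (idx (a , suc b))) (code-idx (a , b))))

on-idx : ∀ {Φ Ψ} → Additive Φ → Additive Ψ → (∀ a b → Φ (mono (idx (a , b))) ≈ᵖ Ψ (mono (idx (a , b)))) → ∀ p → Φ p ≈ᵖ Ψ p
on-idx {Φ} {Ψ} α β e = additive-≈ α β λ n → subst (λ k → Φ (mono k) ≈ᵖ Ψ (mono k)) (idx-code n) (e (proj₁ (code n)) (proj₂ (code n)))

A-A⁺ : ∀ p → A (A⁺ p) ≈ᵖ p
A-A⁺ = on-idx (∘-additive A-additive A⁺-additive) id-additive λ a b → transᵖ (Φ-cong A-additive (A⁺-idx a b)) (A-idx (suc a , b))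

B-B⁺ : ∀ p → B (B⁺ p) ≈ᵖ p
B-B⁺ = on-idx (∘-additive B-additive B⁺-additive) id-additive λ a b → transᵖ (Φ-cong B-additive (B⁺-idx a b)) (B-idx (a , suc b))

A-B⁺ : ∀ p → A (B⁺ p) ≈ᵖ B⁺ (A p)
A-B⁺ = on-idx (∘-additive A-additive B⁺-additive) (∘-additive B⁺-additive A-additive) λ a b →
  transᵖ (Φ-cong A-additive (B⁺-idx a b)) (transᵖ (A-idx (a , suc b)) (transᵖ (lemma a b) (symᵖ (Φ-cong B⁺-additive (A-idx (a , b))))))
  where
  lemma : ∀ a b → lowerA′ (a , suc b) ≈ᵖ B⁺ (lowerA′ (a , b))
  lemma zero b = reflᵖ
  lemma (suc a) b = symᵖ (B⁺-idx a b)

B-A⁺ : ∀ p → B (A⁺ p) ≈ᵖ A⁺ (B p)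
B-A⁺ = on-idx (∘-additive B-additive A⁺-additive) (∘-additive A⁺-additive B-additive) λ a b →
  transᵖ (Φ-cong B-additive (A⁺-idx a b)) (transᵖ (B-idx (suc a , b)) (transᵖ (lemma a b) (symᵖ (Φ-cong A⁺-additive (B-idx (a , b))))))
  where
  lemma : ∀ a b → lowerB′ (suc a , b) ≈ᵖ A⁺ (lowerB′ (a , b))
  lemma a zero = reflᵖ
  lemma a (suc b) = symᵖ (A⁺-idx a b)

constᵖ : Poly → Poly
constᵖ p = co p 0 ∷ []

constᵖ-additive : Additive constᵖ
constᵖ-additive = record
  { +-hom = λ p s → mkᵖ (mk λ
      { zero → trans (trans (at (co-∔ p s) 0) (⊞-at (co p) (co s) 0)) (sym (trans (at (co-∔ (constᵖ p) (constᵖ s)) 0) (⊞-at (co (constᵖ p)) _ 0)))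
      ; (suc n) → sym (trans (at (co-∔ (constᵖ p) (constᵖ s)) (suc n)) (⊞-at (co (constᵖ p)) _ (suc n))) })
  ; 0-hom = λ p (mkᵖ e) → mkᵖ (mk λ { zero → at e 0 ; (suc n) → refl }) }

-- The part of p on monomials whose code has a = 0, which is the part that A annihilates.
rest : Poly → Poly
rest p = p ∔ A⁺ (A p)

rest-additive : Additive rest
rest-additive = +-additive id-additive (∘-additive A⁺-additive A-additive)

-- Monomials with a > 0 are recovered from A, those with a = 0 and b > 0 from B, and the only code
-- left is (0 , 0), that of y⁰.
decompose : ∀ p → p ≈ᵖ (A⁺ (A p) ∔ B⁺ (B (rest p))) ∔ constᵖ p
decompose = on-idx id-additive
  (+-additive (+-additive (∘-additive A⁺-additive A-additive) (∘-additive B⁺-additive (∘-additive B-additive rest-additive))) constᵖ-additive) step′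
  where
  const-idx : ∀ a b n → idx (a , b) ≡ suc n → constᵖ (mono (idx (a , b))) ≈ᵖ []
  const-idx a b n e rewrite e = mkᵖ (mk λ { zero → refl ; (suc n) → refl })
  nonzero : ∀ a b → (a ≡ 0 × b ≡ 0 → ⊥) → ∃[ n ] idx (a , b) ≡ suc n
  nonzero a b ne with idx (a , b) in e
  ... | suc n = n , refl
  ... | zero = ⊥-elim (ne (cong proj₁ v , cong proj₂ v))
    where
    v : (a , b) ≡ (0 , 0)
    v = trans (sym (code-idx (a , b))) (cong code e)
  A⁺A : ∀ a b → A⁺ (A (mono (idx (suc a , b)))) ≈ᵖ mono (idx (suc a , b))
  A⁺A a b = transᵖ (Φ-cong A⁺-additive (A-idx (suc a , b))) (A⁺-idx a b)
  A⁺A-0 : ∀ b → A⁺ (A (mono (idx (zero , b)))) ≈ᵖ []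
  A⁺A-0 b = Φ-cong A⁺-additive (A-idx (zero , b))
  rest-0 : ∀ b → rest (mono (idx (zero , b))) ≈ᵖ mono (idx (zero , b))
  rest-0 b = transᵖ (∔-cong (reflᵖ {mono (idx (zero , b))}) (A⁺A-0 b)) (∔-identityʳ (mono (idx (zero , b))))
  step′ : ∀ a b → let p = mono (idx (a , b)) in p ≈ᵖ (A⁺ (A p) ∔ B⁺ (B (rest p))) ∔ constᵖ p
  step′ (suc a) b = symᵖ (transᵖ (∔-cong (∔-cong (A⁺A a b) (0-hom (∘-additive B⁺-additive B-additive) (rest (mono (idx (suc a , b))))
      (transᵖ (∔-cong (reflᵖ {mono (idx (suc a , b))}) (A⁺A a b)) (∔-self (mono (idx (suc a , b))))))) (const-idx (suc a) b _ (proj₂ (nonzero (suc a) b λ { (() , _) }))))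
    (transᵖ (∔-identityʳ _) (∔-identityʳ _)))
  step′ zero (suc b) = symᵖ (transᵖ (∔-cong (∔-cong (A⁺A-0 (suc b)) (transᵖ (Φ-cong (∘-additive B⁺-additive B-additive) (rest-0 (suc b)))
      (transᵖ (Φ-cong B⁺-additive (B-idx (zero , suc b))) (B⁺-idx zero b)))) (const-idx zero (suc b) _ (proj₂ (nonzero zero (suc b) λ { (_ , ()) }))))
    (transᵖ (∔-identityʳ _) (∔-identityˡ _)))
  step′ zero zero = symᵖ (transᵖ (∔-cong (∔-cong (A⁺A-0 0) (transᵖ (Φ-cong (∘-additive B⁺-additive B-additive) (rest-0 0))
      (Φ-cong B⁺-additive (B-idx (zero , zero))))) reflᵖ) (transᵖ (∔-cong (∔-identityʳ []) reflᵖ) (∔-identityˡ (mono 0))))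

raiseA-deg : ∀ n → deg₀ (code (raiseA n)) ≡ deg₀ (code n) + 2
raiseA-deg n = trans (cong deg₀ (code-idx (suc (proj₁ (code n)) , proj₂ (code n)))) (lemma (proj₁ (code n)) (proj₂ (code n)))
  where
  lemma : ∀ a b → 2 * (1 + a) + 3 * b ≡ 2 * a + 3 * b + 2
  lemma = ℕ-Solver.solve-∀

raiseB-deg : ∀ n → deg₀ (code (raiseB n)) ≡ deg₀ (code n) + 3
raiseB-deg n = trans (cong deg₀ (code-idx (proj₁ (code n) , suc (proj₂ (code n))))) (lemma (proj₁ (code n)) (proj₂ (code n)))
  where
  lemma : ∀ a b → 2 * a + 3 * (1 + b) ≡ 2 * a + 3 * b + 3
  lemma = ℕ-Solver.solve-∀

co-mono-≡ : ∀ m n → co (mono m) n ≡ true → n ≡ m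
co-mono-≡ m n e = sym (ℕₚ.≡ᵇ⇒≡ m n (subst Data.Bool.T (sym (trans (sym (co-mono m n)) e)) tt))

Below-A⁺ : ∀ {d p} → Below (d ∸ 2) p → Below d (A⁺ p)
Below-A⁺ {p = p} = Below-raise 2 (λ n n′ e → trans (cong (deg₀ ∘ code) (co-mono-≡ (raiseA n) n′ e)) (raiseA-deg n)) {p}

Below-B⁺ : ∀ {d p} → Below (d ∸ 3) p → Below d (B⁺ p)
Below-B⁺ {p = p} = Below-raise 3 (λ n n′ e → trans (cong (deg₀ ∘ code) (co-mono-≡ (raiseB n) n′ e)) (raiseB-deg n)) {p}

lowerA-deg : ∀ n n′ → co (lowerA′ (code n)) n′ ≡ true → deg₀ (code n′) + 2 ≤ deg₀ (code n)
lowerA-deg n n′ e with code n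
... | suc a , b rewrite co-mono-≡ (idx (a , b)) n′ e | code-idx (a , b) = ℕₚ.≤-reflexive (lemma a b)
  where
  lemma : ∀ a b → 2 * a + 3 * b + 2 ≡ 2 * (1 + a) + 3 * b
  lemma = ℕ-Solver.solve-∀

lowerB-deg : ∀ n n′ → co (lowerB′ (code n)) n′ ≡ true → deg₀ (code n′) + 3 ≤ deg₀ (code n)
lowerB-deg n n′ e with code n
... | a , suc b rewrite co-mono-≡ (idx (a , b)) n′ e | code-idx (a , b) = ℕₚ.≤-reflexive (lemma a b)
  where
  lemma : ∀ a b → 2 * a + 3 * b + 3 ≡ 2 * a + 3 * (1 + b)
  lemma = ℕ-Solver.solve-∀

T⁺ : ∀ {b} → b ≡ true → Data.Bool.T b
T⁺ refl = tt

symI-refl : ∀ v → symI v v ≡ true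
symI-refl (a , b) = cong₂ _∧_ (≡ᵇ-refl a) (≡ᵇ-refl b)
  where
  ≡ᵇ-refl : ∀ n → (n ≡ᵇ n) ≡ true
  ≡ᵇ-refl zero = refl
  ≡ᵇ-refl (suc n) = ≡ᵇ-refl n

symI-≡ : ∀ v v′ → symI v v′ ≡ true → v ≡ v′
symI-≡ (a , b) (a′ , b′) e with ∧-split {a ≡ᵇ a′} e
... | p , q = cong₂ _,_ (ℕₚ.≡ᵇ⇒≡ a a′ (T⁺ p)) (ℕₚ.≡ᵇ⇒≡ b b′ (T⁺ q))

idx-≡ᵇ : ∀ v n → (idx v ≡ᵇ n) ≡ symI v (code n)
idx-≡ᵇ v n = iff (idx v ≡ᵇ n) (symI v (code n))
  (λ e → trans (cong (symI v) (trans (cong code (sym (ℕₚ.≡ᵇ⇒≡ (idx v) n (T⁺ e)))) (code-idx v))) (symI-refl v))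
  (λ e → T⁻ (ℕₚ.≡⇒≡ᵇ (idx v) n (trans (cong idx (symI-≡ v (code n) e)) (idx-code n))))
  where
  T⁻ : ∀ {b} → Data.Bool.T b → b ≡ true
  T⁻ {true} _ = refl
  iff : ∀ a b → (a ≡ true → b ≡ true) → (b ≡ true → a ≡ true) → a ≡ b
  iff true b f g = sym (f refl)
  iff false true f g = g refl
  iff false false f g = refl

co-lowerA : ∀ n n′ → co (lowerA′ (code n)) n′ ≡ symA (code n) (code n′)
co-lowerA n n′ with code n
... | zero , b = refl
... | suc a , b = trans (co-mono (idx (a , b)) n′) (idx-≡ᵇ (a , b) n′)

co-lowerB : ∀ n n′ → co (lowerB′ (code n)) n′ ≡ symB (code n) (code n′)
co-lowerB n n′ with code n
... | a , zero = sym (∧-zeroʳ _)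
... | a , suc b = trans (co-mono (idx (a , b)) n′) (idx-≡ᵇ (a , b) n′)

-- X and Y are perturbations of A and B by operators of strictly smaller degree.
module Adapted (Xr Yr : ℕ → Poly) (X-0 : Xr 0 ≈ᵖ []) (Y-0 : Yr 0 ≈ᵖ [])
  (X-A : ∀ n n′ → co (Xr n) n′ xor symA (code n) (code n′) ≡ true → deg₀ (code n′) + 3 ≤ deg₀ (code n))
  (Y-B : ∀ n n′ → co (Yr n) n′ xor symB (code n) (code n′) ≡ true → deg₀ (code n′) + 4 ≤ deg₀ (code n))
  (XY-comm : ∀ n → linear Xr (Yr n) ≈ᵖ linear Yr (Xr n)) where

  X Y εX εY : Poly → Poly
  X = linear Xr
  Y = linear Yr
  εX = linear (λ n → Xr n ∔ lowerA′ (code n))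
  εY = linear (λ n → Yr n ∔ lowerB′ (code n))

  X-additive : Additive X
  X-additive = linear-additive Xr

  Y-additive : Additive Y
  Y-additive = linear-additive Yr

  XY : ∀ p → X (Y p) ≈ᵖ Y (X p)
  XY = additive-≈ (∘-additive X-additive Y-additive) (∘-additive Y-additive X-additive)
    λ n → transᵖ (Φ-cong X-additive (linear-mono Yr n)) (transᵖ (XY-comm n) (symᵖ (Φ-cong Y-additive (linear-mono Xr n))))

  X≈ : ∀ p → X p ≈ᵖ A p ∔ εX p
  X≈ = additive-≈ X-additive (+-additive A-additive (linear-additive _)) λ n → transᵖ (linear-mono Xr n)
    (symᵖ (transᵖ (∔-cong (A-mono n) (transᵖ (linear-mono _ n) (∔-comm (Xr n) (lowerA′ (code n))))) (∔-cancel (lowerA′ (code n)) (Xr n))))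

  Y≈ : ∀ p → Y p ≈ᵖ B p ∔ εY p
  Y≈ = additive-≈ Y-additive (+-additive B-additive (linear-additive _)) λ n → transᵖ (linear-mono Yr n)
    (symᵖ (transᵖ (∔-cong (B-mono n) (transᵖ (linear-mono _ n) (∔-comm (Yr n) (lowerB′ (code n))))) (∔-cancel (lowerB′ (code n)) (Yr n))))

  Below-εX : ∀ {d p} → Below d p → Below (d ∸ 3) (εX p)
  Below-εX {p = p} = Below-linear 3 (λ n n′ e → X-A n n′ (trans (cong (co (Xr n) n′ xor_) (sym (co-lowerA n n′)))
    (trans (sym (trans (at (co-∔ (Xr n) (lowerA′ (code n))) n′) (⊞-at (co (Xr n)) _ n′))) e))) {p}

  Below-εY : ∀ {d p} → Below d p → Below (d ∸ 4) (εY p)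
  Below-εY {p = p} = Below-linear 4 (λ n n′ e → Y-B n n′ (trans (cong (co (Yr n) n′ xor_) (sym (co-lowerB n n′)))
    (trans (sym (trans (at (co-∔ (Yr n) (lowerB′ (code n))) n′) (⊞-at (co (Yr n)) _ n′))) e))) {p}

  Below-A : ∀ {d p} → Below d p → Below (d ∸ 2) (A p)
  Below-A {p = p} = Below-linear 2 lowerA-deg {p}

  Below-B : ∀ {d p} → Below d p → Below (d ∸ 3) (B p)
  Below-B {p = p} = Below-linear 3 lowerB-deg {p}

  Below-X : ∀ {d p} → Below d p → Below (d ∸ 2) (X p)
  Below-X {d} {p} b = Below-resp (symᵖ (X≈ p)) (Below-+ {_} {A p} (Below-A {p = p} b) (Below-≤ {p = εX p} (ℕₚ.∸-monoʳ-≤ d (s≤s (s≤s z≤n))) (Below-εX {p = p} b)))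

  Below-Y : ∀ {d p} → Below d p → Below (d ∸ 3) (Y p)
  Below-Y {d} {p} b = Below-resp (symᵖ (Y≈ p)) (Below-+ {_} {B p} (Below-B {p = p} b) (Below-≤ {p = εY p} (ℕₚ.∸-monoʳ-≤ d (s≤s (s≤s (s≤s z≤n)))) (Below-εY {p = p} b)))

  -- A common preimage of f and g under A and B, up to lower terms.
  lift₀ : Poly → Poly → Poly
  lift₀ f g = A⁺ f ∔ B⁺ (rest g)

  -- The remaining errors f + X v and g + Y v have smaller degree, so the correction terminates.
  lift : ℕ → Poly → Poly → Poly
  lift zero f g = []
  lift (suc d) f g = lift₀ f g ∔ lift d (f ∔ X (lift₀ f g)) (g ∔ Y (lift₀ f g))

  Below-rest : ∀ {d g} → Below (d ∸ 3) g → Below (d ∸ 3) (rest g)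
  Below-rest {d} {g} b = Below-+ {_} {g} b (Below-A⁺ {p = A g} (Below-A {p = g} b))

  Below-lift₀ : ∀ {d f g} → Below (d ∸ 2) f → Below (d ∸ 3) g → Below d (lift₀ f g)
  Below-lift₀ {d} {f} {g} bf bg = Below-+ {_} {A⁺ f} (Below-A⁺ {p = f} bf) (Below-B⁺ {p = rest g} (Below-rest {d} {g} bg))

  A-rest : ∀ g → A (rest g) ≈ᵖ []
  A-rest g = transᵖ (+-hom A-additive g (A⁺ (A g))) (transᵖ (∔-cong reflᵖ (A-A⁺ (A g))) (∔-self (A g)))

  A-lift₀ : ∀ f g → A (lift₀ f g) ≈ᵖ f
  A-lift₀ f g = transᵖ (+-hom A-additive (A⁺ f) (B⁺ (rest g))) (transᵖ (∔-cong (A-A⁺ f)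
    (transᵖ (A-B⁺ (rest g)) (0-hom B⁺-additive _ (A-rest g)))) (∔-identityʳ f))

  -- The term besides g measures the failure of f and g to be compatible for A and B themselves.
  B-lift₀ : ∀ f g → B (lift₀ f g) ≈ᵖ g ∔ A⁺ (B f ∔ A g)
  B-lift₀ f g = transᵖ (+-hom B-additive (A⁺ f) (B⁺ (rest g))) (transᵖ (∔-cong (B-A⁺ f) (B-B⁺ (rest g)))
    (transᵖ (∔-comm (A⁺ (B f)) (rest g)) (transᵖ (∔-assoc g (A⁺ (A g)) (A⁺ (B f))) (∔-cong reflᵖ
      (transᵖ (∔-comm (A⁺ (A g)) (A⁺ (B f))) (symᵖ (+-hom A⁺-additive (B f) (A g))))))))

  error-X : ∀ f g → f ∔ X (lift₀ f g) ≈ᵖ εX (lift₀ f g)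
  error-X f g = transᵖ (∔-cong reflᵖ (transᵖ (X≈ (lift₀ f g)) (∔-cong (A-lift₀ f g) reflᵖ))) (∔-cancel f _)

  error-Y : ∀ f g → g ∔ Y (lift₀ f g) ≈ᵖ A⁺ (B f ∔ A g) ∔ εY (lift₀ f g)
  error-Y f g = transᵖ (∔-cong reflᵖ (transᵖ (Y≈ (lift₀ f g)) (transᵖ (∔-cong (B-lift₀ f g) reflᵖ) (∔-assoc g _ _)))) (∔-cancel g _)

  -- The condition Y f = X g makes the obstruction B f + A g equal to a sum of perturbation terms,
  -- hence of lower degree than B f or A g need be.
  compatible : ∀ f g → Y f ≈ᵖ X g → B f ∔ A g ≈ᵖ εY f ∔ εX g
  compatible f g e = ∔-zero⇒≈ᵖ (transᵖ (∔-interchange (B f) (A g) (εY f) (εX g))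
    (transᵖ (∔-cong (symᵖ (Y≈ f)) (symᵖ (X≈ g))) (≈ᵖ⇒∔-zero e)))

  record Lifted (d : ℕ) (f g v : Poly) : Set where
    field
      small : Below d v
      X-v : X v ≈ᵖ f
      Y-v : Y v ≈ᵖ g

  lift-correct : ∀ d f g → Below (d ∸ 2) f → Below (d ∸ 3) g → Y f ≈ᵖ X g → Lifted d f g (lift d f g)
  lift-correct zero f g bf bg e = record { small = Below-[] 0 ; X-v = symᵖ (Below-0 bf) ; Y-v = symᵖ (Below-0 bg) }
  lift-correct (suc d) f g bf bg e = record
    { small = Below-+ {_} {v₀} b₀ (Below-≤ {p = lift d f′ g′} (ℕₚ.n≤1+n d) (Lifted.small ih))
    ; X-v = transᵖ (+-hom X-additive v₀ _) (transᵖ (∔-cong reflᵖ (Lifted.X-v ih)) (transᵖ (∔-cong reflᵖ (∔-comm f (X v₀))) (∔-cancel (X v₀) f)))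
    ; Y-v = transᵖ (+-hom Y-additive v₀ _) (transᵖ (∔-cong reflᵖ (Lifted.Y-v ih)) (transᵖ (∔-cong reflᵖ (∔-comm g (Y v₀))) (∔-cancel (Y v₀) g))) }
    where
    v₀ = lift₀ f g
    f′ = f ∔ X v₀
    g′ = g ∔ Y v₀
    b₀ : Below (suc d) v₀
    b₀ = Below-lift₀ {suc d} {f} {g} bf bg
    bf′ : Below (d ∸ 2) f′
    bf′ = Below-resp (symᵖ (error-X f g)) (Below-εX {p = v₀} b₀)
    -- Starting from the bounds d - 1 for f and d - 2 for g, the perturbations take off 4 and 3, so
    -- both terms lie below d - 5. Raising by `A⁺` adds 2, which gives the bound d - 3 needed for
    -- the new g.
    lower : Below (d ∸ 3 ∸ 2) (B f ∔ A g)
    lower = Below-resp (symᵖ (compatible f g e)) (Below-+ {_} {εY f}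
      (Below-≤ {p = εY f} (ℕₚ.≤-reflexive (trans (ℕₚ.∸-+-assoc (suc d) 2 4) (sym (ℕₚ.∸-+-assoc d 3 2)))) (Below-εY {p = f} bf))
      (Below-≤ {p = εX g} (ℕₚ.≤-reflexive (trans (ℕₚ.∸-+-assoc (suc d) 3 3) (sym (ℕₚ.∸-+-assoc d 3 2)))) (Below-εX {p = g} bg)))
    bg′ : Below (d ∸ 3) g′
    bg′ = Below-resp (symᵖ (error-Y f g)) (Below-+ {_} {A⁺ (B f ∔ A g)} (Below-A⁺ {p = B f ∔ A g} lower) (Below-εY {p = v₀} b₀))
    e′ : Y f′ ≈ᵖ X g′
    e′ = transᵖ (+-hom Y-additive f (X v₀)) (transᵖ (∔-cong e (symᵖ (XY v₀))) (symᵖ (+-hom X-additive g (Y v₀))))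
    ih = lift-correct d f′ g′ bf′ bg′ e′

  -- X and Y annihilate constants, so the constant term of a preimage is free. Setting it to 0 in
  -- every cell except the first makes the cells dual to the probes used for independence.
  clear : Poly → Poly
  clear p = p ∔ constᵖ p

  X-const : ∀ p → X (constᵖ p) ≈ᵖ []
  X-const p = go (co p 0)
    where
    go : ∀ c → X (c ∷ []) ≈ᵖ []
    go false = reflᵖ
    go true = transᵖ (∔-identityʳ (Xr 0)) X-0

  Y-const : ∀ p → Y (constᵖ p) ≈ᵖ []
  Y-const p = go (co p 0)
    where
    go : ∀ c → Y (c ∷ []) ≈ᵖ []
    go false = reflᵖ
    go true = transᵖ (∔-identityʳ (Yr 0)) Y-0

  X-clear : ∀ p → X (clear p) ≈ᵖ X p
  X-clear p = transᵖ (+-hom X-additive p (constᵖ p)) (transᵖ (∔-cong reflᵖ (X-const p)) (∔-identityʳ (X p)))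

  Y-clear : ∀ p → Y (clear p) ≈ᵖ Y p
  Y-clear p = transᵖ (+-hom Y-additive p (constᵖ p)) (transᵖ (∔-cong reflᵖ (Y-const p)) (∔-identityʳ (Y p)))

  clear-0 : ∀ p → co (clear p) 0 ≡ false
  clear-0 p = trans (at (co-∔ p (constᵖ p)) 0) (trans (⊞-at (co p) _ 0) (xor-same (co p 0)))

  Below-const : ∀ {d p} → Below d p → Below d (constᵖ p)
  Below-const b zero t = b zero t

  Below-clear : ∀ {d p} → Below d p → Below d (clear p)
  Below-clear {d} {p} b = Below-+ {_} {p} b (Below-const {d} {p} b)

  bound : ℕ → ℕ → ℕ
  bound i j = suc (2 * i + 3 * j)

  cell left down : ℕ → ℕ → Poly
  cell zero zero = mono 0
  cell zero (suc j) = clear (lift (bound zero (suc j)) [] (cell zero j))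
  cell (suc i) zero = clear (lift (bound (suc i) zero) (cell i zero) [])
  cell (suc i) (suc j) = clear (lift (bound (suc i) (suc j)) (cell i (suc j)) (cell (suc i) j))
  left zero j = []
  left (suc i) j = cell i j
  down i zero = []
  down i (suc j) = cell i j

  record IsCell (i j : ℕ) : Set where
    field
      small : Below (bound i j) (cell i j)
      X-cell : X (cell i j) ≈ᵖ left i j
      Y-cell : Y (cell i j) ≈ᵖ down i j

  cleared : ∀ {d f g v} → Lifted d f g v → Lifted d f g (clear v)
  cleared {v = v} l = record
    { small = Below-clear {p = v} (Lifted.small l) ; X-v = transᵖ (X-clear v) (Lifted.X-v l) ; Y-v = transᵖ (Y-clear v) (Lifted.Y-v l) }

  bound-left : ∀ i j → bound i j ≡ bound (suc i) j ∸ 2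
  bound-left i j = cong (_∸ 1) (lemma i j)
    where
    lemma : ∀ i j → 2 + (2 * i + 3 * j) ≡ 2 * (1 + i) + 3 * j
    lemma = ℕ-Solver.solve-∀

  bound-down : ∀ i j → bound i j ≡ bound i (suc j) ∸ 3
  bound-down i j = cong (_∸ 2) (lemma i j)
    where
    lemma : ∀ i j → 3 + (2 * i + 3 * j) ≡ 2 * i + 3 * (1 + j)
    lemma = ℕ-Solver.solve-∀

  fromLifted : ∀ {i j d} → d ≡ bound i j → Lifted d (left i j) (down i j) (cell i j) → IsCell i j
  fromLifted {i} {j} refl l = record { small = Lifted.small l ; X-cell = Lifted.X-v l ; Y-cell = Lifted.Y-v l }

  cell-down : ∀ j → IsCell zero j → IsCell zero (suc j)
  cell-down j c = fromLifted refl (cleared (lift-correct (bound zero (suc j)) [] (cell zero j) (Below-[] _)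
    (subst (λ d → Below d (cell zero j)) (bound-down zero j) (IsCell.small c)) (symᵖ (IsCell.X-cell c))))

  cell-right : ∀ i → IsCell i zero → IsCell (suc i) zero
  cell-right i c = fromLifted refl (cleared (lift-correct (bound (suc i) zero) (cell i zero) []
    (subst (λ d → Below d (cell i zero)) (bound-left i zero) (IsCell.small c)) (Below-[] _) (IsCell.Y-cell c)))

  cell-corner : ∀ i j → IsCell i (suc j) → IsCell (suc i) j → IsCell (suc i) (suc j)
  cell-corner i j c c′ = fromLifted refl (cleared (lift-correct (bound (suc i) (suc j)) (cell i (suc j)) (cell (suc i) j)
    (subst (λ d → Below d (cell i (suc j))) (bound-left i (suc j)) (IsCell.small c))
    (subst (λ d → Below d (cell (suc i) j)) (bound-down (suc i) j) (IsCell.small c′))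
    (transᵖ (IsCell.Y-cell c) (symᵖ (IsCell.X-cell c′)))))

  isCell : ∀ i j → IsCell i j
  isCell zero zero = record { small = λ { zero t → s≤s z≤n ; (suc n) () } ; X-cell = transᵖ (linear-mono Xr 0) X-0 ; Y-cell = transᵖ (linear-mono Yr 0) Y-0 }
  isCell zero (suc j) = cell-down j (isCell zero j)
  isCell (suc i) zero = cell-right i (isCell i zero)
  isCell (suc i) (suc j) = cell-corner i j (isCell i (suc j)) (isCell (suc i) j)

  X-cell : ∀ i j → X (cell i j) ≈ᵖ left i j
  X-cell i j = IsCell.X-cell (isCell i j)

  Y-cell : ∀ i j → Y (cell i j) ≈ᵖ down i j
  Y-cell i j = IsCell.Y-cell (isCell i j)

  -- Independence and spanning of the cells

  sumCells : List (ℕ × ℕ) → Poly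
  sumCells [] = []
  sumCells ((i , j) ∷ l) = cell i j ∔ sumCells l

  -- The coefficient of X^a Y^b p at y⁰; on cells it is dual to the index.
  probeX probe : ℕ → ℕ → Poly → Bool
  probeX zero b p = co p 0
  probeX (suc a) b p = probeX a b (X p)
  probe a zero p = probeX a zero p
  probe a (suc b) p = probe a b (Y p)

  probeX-+ : ∀ a b p s → probeX a b (p ∔ s) ≡ probeX a b p xor probeX a b s
  probeX-0 : ∀ a b {p} → p ≈ᵖ [] → probeX a b p ≡ false
  probeX-0 zero b (mkᵖ e) = at e 0
  probeX-0 (suc a) b {p} e = probeX-0 a b (0-hom X-additive p e)
  probeX-≈ : ∀ a b {p s} → p ≈ᵖ s → probeX a b p ≡ probeX a b s
  probeX-≈ zero b (mkᵖ e) = at e 0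
  probeX-≈ (suc a) b e = probeX-≈ a b (Φ-cong X-additive e)
  probeX-+ zero b p s = trans (at (co-∔ p s) 0) (⊞-at (co p) (co s) 0)
  probeX-+ (suc a) b p s = trans (probeX-≈ a b (+-hom X-additive p s)) (probeX-+ a b (X p) (X s))

  probe-≈ : ∀ a b {p s} → p ≈ᵖ s → probe a b p ≡ probe a b s
  probe-≈ a zero e = probeX-≈ a zero e
  probe-≈ a (suc b) e = probe-≈ a b (Φ-cong Y-additive e)

  probe-0 : ∀ a b {p} → p ≈ᵖ [] → probe a b p ≡ false
  probe-0 a zero e = probeX-0 a zero e
  probe-0 a (suc b) {p} e = probe-0 a b (0-hom Y-additive p e)

  probe-+ : ∀ a b p s → probe a b (p ∔ s) ≡ probe a b p xor probe a b s
  probe-+ a zero p s = probeX-+ a zero p s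
  probe-+ a (suc b) p s = trans (probe-≈ a b (+-hom Y-additive p s)) (probe-+ a b (Y p) (Y s))

  cell-0 : ∀ i j → co (cell i j) 0 ≡ symI (0 , 0) (i , j)
  cell-0 zero zero = refl
  cell-0 zero (suc j) = clear-0 (lift (bound zero (suc j)) [] (cell zero j))
  cell-0 (suc i) zero = clear-0 (lift (bound (suc i) zero) (cell i zero) [])
  cell-0 (suc i) (suc j) = clear-0 (lift (bound (suc i) (suc j)) (cell i (suc j)) (cell (suc i) j))

  probeX-cell : ∀ a i j → probeX a zero (cell i j) ≡ symI (a , 0) (i , j)
  probeX-cell zero i j = cell-0 i j
  probeX-cell (suc a) zero j = probeX-0 a zero (X-cell zero j)
  probeX-cell (suc a) (suc i) j = trans (probeX-≈ a zero (X-cell (suc i) j)) (probeX-cell a i j)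

  probe-cell : ∀ a b i j → probe a b (cell i j) ≡ symI (a , b) (i , j)
  probe-cell a zero i j = probeX-cell a i j
  probe-cell a (suc b) i zero = trans (probe-0 a b (Y-cell i zero)) (sym (∧-zeroʳ (a ≡ᵇ i)))
  probe-cell a (suc b) i (suc j) = trans (probe-≈ a b (Y-cell i (suc j))) (probe-cell a b i j)

  symI-off : ∀ {v v′} → v ≢ v′ → symI v v′ ≡ false
  symI-off {v} {v′} ne with symI v v′ in eq
  ... | false = refl
  ... | true = ⊥-elim (ne (symI-≡ v v′ eq))

  probe-others : ∀ a b l → All ((a , b) ≢_) l → probe a b (sumCells l) ≡ false
  probe-others a b [] [] = probe-0 a b reflᵖ
  probe-others a b ((i , j) ∷ l) (ne ∷ fr) = trans (probe-+ a b (cell i j) (sumCells l))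
    (cong₂ _xor_ (trans (probe-cell a b i j) (symI-off ne)) (probe-others a b l fr))

  independent : ∀ l → Unique l → sumCells l ≈ᵖ [] → l ≡ []
  independent [] u e = refl
  independent ((a , b) ∷ l) (fresh ∷ u) e with () ← trans (sym (probe-0 a b e)) (trans (probe-+ a b (cell a b) (sumCells l))
      (cong₂ _xor_ (trans (probe-cell a b a b) (symI-refl (a , b))) (probe-others a b l fresh)))

  Spanned : Poly → Set
  Spanned p = ∃[ l ] p ≈ᵖ sumCells l

  sumCells-++ : ∀ l l′ → sumCells (l ++ l′) ≈ᵖ sumCells l ∔ sumCells l′
  sumCells-++ [] l′ = symᵖ (∔-identityˡ (sumCells l′))
  sumCells-++ ((i , j) ∷ l) l′ = transᵖ (∔-cong (reflᵖ {cell i j}) (sumCells-++ l l′)) (symᵖ (∔-assoc (cell i j) (sumCells l) (sumCells l′)))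

  Spanned-+ : ∀ {p s} → Spanned p → Spanned s → Spanned (p ∔ s)
  Spanned-+ (l , e) (l′ , e′) = l ++ l′ , transᵖ (∔-cong e e′) (symᵖ (sumCells-++ l l′))

  Spanned-resp : ∀ {p s} → p ≈ᵖ s → Spanned p → Spanned s
  Spanned-resp e (l , e′) = l , transᵖ (symᵖ e) e′

  column : List ℕ → List (ℕ × ℕ)
  column = map (0 ,_)

  ColumnSpanned : Poly → Set
  ColumnSpanned p = ∃[ js ] p ≈ᵖ sumCells (column js)

  ColumnSpanned-+ : ∀ {p s} → ColumnSpanned p → ColumnSpanned s → ColumnSpanned (p ∔ s)
  ColumnSpanned-+ (l , e) (l′ , e′) = l ++ l′ , transᵖ (∔-cong e e′)
    (transᵖ (symᵖ (sumCells-++ (column l) (column l′))) (≡⇒≈ᵖ (cong sumCells (sym (Lₚ.map-++ (0 ,_) l l′)))))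

  ColumnSpanned-resp : ∀ {p s} → p ≈ᵖ s → ColumnSpanned p → ColumnSpanned s
  ColumnSpanned-resp e (l , e′) = l , transᵖ (symᵖ e) e′

  ColumnSpanned-const : ∀ p → ColumnSpanned (constᵖ p)
  ColumnSpanned-const p with co p 0
  ... | false = [] , mkᵖ (mk λ { zero → refl ; (suc n) → refl })
  ... | true = 0 ∷ [] , symᵖ (∔-identityʳ (mono 0))

  -- On the joint kernel A and B agree with their perturbations, so A h and B h have smaller degree
  -- than expected. By `decompose`, h is then a constant plus something of smaller degree, again in
  -- the joint kernel; hence h is a constant.
  span-joint-kernel : ∀ d h → Below d h → X h ≈ᵖ [] → Y h ≈ᵖ [] → ColumnSpanned h
  span-joint-kernel zero h b x y = [] , Below-0 b
  span-joint-kernel (suc d) h b x y = ColumnSpanned-resp (transᵖ (∔-assoc h (constᵖ h) (constᵖ h)) (transᵖ (∔-cong (reflᵖ {h}) (∔-self (constᵖ h))) (∔-identityʳ h)))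
    (ColumnSpanned-+ (span-joint-kernel d (clear h) b′ (transᵖ (X-clear h) x) (transᵖ (Y-clear h) y)) (ColumnSpanned-const h))
    where
    A≈ : A h ≈ᵖ εX h
    A≈ = ∔-zero⇒≈ᵖ (transᵖ (symᵖ (X≈ h)) x)
    B≈ : B h ≈ᵖ εY h
    B≈ = ∔-zero⇒≈ᵖ (transᵖ (symᵖ (Y≈ h)) y)
    bA : Below d (A⁺ (A h))
    bA = Below-A⁺ {p = A h} (Below-resp (symᵖ A≈) (Below-εX {p = h} b))
    bB : Below (d ∸ 3) (B (rest h))
    bB = Below-resp (symᵖ (+-hom B-additive h (A⁺ (A h)))) (Below-+ {_} {B h} (Below-resp (symᵖ B≈) (Below-εY {p = h} b)) (Below-B {p = A⁺ (A h)} bA))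
    clear≈ : clear h ≈ᵖ A⁺ (A h) ∔ B⁺ (B (rest h))
    clear≈ = transᵖ (∔-cong (decompose h) (reflᵖ {constᵖ h})) (transᵖ (∔-assoc _ (constᵖ h) (constᵖ h))
      (transᵖ (∔-cong reflᵖ (∔-self (constᵖ h))) (∔-identityʳ _)))
    b′ : Below d (clear h)
    b′ = Below-resp (symᵖ clear≈) (Below-+ {_} {A⁺ (A h)} bA (Below-B⁺ {p = B (rest h)} bB))

  Y-column : ∀ l → Y (sumCells (column (map suc l))) ≈ᵖ sumCells (column l)
  Y-column [] = reflᵖ
  Y-column (j ∷ l) = transᵖ (+-hom Y-additive (cell 0 (suc j)) _) (∔-cong (Y-cell 0 (suc j)) (Y-column l))

  X-column : ∀ l → X (sumCells (column l)) ≈ᵖ []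
  X-column [] = reflᵖ
  X-column (j ∷ l) = transᵖ (+-hom X-additive (cell 0 j) _) (transᵖ (∔-cong (X-cell 0 j) (X-column l)) (∔-identityˡ []))

  X-shifted : ∀ l → X (sumCells (map (λ (i , j) → suc i , j) l)) ≈ᵖ sumCells l
  X-shifted [] = reflᵖ
  X-shifted ((i , j) ∷ l) = transᵖ (+-hom X-additive (cell (suc i) j) _) (∔-cong (X-cell (suc i) j) (X-shifted l))

  difference : ∀ {Φ} → Additive Φ → ∀ {f s} → Φ f ≈ᵖ Φ s → Φ (f ∔ s) ≈ᵖ []
  difference a {f} {s} e = transᵖ (+-hom a f s) (≈ᵖ⇒∔-zero e)

  add-back : ∀ f s → (f ∔ s) ∔ s ≈ᵖ f
  add-back f s = transᵖ (∔-assoc f s s) (transᵖ (∔-cong (reflᵖ {f}) (∔-self s)) (∔-identityʳ f))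

  -- Y preserves the kernel of X and lowers the degree. Once Y f is a sum of cells of column 0,
  -- moving each of them one place along the column gives an element with the same images as f under
  -- X and Y, and the difference lies in the joint kernel.
  span-kernel : ∀ d f → Below d f → X f ≈ᵖ [] → ColumnSpanned f
  span-kernel zero f b x = [] , Below-0 b
  span-kernel (suc d) f b x with span-kernel d (Y f) (Below-≤ {p = Y f} (ℕₚ.m∸n≤m d 2) (Below-Y {p = f} b)) (transᵖ (XY f) (0-hom Y-additive (X f) x))
  ... | js , e = ColumnSpanned-resp (add-back f s) (ColumnSpanned-+
      (span-joint-kernel (proj₁ (bounded-deg (f ∔ s))) (f ∔ s) (proj₂ (bounded-deg (f ∔ s)))
        (difference X-additive (transᵖ x (symᵖ (X-column (map suc js))))) (difference Y-additive (transᵖ e (symᵖ (Y-column js)))))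
      (map suc js , reflᵖ))
    where
    s = sumCells (column (map suc js))

  -- The same argument one level up: X f is a sum of cells, moving these along their rows gives an
  -- element with the same image under X, and the difference lies in the kernel of X.
  span : ∀ d f → Below d f → Spanned f
  span zero f b = [] , Below-0 b
  span (suc d) f b with span d (X f) (Below-≤ {p = X f} (ℕₚ.m∸n≤m d 1) (Below-X {p = f} b))
  ... | l , e with span-kernel (proj₁ (bounded-deg (f ∔ s))) (f ∔ s) (proj₂ (bounded-deg (f ∔ s))) (difference X-additive (transᵖ e (symᵖ (X-shifted l))))
    where
    s = sumCells (map (λ (i , j) → suc i , j) l)
  ... | js , e′ = Spanned-resp (add-back f s) (Spanned-+ (column js , e′) (map (λ (i , j) → suc i , j) l , reflᵖ))
    where
    s = sumCells (map (λ (i , j) → suc i , j) l)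

  spanned : ∀ f → Spanned f
  spanned f = span (proj₁ (bounded-deg f)) f (proj₂ (bounded-deg f))

-- The modules K1 / N1 and K5 / N1

opaque
  unfolding _⊞_

  ⊕≡⊞ : ∀ f g → f ⊕ g ≡ f ⊞ g
  ⊕≡⊞ f g = refl

  ⊛≡⊠ : ∀ f g → f ⊛ g ≡ f ⊠ g
  ⊛≡⊠ f g = refl

  y-low : y ≃ shN 6 (λ n → y (6 + n))
  y-low = mk λ { 0 → refl ; 1 → refl ; 2 → refl ; 3 → refl ; 4 → refl ; 5 → refl ; (suc (suc (suc (suc (suc (suc n)))))) → refl }

  y-6 : y 6 ≡ true
  y-6 = refl

  B₅-3 : B₅ 3 ≡ false
  B₅-3 = refl

  B₅-5 : B₅ 5 ≡ true
  B₅-5 = refl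

⊕≃⊞ : ∀ f g → f ⊕ g ≃ f ⊞ g
⊕≃⊞ f g = R.reflexive (⊕≡⊞ f g)

⊛≃⊠ : ∀ f g → f ⊛ g ≃ f ⊠ g
⊛≃⊠ f g = R.reflexive (⊛≡⊠ f g)

G²≃y : G² ≃ y
G²≃y = ⊛≃⊠ G G

B₅≃ : B₅ ≃ F ⊛ F ⊛ G
B₅≃ = R.sym (R.trans (⊛≃⊠ (F ⊛ F) G) (R.*-congʳ (⊛≃⊠ F F)))

evalPoly≃ev : ∀ p → evalPoly p G² ≃ ev p y
evalPoly≃ev [] = R.refl
evalPoly≃ev (c ∷ p) = R.trans (⊕≃⊞ (constPS c) (G² ⊛ evalPoly p G²))
  (R.+-congˡ (R.trans (⊛≃⊠ G² (evalPoly p G²)) (R.*-cong G²≃y (evalPoly≃ev p))))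

G-multiple : ∀ B p → B ⊛ evalPoly p G² ≃ B ⊠ ev p y
G-multiple B p = R.trans (⊛≃⊠ B (evalPoly p G²)) (R.*-congˡ (evalPoly≃ev p))

inN1⁺ : ∀ {f} ν → f ≃ G ⊠ ev ν y → inN1 f
inN1⁺ ν e = ν , at (R.trans e (R.sym (G-multiple G ν)))

inN1⁻ : ∀ {f} → inN1 f → ∃[ ν ] f ≃ G ⊠ ev ν y
inN1⁻ {f} (ν , e) = ν , R.trans {f} (mk e) (G-multiple G ν)

span≃ : ∀ B ν p → G ⊛ evalPoly ν G² ⊕ B ⊛ evalPoly p G² ≃ G ⊠ ev ν y ⊞ B ⊠ ev p y
span≃ B ν p = R.trans (⊕≃⊞ (G ⊛ evalPoly ν G²) (B ⊛ evalPoly p G²)) (R.+-cong (G-multiple G ν) (G-multiple B p))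

inSpan⁺ : ∀ {f} B ν p → f ≃ G ⊠ ev ν y ⊞ B ⊠ ev p y → f ≈ (G ⊛ evalPoly ν G² ⊕ B ⊛ evalPoly p G²)
inSpan⁺ B ν p e = at (R.trans e (R.sym (span≃ B ν p)))

inSpan⁻ : ∀ {f} B ν p → f ≈ (G ⊛ evalPoly ν G² ⊕ B ⊛ evalPoly p G²) → f ≃ G ⊠ ev ν y ⊞ B ⊠ ev p y
inSpan⁻ {f} B ν p e = R.trans {f} (mk e) (span≃ B ν p)

ev-∔ : ∀ p p′ s → ev (p ∔ p′) s ≃ ev p s ⊞ ev p′ s
ev-∔ p p′ s = R.trans (mk λ n → cong (λ f → ev f s n) (∔≡+ᵖ p p′)) (eval-add 1 (s ∷ []) p p′)

ev-zero : ∀ p s → p ≈ᵖ [] → ev p s ≃ zeroPS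
ev-zero [] s e = R.refl
ev-zero (c ∷ p) s (mkᵖ e) = R.trans (R.+-cong (R.trans (mk λ n → cong (λ b → constPS b n) (at e 0)) constPS-zero)
  (R.trans (R.*-congˡ (ev-zero p s (mkᵖ (mk λ n → at e (suc n))))) (R.zeroʳ s))) (R.+-identityˡ zeroPS)

ev-≈ᵖ : ∀ {p p′} s → p ≈ᵖ p′ → ev p s ≃ ev p′ s
ev-≈ᵖ {p} {p′} s e = ⊞-zero⇒≃ (R.trans (R.sym (ev-∔ p p′ s)) (ev-zero (p ∔ p′) s (≈ᵖ⇒∔-zero e)))

y-⊠-low : ∀ f n → n < 6 → (y ⊠ f) n ≡ false
y-⊠-low f n h = trans (at (R.trans (R.*-congʳ y-low) (shN-⊠ 6 _ f)) n) (shN-< 6 _ n h)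

-- Below degree 6 only the constant coefficients contribute to B p(y) + G ν(y).
module Free (B : PS) (j : ℕ) (j<6 : j < 6) (B-j : B j ≡ true) (triangular : B 3 ∧ G j ≡ false) where

  low : ∀ c e p ν n → n < 6 → (B ⊠ (constPS c ⊞ y ⊠ ev p y) ⊞ G ⊠ (constPS e ⊞ y ⊠ ev ν y)) n ≡ (c ∧ B n) xor (e ∧ G n)
  low c e p ν n h = begin
    (B ⊠ (constPS c ⊞ y ⊠ ev p y) ⊞ G ⊠ (constPS e ⊞ y ⊠ ev ν y)) n
      ≡⟨ at (ring (B ∷ constPS c ∷ y ∷ ev p y ∷ G ∷ constPS e ∷ ev ν y ∷ [])
           (:x :* (:y :+ :z :* :w) :+ :a :* (:b :+ :z :* :c)) ((:y :* :x :+ :b :* :a) :+ :z :* (:x :* :w :+ :a :* :c)) refl) n ⟩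
    ((constPS c ⊠ B ⊞ constPS e ⊠ G) ⊞ y ⊠ (B ⊠ ev p y ⊞ G ⊠ ev ν y)) n
      ≡⟨ trans (⊞-at _ _ n) (cong₂ _xor_ (⊞-at _ _ n) (y-⊠-low _ n h)) ⟩
    ((constPS c ⊠ B) n xor (constPS e ⊠ G) n) xor false
      ≡⟨ trans (xor-identityʳ _) (cong₂ _xor_ (at (constPS-⊠ c B) n) (at (constPS-⊠ e G) n)) ⟩
    (c ∧ B n) xor (e ∧ G n) ∎
    where
    open ≡-Reasoning
    :c : Expr 7
    :c = :var (suc (suc (suc (suc (suc (suc zero))))))

  solve-2×2 : ∀ c e b g → b ∧ g ≡ false → (c ∧ true) xor (e ∧ g) ≡ false → (c ∧ b) xor (e ∧ true) ≡ false → c ≡ false × e ≡ false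
  solve-2×2 false false b g _ _ _ = refl , refl
  solve-2×2 false true b g _ _ ()
  solve-2×2 true false b g _ () _
  solve-2×2 true true true true () _ _
  solve-2×2 true true true false _ () _
  solve-2×2 true true false g _ _ ()

  free′ : ∀ p ν → B ⊠ ev p y ⊞ G ⊠ ev ν y ≃ zeroPS → p ≈ᵖ []
  step-free : ∀ c e p ν → B ⊠ (constPS c ⊞ y ⊠ ev p y) ⊞ G ⊠ (constPS e ⊞ y ⊠ ev ν y) ≃ zeroPS → c ∷ p ≈ᵖ []
  step-free c e p ν eq = mkᵖ (mk λ { zero → c≡ ; (suc n) → at (unᵖ (free′ p ν (⊠-cancelʳ-zero 6 y y-6 reduced))) n })
    where
    both-zero : c ≡ false × e ≡ false
    -- The coefficients at `j` and at 3, the lowest exponent of G, give two equations for c and e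
    -- whose matrix is unitriangular in one order or the other.
    both-zero = solve-2×2 c e (B 3) (G j) triangular
      (trans (cong (λ b → (c ∧ b) xor (e ∧ G j)) (sym B-j)) (trans (sym (low c e p ν j j<6)) (at eq j)))
      (trans (sym (low c e p ν 3 (s≤s (s≤s (s≤s (s≤s z≤n)))))) (at eq 3))
    c≡ = proj₁ both-zero
    vanish : ∀ {b} → b ≡ false → constPS b ≃ zeroPS
    vanish refl = constPS-zero
    drop-const : ∀ {b f} → b ≡ false → constPS b ⊞ f ≃ f
    drop-const {f = f} h = R.trans (R.+-congʳ (vanish h)) (R.+-identityˡ f)
    reduced : (B ⊠ ev p y ⊞ G ⊠ ev ν y) ⊠ y ≃ zeroPS
    reduced = R.trans (ring (B ∷ ev p y ∷ G ∷ ev ν y ∷ y ∷ []) ((:x :* :y :+ :z :* :w) :* :a) (:x :* (:a :* :y) :+ :z :* (:a :* :w)) refl)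
      (R.trans (R.sym (R.+-cong (R.*-congˡ (drop-const c≡)) (R.*-congˡ (drop-const (proj₂ both-zero))))) eq)
  free′ [] ν eq = reflᵖ
  free′ (c ∷ p) (e ∷ ν) eq = step-free c e p ν eq
  free′ (c ∷ p) [] eq = step-free c false p [] (R.trans (R.+-congˡ (R.*-congˡ
    (R.trans (R.+-cong constPS-zero (R.zeroʳ y)) (R.+-identityˡ zeroPS)))) eq)

  free : ∀ p ν → B ⊠ ev p y ≃ G ⊠ ev ν y → p ≈ᵖ []
  free p ν e = free′ p ν (R.trans (R.+-congʳ e) (+-self _))

  Rep-unique : ∀ {f p p′} → Rep B f p → Rep B f p′ → p ≈ᵖ p′
  Rep-unique {f} {p} {p′} (rep ν e) (rep ν′ e′) = ∔-zero⇒≈ᵖ (free′ (p ∔ p′) (ν +ᵖ ν′)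
    (R.trans (R.+-cong (R.*-congˡ (ev-∔ p p′ y)) (R.*-congˡ (eval-add 1 (y ∷ []) ν ν′)))
    (R.trans (ring (B ∷ ev p y ∷ ev p′ y ∷ G ∷ ev ν y ∷ ev ν′ y ∷ []) (:x :* (:y :+ :z) :+ :w :* (:a :+ :b))
        ((:x :* :y :+ :w :* :a) :+ (:x :* :z :+ :w :* :b)) refl)
    (R.trans (R.+-cong (R.sym e) (R.sym e′)) (+-self f)))))

Rep-∔ : ∀ {B f g p p′} → Rep B f p → Rep B g p′ → Rep B (f ⊞ g) (p ∔ p′)
Rep-∔ {B} {f} {g} {p} {p′} a b = subst (Rep B (f ⊞ g)) (sym (∔≡+ᵖ p p′)) (Rep-⊞ a b)

module Linear (p : ℕ) .{{_ : NonZero p}} (B : PS) (Xr : ℕ → Poly) (action : ∀ n → Rep B (T p (B ⊠ y ^ n)) (Xr n)) where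

  T-linear-from : ∀ f n → Rep B (T p ((B ⊠ y ^ n) ⊠ ev f y)) (linear (λ k → Xr (n + k)) f)
  T-linear-from [] n = Rep-resp (R.sym (T-zero p (R.zeroʳ (B ⊠ y ^ n)))) Rep-zero
  T-linear-from (c ∷ f) n = Rep-resp (R.sym (R.trans
      (T-cong p (ring (B ∷ y ^ n ∷ constPS c ∷ y ∷ ev f y ∷ []) ((:x :* :y) :* (:z :+ :w :* :a)) (:z :* (:x :* :y) :+ (:x :* (:w :* :y)) :* :a) refl))
      (R.trans (T-⊞ p _ _) (R.+-congʳ (T-const p c (B ⊠ y ^ n)))))) (cases c)
    where
    linear-≡ : ∀ {h h′} f → (∀ k → h k ≡ h′ k) → linear h f ≡ linear h′ f
    linear-≡ [] e = refl
    linear-≡ (false ∷ f) e = linear-≡ f (e ∘ suc)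
    linear-≡ (true ∷ f) e = cong₂ _∔_ (e 0) (linear-≡ f (e ∘ suc))
    tail : Rep B (T p ((B ⊠ y ^ suc n) ⊠ ev f y)) (linear (λ k → Xr (n + suc k)) f)
    tail = subst (Rep B (T p ((B ⊠ y ^ suc n) ⊠ ev f y))) (linear-≡ f λ k → cong Xr (sym (ℕₚ.+-suc n k))) (T-linear-from f (suc n))
    cases : ∀ c → Rep B (constPS c ⊠ T p (B ⊠ y ^ n) ⊞ T p ((B ⊠ y ^ suc n) ⊠ ev f y)) (linear (λ k → Xr (n + k)) (c ∷ f))
    cases false = Rep-resp (R.sym (R.trans (R.+-congʳ (R.trans (R.*-congʳ constPS-zero) (R.zeroˡ _))) (R.+-identityˡ _))) tail
    cases true = Rep-∔ (
      (Rep-resp (R.sym (R.*-identityˡ _)) (subst (λ k → Rep B (T p (B ⊠ y ^ n)) (Xr k)) (sym (ℕₚ.+-identityʳ n)) (action n)))) tail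

  T-linear : ∀ f → Rep B (T p (B ⊠ ev f y)) (linear Xr f)
  T-linear f = Rep-resp (T-cong p (R.*-congʳ (R.*-identityʳ B))) (T-linear-from f 0)

init-G-7 init-G-13 : List Poly
init-G-7 = map bits (0 ∷ 0 ∷ 0 ∷ 1 ∷ 0 ∷ 0 ∷ 2 ∷ 16 ∷ [])
init-G-13 = map bits (0 ∷ 0 ∷ 1 ∷ 2 ∷ 0 ∷ 0 ∷ 17 ∷ 32 ∷ 4 ∷ 8 ∷ 272 ∷ 546 ∷ 64 ∷ 128 ∷ [])

zeros : ℕ → List Poly
zeros zero = []
zeros (suc n) = [] ∷ zeros n

module AG-7 = Action 7 7 m₇ (Maybe.from-just (all-bounded 7 m₇)) y-rec-7 (hecke l₇ w₇) T₇.T-poly G Gᵖ ev-G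
module AG-13 = Action 13 13 m₁₃ (Maybe.from-just (all-bounded 13 m₁₃)) y-rec-13 (hecke l₁₃ w₁₃) T₁₃.T-poly G Gᵖ ev-G

module L-7 = Linear 7 G (λ n → nth (iterate m₇ init-G-7 n) 0) (AG-7.action init-G-7 (zeros 8) refl refl refl)
module L-13 = Linear 13 G (λ n → nth (iterate m₁₃ init-G-13 n) 0) (AG-13.action init-G-13 (zeros 14) refl refl refl)

module Transfer (B : PS) (X Y : Poly → Poly)
  (T₇-X : ∀ p → Rep B (T 7 (B ⊠ ev p y)) (X p)) (T₁₃-Y : ∀ p → Rep B (T 13 (B ⊠ ev p y)) (Y p))
  (free : ∀ p ν → B ⊠ ev p y ≃ G ⊠ ev ν y → p ≈ᵖ [])
  (cell : ℕ → ℕ → Poly) (sumCells : List (ℕ × ℕ) → Poly)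
  (sumCells-[] : sumCells [] ≡ []) (sumCells-∷ : ∀ i j l → sumCells ((i , j) ∷ l) ≡ cell i j ∔ sumCells l)
  (cell-0-0 : cell 0 0 ≡ mono 0)
  (X-suc : ∀ i j → X (cell (suc i) j) ≈ᵖ cell i j) (X-zero : ∀ j → X (cell 0 j) ≈ᵖ [])
  (Y-suc : ∀ i j → Y (cell i (suc j)) ≈ᵖ cell i j) (Y-zero : ∀ i → Y (cell i 0) ≈ᵖ [])
  (independent : ∀ l → Unique l → sumCells l ≈ᵖ [] → l ≡ [])
  (spanned : ∀ p → ∃[ l ] p ≈ᵖ sumCells l) where

  m : ℕ → ℕ → PS
  m i j = B ⊠ ev (cell i j) y

  ⟦_⟧ : Poly → PS
  ⟦ p ⟧ = B ⊠ ev p y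

  ⟦⟧-cong : ∀ {p p′} → p ≈ᵖ p′ → ⟦ p ⟧ ≃ ⟦ p′ ⟧
  ⟦⟧-cong e = R.*-congˡ (ev-≈ᵖ y e)

  ⟦⟧-zero : ∀ {p} → p ≈ᵖ [] → ⟦ p ⟧ ≃ zeroPS
  ⟦⟧-zero e = R.trans (⟦⟧-cong e) (R.zeroʳ B)

  modulo-N1 : ∀ {f g p p′} → Rep B f p → p ≈ᵖ p′ → g ≃ ⟦ p′ ⟧ → inN1 (f ⊕ g)
  modulo-N1 {f} {g} {p} {p′} (rep ν e) e′ e″ = inN1⁺ ν (R.trans (⊕≃⊞ f g) (R.trans (R.+-cong (R.trans e (R.+-congʳ (⟦⟧-cong e′))) e″)
    (ring (⟦ p′ ⟧ ∷ G ⊠ ev ν y ∷ []) ((:x :+ :y) :+ :x) :y refl)))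

  modulo-N1-zero : ∀ {f p} → Rep B f p → p ≈ᵖ [] → inN1 f
  modulo-N1-zero {f} {p} (rep ν e) e′ = inN1⁺ ν (R.trans e (R.trans (R.+-congʳ (⟦⟧-zero e′)) (R.+-identityˡ _)))

  sumFam≃ : ∀ l → sumFam m l ≃ ⟦ sumCells l ⟧
  sumFam≃ [] = R.sym (R.trans (R.reflexive (cong ⟦_⟧ sumCells-[])) (R.zeroʳ B))
  sumFam≃ ((i , j) ∷ l) = R.trans (⊕≃⊞ (m i j) (sumFam m l)) (R.trans (R.+-congˡ (sumFam≃ l))
    (R.trans (R.sym (R.distribˡ B (ev (cell i j) y) (ev (sumCells l) y))) (R.*-congˡ
      (R.sym (R.trans (R.reflexive (cong (λ p → ev p y) (sumCells-∷ i j l))) (ev-∔ (cell i j) (sumCells l) y))))))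

  adapted : ∀ (inV : PS → Set) → (∀ f p → f ≃ ⟦ p ⟧ → inV f) → (∀ f → inV f → ∃[ p ] Rep B f p) → AdaptedBasis inV inN1 (T 7) (T 13) m
  adapted inV intro elim = record
    { mem = λ i j → intro (m i j) (cell i j) R.refl
    ; X-suc = λ i j → modulo-N1 (T₇-X (cell (suc i) j)) (X-suc i j) R.refl
    ; X-zero = λ j → modulo-N1-zero (T₇-X (cell zero j)) (X-zero j)
    ; Y-suc = λ i j → modulo-N1 (T₁₃-Y (cell i (suc j))) (Y-suc i j) R.refl
    ; Y-zero = λ i → modulo-N1-zero (T₁₃-Y (cell i zero)) (Y-zero i)
    ; indep = λ l u n → independent l u (free (sumCells l) (proj₁ (inN1⁻ n)) (R.trans (R.sym (sumFam≃ l)) (proj₂ (inN1⁻ n))))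
    ; span = λ f v → spans f (elim f v) }
    where
    spans : ∀ f → ∃[ p ] Rep B f p → ∃[ l ] inN1 (f ⊕ sumFam m l)
    spans f (p , rp) = proj₁ (spanned p) , modulo-N1 {f} {sumFam m (proj₁ (spanned p))} rp (proj₂ (spanned p)) (sumFam≃ (proj₁ (spanned p)))

  m₀₀ : m 0 0 ≃ B
  m₀₀ = R.trans (R.reflexive (cong ⟦_⟧ cell-0-0)) (R.trans (R.*-congˡ (R.trans (R.+-congˡ (R.zeroʳ y)) (R.+-identityʳ _))) (R.*-identityʳ B))

  m₀₀-class : ∀ {B′} → B ≃ B′ → inN1 (m 0 0 ⊕ B′)
  m₀₀-class {B′} e = inN1⁺ [] (R.trans (⊕≃⊞ (m 0 0) B′) (R.trans (R.+-congʳ (R.trans m₀₀ e)) (R.trans (+-self B′) (R.sym (R.zeroʳ G)))))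

module Conclude (B : PS) (j : ℕ) (j<6 : j < 6) (B-j : B j ≡ true) (triangular : B 3 ∧ G j ≡ false)
  (init-7 init-13 : List Poly)
  (action-7 : ∀ n → Rep B (T 7 (B ⊠ y ^ n)) (nth (iterate m₇ init-7 n) 0))
  (action-13 : ∀ n → Rep B (T 13 (B ⊠ y ^ n)) (nth (iterate m₁₃ init-13 n) 0))
  (X-0 : nth init-7 0 ≈ᵖ []) (Y-0 : nth init-13 0 ≈ᵖ [])
  (X-A : ∀ n n′ → co (nth (iterate m₇ init-7 n) 0) n′ xor symA (code n) (code n′) ≡ true → deg₀ (code n′) + 3 ≤ deg₀ (code n))
  (Y-B : ∀ n n′ → co (nth (iterate m₁₃ init-13 n) 0) n′ xor symB (code n) (code n′) ≡ true → deg₀ (code n′) + 4 ≤ deg₀ (code n)) where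

  Xr Yr : ℕ → Poly
  Xr n = nth (iterate m₇ init-7 n) 0
  Yr n = nth (iterate m₁₃ init-13 n) 0

  open Free B j j<6 B-j triangular
  module L₇ = Linear 7 B Xr action-7
  module L₁₃ = Linear 13 B Yr action-13

  Rep-N : ∀ {f p} ν → Rep G f p → Rep B (f ⊞ G ⊠ ev ν y) []
  Rep-N {f} {p} ν (rep ν′ e) = rep ((p +ᵖ ν′) +ᵖ ν) (R.trans (R.+-congʳ e)
    (R.trans (ring (G ∷ ev p y ∷ ev ν′ y ∷ ev ν y ∷ []) ((:x :* :y :+ :x :* :z) :+ :x :* :w) (:x :* ((:y :+ :z) :+ :w)) refl)
    (R.sym (R.trans (R.+-cong (R.zeroʳ B) (R.*-congˡ (R.trans (eval-add 1 (y ∷ []) (p +ᵖ ν′) ν) (R.+-congʳ (eval-add 1 (y ∷ []) p ν′))))) (R.+-identityˡ _)))))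

  compose-action : ∀ q → .{{_ : NonZero q}} → (Zr : ℕ → Poly) → (∀ f → Rep B (T q (B ⊠ ev f y)) (linear Zr f)) →
    (Zg : ℕ → Poly) → (∀ f → Rep G (T q (G ⊠ ev f y)) (linear Zg f)) →
    ∀ {f p} → Rep B f p → Rep B (T q f) (linear Zr p)
  compose-action q Zr on-B Zg on-G {f} {p} (rep ν e) = subst (Rep B (T q f)) (add-[] (linear Zr p))
    (Rep-resp (R.sym (R.trans (T-cong q e) (T-⊞ q _ _))) (Rep-⊞ (on-B p) (Rep-resp (R.+-identityʳ _) (Rep-resp (R.+-congˡ (R.zeroʳ G)) (Rep-N [] (on-G ν))))))
    where
    add-[] : ∀ p → p +ᵖ [] ≡ p
    add-[] [] = refl
    add-[] (c ∷ p) = refl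

  T₇-Rep : ∀ {f p} → Rep B f p → Rep B (T 7 f) (linear Xr p)
  T₇-Rep = compose-action 7 Xr L₇.T-linear (λ n → nth (iterate m₇ init-G-7 n) 0) L-7.T-linear

  T₁₃-Rep : ∀ {f p} → Rep B f p → Rep B (T 13 f) (linear Yr p)
  T₁₃-Rep = compose-action 13 Yr L₁₃.T-linear (λ n → nth (iterate m₁₃ init-G-13 n) 0) L-13.T-linear

  -- The Hecke operators commute on power series. Both composites applied to B yⁿ have
  -- representatives modulo N1, and these are unique by freeness over 𝔽₂[y].
  XY-comm : ∀ n → linear Xr (Yr n) ≈ᵖ linear Yr (Xr n)
  XY-comm n = Rep-unique (T₇-Rep (action-13 n))
    (Rep-resp (T-T-comm 13 7 (from-yes (coprime? 13 7)) (from-yes (coprime? 7 13)) (B ⊠ y ^ n)) (T₁₃-Rep (action-7 n)))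

  module Ad = Adapted Xr Yr X-0 Y-0 X-A Y-B XY-comm

  open Transfer B Ad.X Ad.Y L₇.T-linear L₁₃.T-linear free Ad.cell Ad.sumCells refl (λ i j l → refl) refl
    (λ i j → Ad.X-cell (suc i) j) (Ad.X-cell 0) (λ i j → Ad.Y-cell i (suc j)) (λ i → Ad.Y-cell i 0)
    Ad.independent Ad.spanned public

symbol-A : ∀ v v′ → symbol (true , false , false) v v′ ≡ symA v v′
symbol-A v v′ = xor-identityʳ _

symbol-B : ∀ v v′ → symbol (false , true , false) v v′ ≡ symB v v′
symbol-B v v′ = xor-identityʳ _

module K₁ = Conclude F 1 (s≤s (s≤s z≤n)) refl (∧-zeroʳ (F 3)) init₁-7 init₁-13 action₁-7 action₁-13 reflᵖ reflᵖ
  -- The certified drop is 4 and the required one is 3, one more than the weight of a. For T 13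
  -- below, the certified drop is 5 and the required one is 4, one more than the weight of b.
  (λ n n′ e → ℕₚ.≤-trans (ℕₚ.+-monoʳ-≤ (deg₀ (code n′)) (s≤s (s≤s (s≤s z≤n)))) (proj₁ (C₇.lowers 18 (from-yes (18 ℕₚ.<? 20)) n n′
    (trans (cong (co (nth (iterate m₇ init₁-7 n) 0) n′ xor_) (symbol-A (code n) (code n′))) e))))
  (λ n n′ e → ℕₚ.≤-trans (ℕₚ.+-monoʳ-≤ (deg₀ (code n′)) (s≤s (s≤s (s≤s (s≤s z≤n))))) (proj₁ (C₁₃.lowers 30 (from-yes (30 ℕₚ.<? 32)) n n′
    (trans (cong (co (nth (iterate m₁₃ init₁-13 n) 0) n′ xor_) (symbol-B (code n) (code n′))) e))))

module K₅ = Conclude B₅ 5 (s≤s (s≤s (s≤s (s≤s (s≤s (s≤s z≤n)))))) B₅-5 (cong (_∧ G 5) B₅-3) init₅-7 init₅-13 action₅-7 action₅-13 reflᵖ reflᵖ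
  (λ n n′ e → ℕₚ.≤-trans (ℕₚ.+-monoʳ-≤ (deg₀ (code n′)) (s≤s (s≤s (s≤s z≤n)))) (proj₁ (C₇.lowers 19 (from-yes (19 ℕₚ.<? 20)) n n′
    (trans (cong (co (nth (iterate m₇ init₅-7 n) 0) n′ xor_) (symbol-A (code n) (code n′))) e))))
  (λ n n′ e → ℕₚ.≤-trans (ℕₚ.+-monoʳ-≤ (deg₀ (code n′)) (s≤s (s≤s (s≤s (s≤s z≤n))))) (proj₁ (C₁₃.lowers 31 (from-yes (31 ℕₚ.<? 32)) n n′
    (trans (cong (co (nth (iterate m₁₃ init₅-13 n) 0) n′ xor_) (symbol-B (code n) (code n′))) e))))

Rep-of-sum : ∀ {f B} ν p → f ≃ G ⊠ ev ν y ⊞ B ⊠ ev p y → Rep B f p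
Rep-of-sum ν p e = rep ν (R.trans e (R.+-comm _ _))

sum-of-multiple : ∀ {f B} p → f ≃ B ⊠ ev p y → f ≃ G ⊠ ev [] y ⊞ B ⊠ ev p y
sum-of-multiple p e = R.trans e (R.sym (R.trans (R.+-congʳ (R.zeroʳ G)) (R.+-identityˡ _)))

theorem4p13 : (∃[ m ] (AdaptedBasis inK1 inN1 (T 7) (T 13) m × inN1 (m 0 0 ⊕ F)))
    × (∃[ m ] (AdaptedBasis inK5 inN1 (T 7) (T 13) m × inN1 (m 0 0 ⊕ F ⊛ F ⊛ G)))
theorem4p13 =
  (K₁.m , K₁.adapted inK1 (λ f p e → [] , p , inSpan⁺ F [] p (sum-of-multiple p e)) (λ { f (ν , p , e) → p , Rep-of-sum ν p (inSpan⁻ F ν p e) })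
        , K₁.m₀₀-class R.refl) ,
  (K₅.m , K₅.adapted inK5 (λ f p e → [] , p , inSpan⁺ (F ⊛ F ⊛ G) [] p (sum-of-multiple p (R.trans e (R.*-congʳ B₅≃))))
            (λ { f (ν , p , e) → p , Rep-of-sum ν p (R.trans (inSpan⁻ (F ⊛ F ⊛ G) ν p e) (R.+-congˡ (R.*-congʳ (R.sym B₅≃)))) })
        , K₅.m₀₀-class B₅≃)
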